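{- Let $\mathcal{D}=(\mathcal{P},\mathcal{B})$ be a nontrivial $2$-$(v,k,\lambda)$ design admitting a flag-transitive, point-imprimitive group of automorphisms. Then $k\leq 2\lambda^2(\lambda-1)$ and $v\leq \left(2\lambda^2(\lambda-1)-2\right)^2$.
   Context: A $2$-$(v,k,\lambda)$ design $\mathcal{D}=(\mathcal{P},\mathcal{B})$ consists of a set $\mathcal{P}$ of $v$ points and a set $\mathcal{B}$ of $k$-subsets of $\mathcal{P}$ (blocks) such that every pair of distinct points lies in exactly $\lambda$ blocks; it is nontrivial if $2<k<v$. An automorphism is a permutation of $\mathcal{P}$ preserving $\mathcal{B}$. A flag is a pair $(\alpha,B)$ with $\alpha\in B\in\mathcal{B}$; a group $G$ of automorphisms is flag-transitive if it is transitive on flags, and point-imprimitive if it leaves invariant some partition of $\mathcal{P}$ other than the partition into singletons and the partition $\{\mathcal{P}\}$. -}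

module Defs where

open import Data.Nat using (ℕ; _<_; _≤_; _*_; _∸_; _^_)
open import Data.Fin using (Fin)
open import Data.Fin.Subset using (Subset; _∈_; ∣_∣)
open import Data.Fin.Permutation using (Permutation′; _⟨$⟩ʳ_; _⟨$⟩ˡ_; id; flip; _∘ₚ_)
open import Data.Bool using (_∧_)
open import Data.Vec using (lookup; tabulate)
open import Data.Product using (Σ; ∃; ∃₂; _×_)
open import Relation.Binary.PropositionalEquality using (_≡_; _≢_)
open import Relation.Nullary using (¬_)
open import Function.Definitions using (Injective)

-- A finite incidence structure: point set Fin v, and a *set* of blocks given
-- as an injective family  Fin b → Subset v  (injectivity = no repeated blocks).
record Structure (v : ℕ) : Set where
  field
    b      : ℕ
    block  : Fin b → Subset v
    block-injective : Injective _≡_ _≡_ block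

open Structure public

blocksThrough : ∀ {v} (D : Structure v) → Fin v → Fin v → Subset (b D)
blocksThrough D x y = tabulate (λ j → lookup (block D j) x ∧ lookup (block D j) y)

record Is2Design {v : ℕ} (D : Structure v) (k lam : ℕ) : Set where
  field
    blocks-nonempty : 1 ≤ b D
    block-size      : ∀ j → ∣ block D j ∣ ≡ k
    balanced        : ∀ x y → x ≢ y → ∣ blocksThrough D x y ∣ ≡ lam

image : ∀ {v} → Permutation′ v → Subset v → Subset v
image σ S = tabulate (λ y → lookup S (σ ⟨$⟩ˡ y))

IsAutomorphism : ∀ {v} (D : Structure v) → Permutation′ v → Set
IsAutomorphism D σ = ∀ j → ∃ λ l → image σ (block D j) ≡ block D l

record IsAutGroup {v : ℕ} (D : Structure v) (G : Permutation′ v → Set) : Set where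
  field
    aut    : ∀ σ → G σ → IsAutomorphism D σ
    has-id : G id
    closed-∘ : ∀ σ τ → G σ → G τ → G (σ ∘ₚ τ)
    closed-⁻¹ : ∀ σ → G σ → G (flip σ)

FlagTransitive : ∀ {v} (D : Structure v) (G : Permutation′ v → Set) → Set
FlagTransitive D G =
  ∀ x j y l → x ∈ block D j → y ∈ block D l →
  ∃ λ σ → G σ × (σ ⟨$⟩ʳ x ≡ y) × (image σ (block D j) ≡ block D l)

-- Point-imprimitivity: there is a G-invariant partition of the points,
-- given by class labels c : Fin v → ℕ (x ~ y iff c x ≡ c y), that is neither
-- the partition into singletons nor the one-class partition.
PointImprimitive : ∀ {v} (G : Permutation′ v → Set) → Set
PointImprimitive {v} G =
  Σ (Fin v → ℕ) λ c →
    (∀ σ → G σ → ∀ x y → c x ≡ c y → c (σ ⟨$⟩ʳ x) ≡ c (σ ⟨$⟩ʳ y))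
    × (∃₂ λ x y → x ≢ y × c x ≡ c y)
    × (∃₂ λ x y → c x ≢ c y)

{-# OPTIONS --safe #-}

-- Every block meets a class in 0 or ℓ points.  Let s be the class size, d the number of
-- classes, e = ℓ − 1 and x = k − 1 − d e.  Counting gives x (s − 1) = e (d − 1) and
-- r x = λ (d − 1), so Fisher's inequality r ≥ k yields x e < λ, and v = d s ≤ (k − 2)².
-- Modulo k one has e d ≡ −(x + 1), e (d − 1) ≡ −(x + ℓ) and x s ≡ −ℓ, so b k = v r implies
-- k ∣ λ ℓ (x + 1)(x + ℓ).  If x e ≤ λ − 2 this is the claimed bound; if x e = λ − 1 it leaves,
-- besides the bound, only the parameters (v, k, λ) = (100, 12, 2), (484, 24, 2) and
-- (12321, 225, 5).
--
-- In these three cases d = s = ℓ p with p = 5, 11, 37, ℓ = 2, 2, 3.  By Cauchy's theorem the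
-- stabilizer of a class contains an element g of order p.  It moves some class, and fixes at
-- least p of them, since ℓ p < p².  By an argument of Jordan such an element makes stabilizers
-- of classes multiply transitive, and then the number of blocks meeting suitable sets of
-- classes fails to be an integer.

module Submission where

open import Defs
open import Data.Fin using (Fin; zero; suc; toℕ; fromℕ<; punchIn; combine; remQuot)
open import Data.Fin.Properties using (any?; all?; toℕ<n; toℕ-fromℕ<; toℕ-injective; remQuot-combine; combine-remQuot) renaming (_≟_ to _≟ᶠ_; suc-injective to sucᶠ-injective)
open import Data.Product using (∃; _×_; _,_; proj₁; proj₂)
open import Data.Sum using (_⊎_; inj₁; inj₂; [_,_]′)
open import Data.Unit using (⊤; tt)
open import Data.Empty using (⊥; ⊥-elim)
open import Relation.Nullary using (¬_; Dec; yes; no; contradiction)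
open import Relation.Nullary.Decidable using (_×-dec_; _⊎-dec_; _→-dec_; ¬?; decidable-stable; from-yes; from-no; toWitness; ¬¬-excluded-middle)
open import Relation.Nullary.Negation using (¬¬-map)
open import Relation.Unary using (Decidable)
open import Relation.Binary using (tri<; tri≈; tri>)
open import Relation.Binary.PropositionalEquality

-- The parameter arithmetic uses the group only through the constancy of ℓ; beyond that the group
-- serves to exclude three parameter sets. There the goal is a contradiction, so G may be listed
-- under a double negation and its elements counted.
--
-- Why an element g of order p moves some class: if it fixed all of them, it would send each block
-- to a block meeting the same classes. The number of blocks through a point that meet the same
-- classes as a given one is forced by divisibility to be 1, or possibly 2 when ℓ = 2. If it is 1,
-- the block through x and g x is fixed by g and contains p > ℓ points of one class. If it is 2, the
-- other s - 1 points of a class fall into pairs, although s is even.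
--
-- Jordan's argument rests on the fact that two p-cycles among fewer than 2p points meet. With 2p
-- classes this holds once one class is fixed. With 111 = 3p classes, 110 remain and the bound 74 is
-- exceeded; hence the separate treatment of orbits of length 55 and 110, the latter by counting
-- pairs of classes met by a block.

-- Counting subsets of finite sets.

module Counting where

  open import Data.Nat
  open import Data.Nat.Properties
  open import Data.Nat.Divisibility
  open import Algebra.Properties.Semiring.Sum +-*-semiring using (sum; ∑-comm; ∑-distrib-+; sum-cong-≗; *-distribʳ-sum) public

  private
    variable
      m n : ℕ

  ind : {A : Set} → Dec A → ℕ
  ind (yes _) = 1
  ind (no _)  = 0

  ind-yes : {A : Set} (a? : Dec A) → A → ind a? ≡ 1
  ind-yes (yes _) a = refl
  ind-yes (no ¬a) a = contradiction a ¬a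

  ind-no : {A : Set} (a? : Dec A) → ¬ A → ind a? ≡ 0
  ind-no (yes a) ¬a = contradiction a ¬a
  ind-no (no _)  ¬a = refl

  ind-mono : {A B : Set} (a? : Dec A) (b? : Dec B) → (A → B) → ind a? ≤ ind b?
  ind-mono (yes a) b? f = ≤-reflexive (sym (ind-yes b? (f a)))
  ind-mono (no _)  b? f = z≤n

  ind-cong : {A B : Set} (a? : Dec A) (b? : Dec B) → (A → B) → (B → A) → ind a? ≡ ind b?
  ind-cong a? b? f g = ≤-antisym (ind-mono a? b? f) (ind-mono b? a? g)

  ind-× : {A B : Set} (a? : Dec A) (b? : Dec B) → ind (a? ×-dec b?) ≡ ind a? * ind b?
  ind-× (yes a) (yes b) = refl
  ind-× (yes a) (no ¬b) = refl
  ind-× (no ¬a) (yes b) = refl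
  ind-× (no ¬a) (no ¬b) = refl

  sum-mono : {f g : Fin n → ℕ} → (∀ i → f i ≤ g i) → sum f ≤ sum g
  sum-mono {zero}  h = z≤n
  sum-mono {suc n} h = +-mono-≤ (h zero) (sum-mono (λ i → h (suc i)))

  sum-≡0 : {f : Fin n → ℕ} → (∀ i → f i ≡ 0) → sum f ≡ 0
  sum-≡0 {zero}  h = refl
  sum-≡0 {suc n} h = cong₂ _+_ (h zero) (sum-≡0 (λ i → h (suc i)))

  term≤sum : (f : Fin n → ℕ) (i : Fin n) → f i ≤ sum f
  term≤sum f zero    = m≤m+n _ _
  term≤sum f (suc i) = ≤-trans (term≤sum (λ j → f (suc j)) i) (m≤n+m _ (f zero))

  opaque
    count : {P : Fin n → Set} → Decidable P → ℕ
    count P? = sum (λ i → ind (P? i))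

    count≡sum : {P : Fin n → Set} (P? : Decidable P) → count P? ≡ sum (λ i → ind (P? i))
    count≡sum P? = refl

    count-mono : {P Q : Fin n → Set} (P? : Decidable P) (Q? : Decidable Q) →
                 (∀ i → P i → Q i) → count P? ≤ count Q?
    count-mono P? Q? f = sum-mono (λ i → ind-mono (P? i) (Q? i) (f i))

    count-cong : {P Q : Fin n → Set} (P? : Decidable P) (Q? : Decidable Q) →
                 (∀ i → P i → Q i) → (∀ i → Q i → P i) → count P? ≡ count Q?
    count-cong P? Q? f g = ≤-antisym (count-mono P? Q? f) (count-mono Q? P? g)

    count-split : {P Q : Fin n → Set} (P? : Decidable P) (Q? : Decidable Q) →
      count P? ≡ count (λ i → P? i ×-dec Q? i) + count (λ i → P? i ×-dec ¬? (Q? i))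
    count-split P? Q? = trans (sum-cong-≗ step) (∑-distrib-+ (λ i → ind (P? i ×-dec Q? i)) (λ i → ind (P? i ×-dec ¬? (Q? i))))
      where
      step : ∀ i → ind (P? i) ≡ ind (P? i ×-dec Q? i) + ind (P? i ×-dec ¬? (Q? i))
      step i with P? i | Q? i
      ... | yes _ | yes _ = refl
      ... | yes _ | no _  = refl
      ... | no _  | yes _ = refl
      ... | no _  | no _  = refl

    count-⊎ : {P Q : Fin n → Set} (P? : Decidable P) (Q? : Decidable Q) →
      (∀ i → P i → ¬ Q i) → count (λ i → P? i ⊎-dec Q? i) ≡ count P? + count Q?
    count-⊎ P? Q? dis = trans (sum-cong-≗ step) (∑-distrib-+ (λ i → ind (P? i)) (λ i → ind (Q? i)))
      where
      step : ∀ i → ind (P? i ⊎-dec Q? i) ≡ ind (P? i) + ind (Q? i)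
      step i with P? i | Q? i
      ... | yes p | yes q = contradiction q (dis i p)
      ... | yes _ | no _  = refl
      ... | no _  | yes _ = refl
      ... | no _  | no _  = refl

    count-all : {P : Fin n → Set} (P? : Decidable P) → (∀ i → P i) → count P? ≡ n
    count-all {zero}  P? all = refl
    count-all {suc n} P? all =
      cong₂ _+_ (ind-yes (P? zero) (all zero)) (count-all (λ i → P? (suc i)) (λ i → all (suc i)))

    count-none : {P : Fin n → Set} (P? : Decidable P) → (∀ i → ¬ P i) → count P? ≡ 0
    count-none P? none = sum-≡0 (λ i → ind-no (P? i) (none i))

    count-pos : {P : Fin n → Set} (P? : Decidable P) (i : Fin n) → P i → 1 ≤ count P?
    count-pos P? i p =
      ≤-trans (≤-reflexive (sym (ind-yes (P? i) p))) (term≤sum (λ j → ind (P? j)) i)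

    count-witness : {P : Fin n → Set} (P? : Decidable P) → 1 ≤ count P? → ∃ P
    count-witness P? le with any? P?
    ... | yes w = w
    ... | no ¬w = contradiction le (<⇒≱ (s≤s (≤-reflexive (count-none P? (λ i p → ¬w (i , p))))))

    count-≤1 : {P : Fin n → Set} (P? : Decidable P) → (∀ i j → P i → P j → i ≡ j) → count P? ≤ 1
    count-≤1 {zero}  P? uniq = z≤n
    count-≤1 {suc n} P? uniq with P? zero
    ... | yes p = ≤-reflexive (cong suc (count-none (λ i → P? (suc i))
                    (λ i q → contradiction (uniq zero (suc i) p q) λ ())))
    ... | no ¬p = count-≤1 (λ i → P? (suc i)) (λ i j p q → suc-inj (uniq (suc i) (suc j) p q))
      where
      suc-inj : ∀ {i j : Fin n} → suc i ≡ suc j → i ≡ j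
      suc-inj refl = refl

    count-unique : {P : Fin n → Set} (P? : Decidable P) (i : Fin n) → P i →
                   (∀ j → P j → j ≡ i) → count P? ≡ 1
    count-unique P? i p uniq =
      ≤-antisym (count-≤1 P? (λ j k pj pk → trans (uniq j pj) (sym (uniq k pk)))) (count-pos P? i p)

  count-≡ : (i : Fin n) → count (λ j → j ≟ᶠ i) ≡ 1
  count-≡ i = count-unique (λ j → j ≟ᶠ i) i refl (λ _ e → e)

  opaque
    unfolding count

    sum-on : {P : Fin n → Set} (P? : Decidable P) (f : Fin n → ℕ) (s : ℕ) →
      (∀ i → P i → f i ≡ s) → (∀ i → ¬ P i → f i ≡ 0) → sum f ≡ count P? * s
    sum-on P? f s on off = trans (sum-cong-≗ step) (sym (*-distribʳ-sum s (λ i → ind (P? i))))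
      where
      step : ∀ i → f i ≡ ind (P? i) * s
      step i with P? i
      ... | yes p = trans (on i p) (sym (+-identityʳ s))
      ... | no ¬p = off i ¬p

    double-count : {R : Fin m → Fin n → Set} (R? : ∀ i j → Dec (R i j)) →
      sum (λ i → count (λ j → R? i j)) ≡ sum (λ j → count (λ i → R? i j))
    double-count R? = ∑-comm (λ i j → ind (R? i j))

    -- Double counting of the edges of a bipartite graph. Nearly every parameter identity below is
    -- an instance.
    biregular : {P : Fin m → Set} {Q : Fin n → Set} {R : Fin m → Fin n → Set}
      (P? : Decidable P) (Q? : Decidable Q) (R? : ∀ i j → Dec (R i j)) (s t : ℕ) →
      (∀ i → P i → count (λ j → Q? j ×-dec R? i j) ≡ s) →
      (∀ j → Q j → count (λ i → P? i ×-dec R? i j) ≡ t) →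
      count P? * s ≡ count Q? * t
    biregular {m} {n} {P} {Q} {R} P? Q? R? s t rows cols = begin
      count P? * s                      ≡⟨ sym (sum-on P? _ s
          (λ i p → trans (count-cong (T? i) (λ j → Q? j ×-dec R? i j) (λ j → proj₂) (λ j w → p , w)) (rows i p))
          (λ i ¬p → count-none (T? i) (λ j w → ¬p (proj₁ w)))) ⟩
      sum (λ i → count (T? i))          ≡⟨ double-count T? ⟩
      sum (λ j → count (λ i → T? i j))  ≡⟨ sum-on Q? _ t
          (λ j q → trans (count-cong (λ i → T? i j) (λ i → P? i ×-dec R? i j)
              (λ i w → proj₁ w , proj₂ (proj₂ w)) (λ i w → proj₁ w , q , proj₂ w)) (cols j q))
          (λ j ¬q → count-none (λ i → T? i j) (λ i w → ¬q (proj₁ (proj₂ w)))) ⟩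
      count Q? * t ∎
      where
      open ≡-Reasoning
      T? : ∀ i j → Dec (P i × Q j × R i j)
      T? i j = P? i ×-dec (Q? j ×-dec R? i j)

    count-inj : {P : Fin m → Set} {Q : Fin n → Set} (P? : Decidable P) (Q? : Decidable Q)
      (f : Fin m → Fin n) → (∀ i → P i → Q (f i)) →
      (∀ i j → P i → P j → f i ≡ f j → i ≡ j) → count P? ≤ count Q?
    count-inj {P = P} P? Q? f maps inj = begin
      count P?                                            ≡⟨ sum-cong-≗ row ⟩
      sum (λ i → count (λ j → P? i ×-dec (j ≟ᶠ f i)))     ≡⟨ double-count (λ i j → P? i ×-dec (j ≟ᶠ f i)) ⟩
      sum (λ j → count (λ i → P? i ×-dec (j ≟ᶠ f i)))     ≤⟨ sum-mono col ⟩
      count Q? ∎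
      where
      open ≤-Reasoning
      row : ∀ i → ind (P? i) ≡ count (λ j → P? i ×-dec (j ≟ᶠ f i))
      row i with P? i
      ... | yes p = sym (count-unique (λ j → yes p ×-dec (j ≟ᶠ f i)) (f i) (p , refl) (λ j w → proj₂ w))
      ... | no ¬p = sym (count-none (λ j → no ¬p ×-dec (j ≟ᶠ f i)) (λ j w → ¬p (proj₁ w)))
      col : ∀ j → count (λ i → P? i ×-dec (j ≟ᶠ f i)) ≤ ind (Q? j)
      col j with Q? j
      ... | yes q = count-≤1 (λ i → P? i ×-dec (j ≟ᶠ f i))
                      (λ i i′ w w′ → inj i i′ (proj₁ w) (proj₁ w′) (trans (sym (proj₂ w)) (proj₂ w′)))
      ... | no ¬q = ≤-reflexive (count-none (λ i → P? i ×-dec (j ≟ᶠ f i))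
                      (λ i w → ¬q (subst _ (sym (proj₂ w)) (maps i (proj₁ w)))))

    count-surj : {P : Fin m → Set} {Q : Fin n → Set} (P? : Decidable P) (Q? : Decidable Q)
      (f : Fin m → Fin n) → (∀ j → Q j → ∃ λ i → P i × f i ≡ j) → count Q? ≤ count P?
    count-surj {P = P} {Q} P? Q? f onto = begin
      count Q?                                            ≤⟨ sum-mono col ⟩
      sum (λ j → count (λ i → P? i ×-dec (f i ≟ᶠ j)))     ≡⟨ sym (double-count (λ i j → P? i ×-dec (f i ≟ᶠ j))) ⟩
      sum (λ i → count (λ j → P? i ×-dec (f i ≟ᶠ j)))     ≤⟨ sum-mono row ⟩
      count P? ∎
      where
      open ≤-Reasoning
      col : ∀ j → ind (Q? j) ≤ count (λ i → P? i ×-dec (f i ≟ᶠ j))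
      col j with Q? j
      ... | yes q = let i , p , e = onto j q in count-pos (λ i → P? i ×-dec (f i ≟ᶠ j)) i (p , e)
      ... | no ¬q = z≤n
      row : ∀ i → count (λ j → P? i ×-dec (f i ≟ᶠ j)) ≤ ind (P? i)
      row i with P? i
      ... | yes p = count-≤1 (λ j → yes p ×-dec (f i ≟ᶠ j)) (λ j k w w′ → trans (sym (proj₂ w)) (proj₂ w′))
      ... | no ¬p = ≤-reflexive (count-none (λ j → no ¬p ×-dec (f i ≟ᶠ j)) (λ j w → ¬p (proj₁ w)))

    count-bij : {P : Fin m → Set} {Q : Fin n → Set} (P? : Decidable P) (Q? : Decidable Q)
      (f : Fin m → Fin n) → (∀ i → P i → Q (f i)) →
      (∀ i j → P i → P j → f i ≡ f j → i ≡ j) → (∀ j → Q j → ∃ λ i → P i × f i ≡ j) →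
      count P? ≡ count Q?
    count-bij P? Q? f maps inj onto =
      ≤-antisym (count-inj P? Q? f maps inj) (count-surj P? Q? f onto)

  count-fibres : {P : Fin m → Set} {Q : Fin n → Set} (P? : Decidable P) (Q? : Decidable Q)
    (f : Fin m → Fin n) (s : ℕ) → (∀ i → P i → Q (f i)) →
    (∀ j → Q j → count (λ i → P? i ×-dec (f i ≟ᶠ j)) ≡ s) → count P? ≡ count Q? * s
  count-fibres P? Q? f s maps fib = trans (sym (*-identityʳ (count P?)))
    (biregular P? Q? (λ i j → f i ≟ᶠ j) 1 s
      (λ i p → count-unique (λ j → Q? j ×-dec (f i ≟ᶠ j)) (f i) (maps i p , refl) (λ j w → sym (proj₂ w)))
      fib)

  count-< : {P Q : Fin n → Set} (P? : Decidable P) (Q? : Decidable Q) →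
    (∀ i → P i → Q i) → (i : Fin n) → Q i → ¬ P i → count P? < count Q?
  count-< {P = P} {Q} P? Q? sub i q ¬p = begin-strict
    count P?                                                   ≡⟨ count-cong P? (λ j → Q? j ×-dec P? j) (λ j p → sub j p , p) (λ j → proj₂) ⟩
    count (λ j → Q? j ×-dec P? j)                              <⟨ m<m+n _ (count-pos (λ j → Q? j ×-dec ¬? (P? j)) i (q , ¬p)) ⟩
    count (λ j → Q? j ×-dec P? j) + count (λ j → Q? j ×-dec ¬? (P? j))  ≡⟨ sym (count-split Q? P?) ⟩
    count Q? ∎
    where open ≤-Reasoning

  count-full : {P Q : Fin n → Set} (P? : Decidable P) (Q? : Decidable Q) →
    (∀ i → P i → Q i) → count Q? ≤ count P? → ∀ i → Q i → P i
  count-full P? Q? sub le i q with P? i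
  ... | yes p = p
  ... | no ¬p = contradiction le (<⇒≱ (count-< P? Q? sub i q ¬p))

  -- Pigeonhole; it forces two p-cycles in a set of fewer than 2p points to intersect.
  count-meet : {P Q U : Fin n → Set} (P? : Decidable P) (Q? : Decidable Q) (U? : Decidable U) →
    (∀ i → P i → U i) → (∀ i → Q i → U i) → count U? < count P? + count Q? → ∃ λ i → P i × Q i
  count-meet P? Q? U? pu qu lt with any? (λ i → P? i ×-dec Q? i)
  ... | yes w = w
  ... | no ¬w = contradiction lt (≤⇒≯ (≤-trans
    (≤-reflexive (sym (count-⊎ P? Q? (λ i p q → ¬w (i , p , q)))))
    (count-mono (λ i → P? i ⊎-dec Q? i) U? (λ i → [ pu i , qu i ]′))))

  -- `closed` keeps the class of an element of P inside P, so its size is that of E i with no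
  -- restriction to P.
  record IsEquivalenceOn {n : ℕ} (P : Fin n → Set) (E : Fin n → Fin n → Set) : Set where
    field
      rfl    : ∀ i → P i → E i i
      symm   : ∀ i j → P i → E i j → E j i
      trns   : ∀ i j k → P i → E i j → E j k → E i k
      closed : ∀ i j → P i → E i j → P j

  -- Classes are removed one at a time, by induction on a bound for the number of elements left.
  -- Most divisibilities below come from this.
  class-size-∣-count : {P : Fin n → Set} {E : Fin n → Fin n → Set} (P? : Decidable P)
    (E? : ∀ i j → Dec (E i j)) → IsEquivalenceOn P E → (s : ℕ) →
    (∀ i → P i → count (E? i) ≡ s) → s ∣ count P?
  class-size-∣-count {n} {P} {E} P? E? eq s sizes = go (count P?) P? ≤-refl eq sizes
    where
    go : ∀ fuel {P : Fin n → Set} (P? : Decidable P) → count P? ≤ fuel → IsEquivalenceOn P E →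
         (∀ i → P i → count (E? i) ≡ s) → s ∣ count P?
    go zero    P? le _  _     = subst (s ∣_) (sym (n≤0⇒n≡0 le)) (s ∣0)
    go (suc fuel) {P} P? le eq sizes with any? P?
    ... | no ¬w = subst (s ∣_) (sym (count-none P? (λ i p → ¬w (i , p)))) (s ∣0)
    ... | yes (i , p) = subst (s ∣_) (sym (count-split P? (E? i)))
            (∣m∣n⇒∣m+n (∣-reflexive (sym inside))
              (go fuel rest? (s≤s⁻¹ (≤-trans smaller le)) eq′ (λ j w → sizes j (proj₁ w))))
      where
      open IsEquivalenceOn eq
      rest? = λ j → P? j ×-dec ¬? (E? i j)
      inside : count (λ j → P? j ×-dec E? i j) ≡ s
      inside = trans (count-cong _ (E? i) (λ j → proj₂) (λ j e → closed i j p e , e)) (sizes i p)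
      smaller : count rest? < count P?
      smaller = count-< rest? P? (λ j → proj₁) i p (λ w → proj₂ w (rfl i p))
      eq′ : IsEquivalenceOn (λ j → P j × ¬ E i j) E
      eq′ = record
        { rfl = λ j w → rfl j (proj₁ w)
        ; symm = λ j k w → symm j k (proj₁ w)
        ; trns = λ j k l w → trns j k l (proj₁ w)
        ; closed = λ j k w e → closed j k (proj₁ w) e ,
            λ ik → proj₂ w (trns i k j p ik (symm j k (proj₁ w) e)) }

-- Fisher's inequality by linear algebra over the integers.

module FisherInequality where

  open Counting using (ind; ind-cong; ind-×; count; count≡sum; count-cong) renaming (sum to ℕ-sum)
  open import Data.Nat as ℕ using (ℕ; zero; suc; s≤s)
  import Data.Nat.Properties as ℕ
  open import Data.Integer hiding (suc)
  open import Data.Integer.Properties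
  open import Data.Integer.Tactic.RingSolver using (solve-∀)
  open import Algebra.Properties.Semiring.Sum +-*-semiring
  open import Data.Vec.Functional using (insertAt)
  open import Data.Vec.Functional.Properties using (insertAt-lookup; insertAt-punchIn)

  private
    variable
      m n : ℕ

  sum-zero : {f : Fin n → ℤ} → (∀ i → f i ≡ 0ℤ) → sum f ≡ 0ℤ
  sum-zero {zero}  h = refl
  sum-zero {suc n} h = cong₂ _+_ (h zero) (sum-zero (λ i → h (suc i)))

  -- Gaussian elimination without division: row and column of a nonzero pivot are cleared by
  -- cross-multiplication.
  underdetermined : n ℕ.< m → (A : Fin n → Fin m → ℤ) →
    ∃ λ (u : Fin m → ℤ) → (∃ λ i → u i ≢ 0ℤ) × (∀ j → sum (λ i → A j i * u i) ≡ 0ℤ)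
  underdetermined {zero}  {suc m} _ A = (λ _ → 1ℤ) , (zero , λ ()) , λ ()
  underdetermined {suc n} {suc m} (s≤s n<m) A with any? (λ i → ¬? (A zero i ≟ 0ℤ))
  ... | no none = let u , nz , sol = underdetermined (ℕ.m<n⇒m<1+n n<m) (λ j → A (suc j)) in
    u , nz , λ { zero → sum-zero (λ i → trans (cong (_* u i) (decidable-stable (A zero i ≟ 0ℤ) (λ ne → none (i , ne)))) (*-zeroˡ (u i)))
               ; (suc j) → sol j }
  ... | yes (i , a≢0) = let w , (l , wl≢0) , sol = underdetermined n<m B in
    u w , (punchIn i l , λ e → wl≢0 (factor w l (trans (sym (u-punchIn w l)) e))) , solves w sol
    where
    a : ℤ
    a = A zero i
    B : Fin n → Fin m → ℤ
    B j l = a * A (suc j) (punchIn i l) - A (suc j) i * A zero (punchIn i l)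
    tail-sum : (Fin m → ℤ) → ℤ
    tail-sum w = sum (λ l → A zero (punchIn i l) * w l)
    -- Back-substitution without fractions: a solution w of the reduced system is scaled by the
    -- pivot a, which makes the pivot coordinate an integer.
    u : (Fin m → ℤ) → Fin (suc m) → ℤ
    u w = insertAt (λ l → a * w l) i (- tail-sum w)
    u-punchIn : ∀ w l → u w (punchIn i l) ≡ a * w l
    u-punchIn w l = insertAt-punchIn (λ l → a * w l) i (- tail-sum w) l
    factor : ∀ w l → a * w l ≡ 0ℤ → w l ≡ 0ℤ
    factor w l e = *-cancelˡ-≡ a (w l) 0ℤ {{≢-nonZero a≢0}} (trans e (sym (*-zeroʳ a)))
    expand : ∀ w j → sum (λ i′ → A j i′ * u w i′) ≡ A j i * (- tail-sum w) + sum (λ l → A j (punchIn i l) * (a * w l))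
    expand w j = trans (sum-remove {i = i} (λ i′ → A j i′ * u w i′))
      (cong₂ _+_ (cong (A j i *_) (insertAt-lookup (λ l → a * w l) i (- tail-sum w)))
        (sum-cong-≗ (λ l → cong (A j (punchIn i l) *_) (u-punchIn w l))))
    pull : ∀ w (c : Fin m → ℤ) → sum (λ l → c l * (a * w l)) ≡ a * sum (λ l → c l * w l)
    pull w c = trans (sum-cong-≗ (λ l → swap (c l) a (w l))) (sym (*-distribˡ-sum a (λ l → c l * w l)))
      where
      swap : ∀ x y z → x * (y * z) ≡ y * (x * z)
      swap = solve-∀
    solves : ∀ w → (∀ j → sum (λ l → B j l * w l) ≡ 0ℤ) → ∀ j → sum (λ i′ → A j i′ * u w i′) ≡ 0ℤ
    solves w sol zero = trans (expand w zero) (trans (cong (_+_ (a * (- tail-sum w))) (pull w (λ l → A zero (punchIn i l)))) (cancel a (tail-sum w)))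
      where
      cancel : ∀ a t → a * (- t) + a * t ≡ 0ℤ
      cancel = solve-∀
    solves w sol (suc j) = trans (expand w (suc j)) (trans (cong₂ _+_ (move (A (suc j) i) (tail-sum w)) (pull w (λ l → A (suc j) (punchIn i l))))
      (trans (sym combined) (sol j)))
      where
      move : ∀ x t → x * (- t) ≡ - (x * t)
      move = solve-∀
      combined : sum (λ l → B j l * w l) ≡ - (A (suc j) i * tail-sum w) + a * sum (λ l → A (suc j) (punchIn i l) * w l)
      combined = trans (sum-cong-≗ (λ l → split a (A (suc j) (punchIn i l)) (A (suc j) i) (A zero (punchIn i l)) (w l)))
        (trans (∑-distrib-+ (λ l → (- A (suc j) i) * (A zero (punchIn i l) * w l)) (λ l → a * (A (suc j) (punchIn i l) * w l)))
          (cong₂ _+_ (trans (sym (*-distribˡ-sum (- A (suc j) i) (λ l → A zero (punchIn i l) * w l))) (sym (neg-distribˡ-* (A (suc j) i) (tail-sum w))))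
            (sym (*-distribˡ-sum a (λ l → A (suc j) (punchIn i l) * w l)))))
        where
        split : ∀ a x y z w → (a * x - y * z) * w ≡ (- y) * (z * w) + a * (x * w)
        split = solve-∀

  +-sum : (f : Fin n → ℕ) → + ℕ-sum f ≡ sum (λ i → + f i)
  +-sum {zero}  f = refl
  +-sum {suc n} f = trans (pos-+ (f zero) _) (cong (_+_ (+ f zero)) (+-sum (λ i → f (suc i))))

  -- If all block sums of u vanish, then summing them over the blocks through y gives
  -- (r − λ) u y + λ Σ u = 0; summing over y forces Σ u = 0 and then u = 0.
  fisher : ∀ {v b : ℕ} {I : Fin v → Fin b → Set} (I? : ∀ x j → Dec (I x j)) (r lam : ℕ) → lam ℕ.< r →
    (∀ x → count (I? x) ≡ r) → (∀ {x y} → x ≢ y → count (λ j → I? x j ×-dec I? y j) ≡ lam) → v ℕ.≤ b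
  fisher {v} {b} {I} I? r lam lam<r degree balanced = ℕ.≮⇒≥ (λ b<v → absurd (underdetermined b<v (λ j x → + ind (I? x j))))
    where
    ρ : ℕ
    ρ = r ℕ.∸ lam
    instance
      ρ≢0 : ℕ.NonZero ρ
      ρ≢0 = ℕ.>-nonZero (ℕ.m<n⇒0<n∸m lam<r)
    gram : Fin v → Fin v → ℤ
    gram y x = sum (λ j → + ind (I? y j) * + ind (I? x j))
    gram≡count : ∀ y x → gram y x ≡ + count (λ j → I? y j ×-dec I? x j)
    gram≡count y x = trans (sum-cong-≗ (λ j → trans (sym (pos-* (ind (I? y j)) (ind (I? x j)))) (cong +_ (sym (ind-× (I? y j) (I? x j))))))
      (trans (sym (+-sum (λ j → ind (I? y j ×-dec I? x j)))) (cong +_ (sym (count≡sum (λ j → I? y j ×-dec I? x j)))))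
    -- The incidence matrix times its transpose is (r - λ) I + λ J.
    gram≡ : ∀ y x → gram y x ≡ + lam + + ind (x ≟ᶠ y) * + ρ
    gram≡ y x with x ≟ᶠ y
    ... | yes refl = trans (gram≡count y y) (trans (cong +_ (trans (count-cong _ (I? y) (λ _ → proj₁) (λ _ i → i , i)) (degree y)))
            (trans (cong +_ (sym (ℕ.m+[n∸m]≡n (ℕ.<⇒≤ lam<r)))) (trans (pos-+ lam ρ) (cong (_+_ (+ lam)) (sym (*-identityˡ (+ ρ)))))))
    ... | no ne = trans (gram≡count y x) (trans (cong +_ (balanced (λ e → ne (sym e)))) (sym (trans (cong (_+_ (+ lam)) (*-zeroˡ (+ ρ))) (+-identityʳ (+ lam)))))
    absurd : ¬ ∃ λ (u : Fin v → ℤ) → (∃ λ x → u x ≢ 0ℤ) × (∀ j → sum (λ x → + ind (I? x j) * u x) ≡ 0ℤ)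
    absurd (u , (x₁ , nz) , sol) = nz (vanish x₁)
      where
      U : ℤ
      U = sum u
      pick : ∀ y → sum (λ x → + ind (x ≟ᶠ y) * u x) ≡ u y
      pick y = go y u
        where
        go : ∀ {n} (y : Fin n) (u : Fin n → ℤ) → sum (λ x → + ind (x ≟ᶠ y) * u x) ≡ u y
        go {suc n} zero u = trans (cong₂ _+_ (*-identityˡ (u zero)) (sum-zero (λ i → *-zeroˡ (u (suc i))))) (+-identityʳ (u zero))
        go {suc n} (suc y) u = trans (cong₂ _+_ (*-zeroˡ (u zero)) (trans (sum-cong-≗ (λ x → cong (λ t → + t * u (suc x))
            (ind-cong (suc x ≟ᶠ suc y) (x ≟ᶠ y) (λ { refl → refl }) (λ { refl → refl })))) (go y (λ i → u (suc i))))) (+-identityˡ (u (suc y)))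
      normal : ∀ y → + lam * U + + ρ * u y ≡ 0ℤ
      normal y = begin
        + lam * U + + ρ * u y
          ≡⟨ cong₂ _+_ (*-distribˡ-sum (+ lam) u) (trans (cong (_*_ (+ ρ)) (sym (pick y))) (*-distribˡ-sum (+ ρ) (λ x → + ind (x ≟ᶠ y) * u x))) ⟩
        sum (λ x → + lam * u x) + sum (λ x → + ρ * (+ ind (x ≟ᶠ y) * u x))
          ≡⟨ sym (∑-distrib-+ (λ x → + lam * u x) (λ x → + ρ * (+ ind (x ≟ᶠ y) * u x))) ⟩
        sum (λ x → + lam * u x + + ρ * (+ ind (x ≟ᶠ y) * u x))
          ≡⟨ sum-cong-≗ (λ x → trans (collect (+ lam) (+ ρ) (+ ind (x ≟ᶠ y)) (u x)) (cong (_* u x) (sym (gram≡ y x)))) ⟩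
        sum (λ x → gram y x * u x)
          ≡⟨ sum-cong-≗ (λ x → *-distribʳ-sum (u x) (λ j → + ind (I? y j) * + ind (I? x j))) ⟩
        sum (λ x → sum (λ j → + ind (I? y j) * + ind (I? x j) * u x))
          ≡⟨ ∑-comm (λ x j → + ind (I? y j) * + ind (I? x j) * u x) ⟩
        sum (λ j → sum (λ x → + ind (I? y j) * + ind (I? x j) * u x))
          ≡⟨ sum-zero (λ j → trans (sum-cong-≗ (λ x → *-assoc (+ ind (I? y j)) (+ ind (I? x j)) (u x)))
               (trans (sym (*-distribˡ-sum (+ ind (I? y j)) (λ x → + ind (I? x j) * u x))) (trans (cong (_*_ (+ ind (I? y j))) (sol j)) (*-zeroʳ (+ ind (I? y j)))))) ⟩
        0ℤ ∎
        where
        open ≡-Reasoning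
        collect : ∀ l ρ i u → l * u + ρ * (i * u) ≡ (l + i * ρ) * u
        collect = solve-∀
      sum-const : ∀ n (c : ℤ) → sum {n} (λ _ → c) ≡ + n * c
      sum-const zero    c = sym (*-zeroˡ c)
      sum-const (suc n) c = trans (cong (_+_ c) (sum-const n c)) (sym (trans (cong (_* c) (pos-+ 1 n)) (distrib (+ n) c)))
        where
        distrib : ∀ n c → (1ℤ + n) * c ≡ c + n * c
        distrib = solve-∀
      U-eq : (+ v * + lam + + ρ) * U ≡ 0ℤ
      U-eq = begin
        (+ v * + lam + + ρ) * U                             ≡⟨ expand (+ v) (+ lam) (+ ρ) U ⟩
        + v * (+ lam * U) + + ρ * U                         ≡⟨ cong₂ _+_ (sym (sum-const v (+ lam * U))) (*-distribˡ-sum (+ ρ) u) ⟩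
        sum {v} (λ _ → + lam * U) + sum (λ y → + ρ * u y)   ≡⟨ sym (∑-distrib-+ (λ (_ : Fin v) → + lam * U) (λ y → + ρ * u y)) ⟩
        sum (λ y → + lam * U + + ρ * u y)                   ≡⟨ sum-zero normal ⟩
        0ℤ ∎
        where
        open ≡-Reasoning
        expand : ∀ v l ρ U → (v * l + ρ) * U ≡ v * (l * U) + ρ * U
        expand = solve-∀
      U≡0 : U ≡ 0ℤ
      U≡0 = *-cancelˡ-≡ (+ (v ℕ.* lam ℕ.+ ρ)) U 0ℤ {{ℕ.>-nonZero (ℕ.≤-trans (ℕ.>-nonZero⁻¹ ρ) (ℕ.m≤n+m ρ (v ℕ.* lam)))}}
        (trans (cong (_* U) (trans (pos-+ (v ℕ.* lam) ρ) (cong (λ t → t + + ρ) (pos-* v lam)))) (trans U-eq (sym (*-zeroʳ (+ (v ℕ.* lam ℕ.+ ρ))))))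
      vanish : ∀ y → u y ≡ 0ℤ
      vanish y = *-cancelˡ-≡ (+ ρ) (u y) 0ℤ (trans (trans (sym (+-identityˡ (+ ρ * u y)))
        (trans (cong (λ t → t + + ρ * u y) (sym (trans (cong (_*_ (+ lam)) U≡0) (*-zeroʳ (+ lam))))) (normal y))) (sym (*-zeroʳ (+ ρ))))

open import Data.Nat
open import Data.Nat.Properties
open import Data.Nat.Divisibility
open import Data.Nat.DivMod using (_%_; _/_; m≡m%n+[m/n]*n; m%n<n)
open import Data.Nat.GCD using (module Bézout)
open import Data.Nat.Coprimality using (Coprime; coprime?; coprime-Bézout; coprime-divisor)
open import Data.Nat.Primality using (Prime; prime?; prime[2]; prime⇒nonZero; prime⇒nonTrivial; prime⇒irreducible)
open import Data.Nat.Tactic.RingSolver using (solve-∀)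
open import Data.Bool using (Bool; true; false; _∧_)
import Data.Bool as Bool
open import Data.List using (List; []; _∷_; _++_; length)
open import Data.List.Properties using (++-assoc; ++-identityʳ)
open import Data.Vec using (Vec; []; _∷_; _∷ʳ_; toList; head; tail; lookup; tabulate)
open import Data.Vec.Properties using (≡-dec; cast-is-id; toList-injective; length-toList; toList-∷ʳ; lookup⇒[]=; lookup∘tabulate; tabulate∘lookup; tabulate-cong)
open import Data.Fin.Subset using (Subset; _∈_; ∣_∣)
open import Data.Fin.Permutation using (Permutation′; _⟨$⟩ʳ_; _⟨$⟩ˡ_; flip; inverseˡ; inverseʳ; _∘ₚ_; id)
open Counting
open FisherInequality using (fisher)

-- Maps of prime period

iter : {A : Set} → (A → A) → ℕ → A → A
iter f zero    x = x
iter f (suc n) x = f (iter f n x)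

module _ {A : Set} (f : A → A) where

  iter-+ : ∀ m n x → iter f (m + n) x ≡ iter f m (iter f n x)
  iter-+ zero    n x = refl
  iter-+ (suc m) n x = cong f (iter-+ m n x)

  iter-*-fixed : ∀ m n x → iter f n x ≡ x → iter f (m * n) x ≡ x
  iter-*-fixed zero    n x e = refl
  iter-*-fixed (suc m) n x e =
    trans (iter-+ n (m * n) x) (trans (cong (iter f n) (iter-*-fixed m n x e)) e)

  -- By Bézout 1 + b n = a m, up to exchanging m and n, so one further step leads from x back to x.
  iter-coprime : ∀ m n x → Coprime m n → iter f m x ≡ x → iter f n x ≡ x → f x ≡ x
  iter-coprime m n x c em en with coprime-Bézout c
  ... | Bézout.+- a b eq = trans (cong f (sym (iter-*-fixed b n x en)))
          (trans (cong (λ t → iter f t x) eq) (iter-*-fixed a m x em))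
  ... | Bézout.-+ a b eq = trans (cong f (sym (iter-*-fixed a m x em)))
          (trans (cong (λ t → iter f t x) eq) (iter-*-fixed b n x en))

prime-coprime : ∀ {p} t → Prime p → ¬ (p ∣ t) → Coprime t p
prime-coprime t pr p∤t (d∣t , d∣p) with prime⇒irreducible pr d∣p
... | inj₁ e = e
... | inj₂ refl = contradiction d∣t p∤t

prime-coprime-< : ∀ {p} t → Prime p → 1 ≤ t → t < p → Coprime t p
prime-coprime-< t pr 1≤t t<p =
  prime-coprime t pr (λ p∣t → <⇒≱ t<p (∣⇒≤ {{>-nonZero 1≤t}} p∣t))

-- No inverse of f is assumed: where f has period p, going back i steps is going forward p - i.
module PrimeCycle {n p : ℕ} (pr : Prime p) (f : Fin n → Fin n) where

  private
    instance
      p≢0 : NonZero p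
      p≢0 = prime⇒nonZero pr

  -- A repetition gives x the period j - i, which is prime to p, so x would be fixed.
  iter-injective-< : ∀ x → iter f p x ≡ x → f x ≢ x →
                     ∀ i j → i < j → j < p → iter f i x ≢ iter f j x
  iter-injective-< x per moved i j i<j j<p eq =
    moved (iter-coprime f (j ∸ i) p x (prime-coprime-< (j ∸ i) pr (m<n⇒0<n∸m i<j) (≤-<-trans (m∸n≤m j i) j<p)) back per)
    where
    open ≡-Reasoning
    shift : j + (p ∸ i) ≡ (j ∸ i) + p
    shift = begin
      j + (p ∸ i)             ≡⟨ cong (_+ (p ∸ i)) (sym (m∸n+n≡m (<⇒≤ i<j))) ⟩
      j ∸ i + i + (p ∸ i)     ≡⟨ +-assoc (j ∸ i) i (p ∸ i) ⟩
      j ∸ i + (i + (p ∸ i))   ≡⟨ cong (j ∸ i +_) (m+[n∸m]≡n (<⇒≤ (<-trans i<j j<p))) ⟩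
      (j ∸ i) + p ∎
    back : iter f (j ∸ i) x ≡ x
    back = begin
      iter f (j ∸ i) x               ≡⟨ cong (iter f (j ∸ i)) (sym per) ⟩
      iter f (j ∸ i) (iter f p x)    ≡⟨ sym (iter-+ f (j ∸ i) p x) ⟩
      iter f ((j ∸ i) + p) x         ≡⟨ cong (λ t → iter f t x) (trans (sym shift) (+-comm j (p ∸ i))) ⟩
      iter f ((p ∸ i) + j) x         ≡⟨ iter-+ f (p ∸ i) j x ⟩
      iter f (p ∸ i) (iter f j x)    ≡⟨ cong (iter f (p ∸ i)) (sym eq) ⟩
      iter f (p ∸ i) (iter f i x)    ≡⟨ sym (iter-+ f (p ∸ i) i x) ⟩
      iter f ((p ∸ i) + i) x         ≡⟨ cong (λ t → iter f t x) (m∸n+n≡m (<⇒≤ (<-trans i<j j<p))) ⟩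
      iter f p x                     ≡⟨ per ⟩
      x ∎

  iter-injective : ∀ x → iter f p x ≡ x → f x ≢ x →
                   ∀ (i j : Fin p) → iter f (toℕ i) x ≡ iter f (toℕ j) x → i ≡ j
  iter-injective x per moved i j eq with <-cmp (toℕ i) (toℕ j)

  ... | tri< a _ _ = contradiction eq (iter-injective-< x per moved _ _ a (toℕ<n j))

  ... | tri≈ _ e _ = toℕ-injective e
  ... | tri> _ _ a = contradiction (sym eq) (iter-injective-< x per moved _ _ a (toℕ<n i))

  Orbit : Fin n → Fin n → Set
  Orbit x y = ∃ λ (i : Fin p) → iter f (toℕ i) x ≡ y

  orbit? : ∀ x y → Dec (Orbit x y)
  orbit? x y = any? (λ i → iter f (toℕ i) x ≟ᶠ y)

  iter-mod : ∀ x → iter f p x ≡ x → ∀ t → iter f t x ≡ iter f (t % p) x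
  iter-mod x per t = begin
    iter f t x                               ≡⟨ cong (λ s → iter f s x) (m≡m%n+[m/n]*n t p) ⟩
    iter f (t % p + (t / p) * p) x           ≡⟨ iter-+ f (t % p) ((t / p) * p) x ⟩
    iter f (t % p) (iter f ((t / p) * p) x)  ≡⟨ cong (iter f (t % p)) (iter-*-fixed f (t / p) p x per) ⟩
    iter f (t % p) x ∎
    where open ≡-Reasoning

  orbit-iter : ∀ x → iter f p x ≡ x → ∀ t → Orbit x (iter f t x)
  orbit-iter x per t = fromℕ< (m%n<n t p) ,
    trans (cong (λ s → iter f s x) (toℕ-fromℕ< (m%n<n t p))) (sym (iter-mod x per t))

  iter-comm : ∀ s t x → iter f s (iter f t x) ≡ iter f t (iter f s x)
  iter-comm s t x = trans (sym (iter-+ f s t x))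
    (trans (cong (λ u → iter f u x) (+-comm s t)) (iter-+ f t s x))

  iter-period : ∀ t x → iter f p x ≡ x → iter f p (iter f t x) ≡ iter f t x
  iter-period t x per = trans (iter-comm p t x) (cong (iter f t) per)

  orbit-sym : ∀ x y → iter f p x ≡ x → Orbit x y → Orbit y x
  orbit-sym x y per (i , refl) = subst (Orbit y) back (orbit-iter y (iter-period (toℕ i) x per) (p ∸ toℕ i))
    where
    back : iter f (p ∸ toℕ i) (iter f (toℕ i) x) ≡ x
    back = trans (sym (iter-+ f (p ∸ toℕ i) (toℕ i) x))
      (trans (cong (λ u → iter f u x) (m∸n+n≡m (<⇒≤ (toℕ<n i)))) per)

  orbit-trans : ∀ x y z → iter f p x ≡ x → Orbit x y → Orbit y z → Orbit x z
  orbit-trans x y z per (i , refl) (j , refl) =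
    subst (Orbit x) (iter-+ f (toℕ j) (toℕ i) x) (orbit-iter x per (toℕ j + toℕ i))

  orbit-moved : ∀ x y → iter f p x ≡ x → f x ≢ x → Orbit x y → f y ≢ y
  orbit-moved x y per moved o fy = moved (fixed-orbit (orbit-sym x y per o))
    where
    iter-fixed : ∀ t → iter f t y ≡ y
    iter-fixed zero    = refl
    iter-fixed (suc t) = trans (cong f (iter-fixed t)) fy
    fixed-orbit : Orbit y x → f x ≡ x
    fixed-orbit (i , e) = subst (λ z → f z ≡ z) (trans (sym (iter-fixed (toℕ i))) e) fy

  count-orbit : ∀ x → iter f p x ≡ x → f x ≢ x → count (orbit? x) ≡ p
  count-orbit x per moved = trans
    (sym (count-bij (λ (i : Fin p) → i ≟ᶠ i) (orbit? x) (λ i → iter f (toℕ i) x)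
      (λ i _ → i , refl) (λ i j _ _ → iter-injective x per moved i j)
      (λ { j (i , e) → i , refl , e })))
    (count-all (λ i → i ≟ᶠ i) (λ _ → refl))

  -- The moved points of P split into cycles of length exactly p.
  moved-∣ : {P : Fin n → Set} (P? : Decidable P) → (∀ x → P x → P (f x)) →
            (∀ x → P x → iter f p x ≡ x) → p ∣ count (λ x → P? x ×-dec ¬? (f x ≟ᶠ x))
  moved-∣ {P} P? closed per = class-size-∣-count (λ x → P? x ×-dec ¬? (f x ≟ᶠ x)) orbit?
    (record
      { rfl = λ i w → orbit-iter i (per i (proj₁ w)) 0
      ; symm = λ i j w → orbit-sym i j (per i (proj₁ w))
      ; trns = λ i j k w → orbit-trans i j k (per i (proj₁ w))
      ; closed = λ { i j (pi , mi) o → orbit-P i j pi o , orbit-moved i j (per i pi) mi o } })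
    p (λ i w → count-orbit i (per i (proj₁ w)) (proj₂ w))
    where
    iter-P : ∀ t x → P x → P (iter f t x)
    iter-P zero    x px = px
    iter-P (suc t) x px = closed _ (iter-P t x px)
    orbit-P : ∀ x y → P x → Orbit x y → P y
    orbit-P x _ px (i , refl) = iter-P (toℕ i) x px

  -- The multiples of t run through all residues modulo p.
  step-covers : {R : Fin n → Set} → ∀ x → iter f p x ≡ x → ∀ t → ¬ (p ∣ t) →
    R x → (∀ y → R y → R (iter f t y)) → ∀ y → Orbit x y → R y
  step-covers {R} x per t p∤t rx step _ (i , refl) = subst R (hit (coprime-Bézout (prime-coprime t pr p∤t))) (multiples (proj₁ (coefficient (coprime-Bézout (prime-coprime t pr p∤t))) * toℕ i))
    where
    multiples : ∀ s → R (iter f (s * t) x)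
    multiples zero    = rx
    multiples (suc s) = subst R (sym (iter-+ f t (s * t) x)) (step _ (multiples s))
    -- The inverse a of t modulo p, kept free of subtraction by multiples of p on both sides. When
    -- Bézout yields 1 + a t = b p, the inverse -a is represented by a (p - 1).
    coefficient : Bézout.Identity 1 t p → ∃ λ (a : ℕ) → ∃ λ b → ∃ λ c → a * t + b * p ≡ 1 + c * p
    coefficient (Bézout.+- a b eq) = a , 0 , b , trans (+-identityʳ _) (sym eq)
    coefficient (Bézout.-+ a b eq) = a * (p ∸ 1) , b , a * t , lemma p eq
      where
      ring₁ : ∀ a t q → a * q * t + (1 + a * t) ≡ 1 + a * t * suc q
      ring₁ = solve-∀
      lemma : ∀ p .{{_ : NonZero p}} → 1 + a * t ≡ b * p → a * (p ∸ 1) * t + b * p ≡ 1 + a * t * p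
      lemma (suc q) eq = trans (cong (a * q * t +_) (sym eq)) (ring₁ a t q)
    hit : (bz : Bézout.Identity 1 t p) → iter f (proj₁ (coefficient bz) * toℕ i * t) x ≡ iter f (toℕ i) x
    hit bz with coefficient bz
    ... | a , b , c , eq = begin
      iter f (a * i′ * t) x                             ≡⟨ cong (iter f (a * i′ * t)) (sym (iter-*-fixed f (i′ * b) p x per)) ⟩
      iter f (a * i′ * t) (iter f (i′ * b * p) x)       ≡⟨ sym (iter-+ f (a * i′ * t) (i′ * b * p) x) ⟩
      iter f (a * i′ * t + i′ * b * p) x                ≡⟨ cong (λ u → iter f u x) arith ⟩
      iter f (i′ + i′ * c * p) x                        ≡⟨ iter-+ f i′ (i′ * c * p) x ⟩
      iter f i′ (iter f (i′ * c * p) x)                 ≡⟨ cong (iter f i′) (iter-*-fixed f (i′ * c) p x per) ⟩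
      iter f i′ x ∎
      where
      open ≡-Reasoning
      i′ = toℕ i
      ring₂ : ∀ a i t b p → a * i * t + i * b * p ≡ i * (a * t + b * p)
      ring₂ = solve-∀
      ring₃ : ∀ i c p → i * (1 + c * p) ≡ i + i * c * p
      ring₃ = solve-∀
      arith : a * i′ * t + i′ * b * p ≡ i′ + i′ * c * p
      arith = trans (ring₂ a i′ t b p) (trans (cong (i′ *_) eq) (ring₃ i′ c p))

-- Finite groups, actions and Cauchy's theorem

-- The carrier is `Fin order`, so that subsets can be counted and quantifiers over the group
-- decided.
record FinGroup : Set where
  infixl 7 _∙_
  field
    order : ℕ
    _∙_   : Fin order → Fin order → Fin order
    ε     : Fin order
    _⁻¹   : Fin order → Fin order
    assoc : ∀ x y z → (x ∙ y) ∙ z ≡ x ∙ (y ∙ z)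
    idˡ   : ∀ x → ε ∙ x ≡ x
    idʳ   : ∀ x → x ∙ ε ≡ x
    invˡ  : ∀ x → x ⁻¹ ∙ x ≡ ε
    invʳ  : ∀ x → x ∙ x ⁻¹ ≡ ε

  cancelˡ : ∀ x y z → x ∙ y ≡ x ∙ z → y ≡ z
  cancelˡ x y z e = trans (sym (undo y)) (trans (cong (x ⁻¹ ∙_) e) (undo z))
    where
    undo : ∀ w → x ⁻¹ ∙ (x ∙ w) ≡ w
    undo w = trans (sym (assoc (x ⁻¹) x w)) (trans (cong (_∙ w) (invˡ x)) (idˡ w))

  cancelʳ : ∀ x y z → y ∙ x ≡ z ∙ x → y ≡ z
  cancelʳ x y z e = trans (sym (undo y)) (trans (cong (_∙ x ⁻¹) e) (undo z))
    where
    undo : ∀ w → (w ∙ x) ∙ x ⁻¹ ≡ w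
    undo w = trans (assoc w x (x ⁻¹)) (trans (cong (w ∙_) (invʳ x)) (idʳ w))

  ⁻¹-⁻¹ : ∀ x → (x ⁻¹) ⁻¹ ≡ x
  ⁻¹-⁻¹ x = cancelˡ (x ⁻¹) _ _ (trans (invʳ (x ⁻¹)) (sym (invˡ x)))

  conj : Fin order → Fin order → Fin order
  conj h g = h ∙ g ∙ h ⁻¹

  infixr 8 _^ᵍ_
  _^ᵍ_ : Fin order → ℕ → Fin order
  g ^ᵍ n = iter (g ∙_) n ε

  record Subgroup (S : Fin order → Set) : Set where
    field
      ε-closed : S ε
      ∙-closed : ∀ {x y} → S x → S y → S (x ∙ y)
      ⁻¹-closed : ∀ {x} → S x → S (x ⁻¹)

    ^-closed : ∀ {g} n → S g → S (g ^ᵍ n)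
    ^-closed zero    s = ε-closed
    ^-closed (suc n) s = ∙-closed s (^-closed n s)

record Action (Γ : FinGroup) (n : ℕ) : Set where
  open FinGroup Γ
  field
    act   : Fin order → Fin n → Fin n
    act-ε : ∀ x → act ε x ≡ x
    act-∙ : ∀ g h x → act (g ∙ h) x ≡ act g (act h x)

  act-⁻¹ˡ : ∀ g x → act (g ⁻¹) (act g x) ≡ x
  act-⁻¹ˡ g x = trans (sym (act-∙ (g ⁻¹) g x)) (trans (cong (λ h → act h x) (invˡ g)) (act-ε x))

  act-⁻¹ʳ : ∀ g x → act g (act (g ⁻¹) x) ≡ x
  act-⁻¹ʳ g x = trans (sym (act-∙ g (g ⁻¹) x)) (trans (cong (λ h → act h x) (invʳ g)) (act-ε x))

  act-injective : ∀ g {x y} → act g x ≡ act g y → x ≡ y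
  act-injective g {x} {y} e = trans (sym (act-⁻¹ˡ g x)) (trans (cong (act (g ⁻¹)) e) (act-⁻¹ˡ g y))

  act-to-⁻¹ : ∀ g {x y} → act g x ≡ y → act (g ⁻¹) y ≡ x
  act-to-⁻¹ g refl = act-⁻¹ˡ g _

  act-^ : ∀ g n x → act (g ^ᵍ n) x ≡ iter (act g) n x
  act-^ g zero    x = act-ε x
  act-^ g (suc n) x = trans (act-∙ g (g ^ᵍ n) x) (cong (act g) (act-^ g n x))

  act-period : ∀ g p → g ^ᵍ p ≡ ε → ∀ x → iter (act g) p x ≡ x
  act-period g p e x = trans (sym (act-^ g p x)) (trans (cong (λ h → act h x) e) (act-ε x))

  act-conj : ∀ h g x → act (conj h g) x ≡ act h (act g (act (h ⁻¹) x))
  act-conj h g x = trans (act-∙ (h ∙ g) (h ⁻¹) x) (act-∙ h g _)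

  count-act : {P Q : Fin n → Set} (P? : Decidable P) (Q? : Decidable Q) → ∀ g →
    (∀ x → P x → Q (act g x)) → (∀ x → Q x → P (act (g ⁻¹) x)) → count P? ≡ count Q?
  count-act P? Q? g to from = count-bij P? Q? (act g) to (λ _ _ _ _ → act-injective g)
    (λ y q → act (g ⁻¹) y , from y q , act-⁻¹ʳ g y)

module _ {A : Set} where

  rotate : ∀ {n} → Vec A n → Vec A n
  rotate []       = []
  rotate (x ∷ xs) = xs ∷ʳ x

  rotateᴸ : List A → List A
  rotateᴸ []       = []
  rotateᴸ (x ∷ xs) = xs ++ x ∷ []

  -- Stated for lists, where the two parts can be swapped without length casts; ys = [] gives the
  -- period of the rotation.
  rotateᴸ-++ : ∀ xs ys → iter rotateᴸ (length xs) (xs ++ ys) ≡ ys ++ xs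
  rotateᴸ-++ []       ys = sym (++-identityʳ ys)
  rotateᴸ-++ (x ∷ xs) ys = begin
    rotateᴸ (iter rotateᴸ (length xs) (x ∷ xs ++ ys))     ≡⟨ sym (iter-suc (length xs) (x ∷ xs ++ ys)) ⟩
    iter rotateᴸ (length xs) ((xs ++ ys) ++ x ∷ [])       ≡⟨ cong (iter rotateᴸ (length xs)) (++-assoc xs ys (x ∷ [])) ⟩
    iter rotateᴸ (length xs) (xs ++ (ys ++ x ∷ []))       ≡⟨ rotateᴸ-++ xs (ys ++ x ∷ []) ⟩
    (ys ++ x ∷ []) ++ xs                                  ≡⟨ ++-assoc ys (x ∷ []) xs ⟩
    ys ++ x ∷ xs ∎
    where
    open ≡-Reasoning
    iter-suc : ∀ n zs → iter rotateᴸ n (rotateᴸ zs) ≡ rotateᴸ (iter rotateᴸ n zs)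
    iter-suc zero    zs = refl
    iter-suc (suc n) zs = cong rotateᴸ (iter-suc n zs)

  toList-rotate : ∀ {n} (xs : Vec A n) → toList (rotate xs) ≡ rotateᴸ (toList xs)
  toList-rotate []       = refl
  toList-rotate (x ∷ xs) = toList-∷ʳ x xs

  rotate-period : ∀ {n} (xs : Vec A n) → iter rotate n xs ≡ xs
  rotate-period {n} xs = trans (sym (cast-is-id refl _)) (toList-injective refl _ _ lists)
    where

    commute : ∀ k → toList (iter rotate k xs) ≡ iter rotateᴸ k (toList xs)
    commute zero    = refl
    commute (suc k) = trans (toList-rotate (iter rotate k xs)) (cong rotateᴸ (commute k))
    lists : toList (iter rotate n xs) ≡ toList xs
    lists = trans (commute n)
      (trans (cong₂ (iter rotateᴸ) (sym (length-toList xs)) (sym (++-identityʳ (toList xs))))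
             (rotateᴸ-++ (toList xs) []))

  Constantly : ∀ {n} → A → Vec A n → Set
  Constantly a []       = ⊤
  Constantly a (x ∷ xs) = x ≡ a × Constantly a xs

  rotate-fixed : ∀ {n} (x : A) (xs : Vec A n) → xs ∷ʳ x ≡ x ∷ xs → Constantly x xs
  rotate-fixed x []       e = tt
  rotate-fixed x (y ∷ ys) e with cong head e
  ... | refl = refl , rotate-fixed x ys (cong tail e)

-- `count` ranges over `Fin` only, so tuples are carried by `Fin (h ^ n)`. The same coding later
-- lists permutations by their tables of values.
module Vectors (h : ℕ) where

  encode : ∀ {n} → Vec (Fin h) n → Fin (h ^ n)
  encode []       = zero
  encode (x ∷ xs) = combine x (encode xs)

  decode : ∀ {n} → Fin (h ^ n) → Vec (Fin h) n
  decode {zero}  i = []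
  decode {suc n} i = proj₁ (remQuot {h} (h ^ n) i) ∷ decode (proj₂ (remQuot {h} (h ^ n) i))

  decode-encode : ∀ {n} (xs : Vec (Fin h) n) → decode (encode xs) ≡ xs
  decode-encode []       = refl
  decode-encode {suc n} (x ∷ xs) = cong₂ (λ q w → proj₁ q ∷ w) eq
    (trans (cong (λ q → decode (proj₂ q)) eq) (decode-encode xs))
    where
    eq : remQuot {h} (h ^ n) (combine x (encode xs)) ≡ (x , encode xs)
    eq = remQuot-combine x (encode xs)

  encode-decode : ∀ {n} (i : Fin (h ^ n)) → encode (decode {n} i) ≡ i
  encode-decode {zero}  zero = refl
  encode-decode {suc n} i = trans
    (cong (combine (proj₁ (remQuot {h} (h ^ n) i))) (encode-decode {n} (proj₂ (remQuot {h} (h ^ n) i))))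
    (combine-remQuot {h} (h ^ n) i)

-- McKay's argument: the cyclic shift acts on the p-tuples with product ε, and its fixed
-- points are the constant tuples (g, …, g) with g ^ p = ε.
module Cauchy (Γ : FinGroup) {S : Fin (FinGroup.order Γ) → Set} (S? : Decidable S)
  (sub : FinGroup.Subgroup Γ S) where

  open FinGroup Γ
  open Subgroup sub
  open Vectors order

  AllS : ∀ {n} → Vec (Fin order) n → Set
  AllS []       = ⊤
  AllS (x ∷ xs) = S x × AllS xs

  allS? : ∀ {n} (xs : Vec (Fin order) n) → Dec (AllS xs)
  allS? []       = yes tt
  allS? (x ∷ xs) = S? x ×-dec allS? xs

  product : ∀ {n} → Vec (Fin order) n → Fin order
  product []       = ε
  product (x ∷ xs) = x ∙ product xs

  product-∷ʳ : ∀ {n} (xs : Vec (Fin order) n) x → product (xs ∷ʳ x) ≡ product xs ∙ x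
  product-∷ʳ []       x = trans (idʳ x) (sym (idˡ x))
  product-∷ʳ (y ∷ xs) x = trans (cong (y ∙_) (product-∷ʳ xs x)) (sym (assoc y (product xs) x))

  product-closed : ∀ {n} (xs : Vec (Fin order) n) → AllS xs → S (product xs)
  product-closed []       _        = ε-closed
  product-closed (x ∷ xs) (s , ss) = ∙-closed s (product-closed xs ss)

  AllS-∷ʳ : ∀ {n} (xs : Vec (Fin order) n) x → AllS xs → S x → AllS (xs ∷ʳ x)
  AllS-∷ʳ []       x _        sx = sx , tt
  AllS-∷ʳ (y ∷ xs) x (s , ss) sx = s , AllS-∷ʳ xs x ss sx

  tuple? : ∀ n → Decidable (λ (i : Fin (order ^ n)) → AllS (decode {n} i))
  tuple? n i = allS? (decode {n} i)

  -- Tuples are grouped by their tails; each group has one tuple for every choice of the head in S.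
  count-S-∣ : ∀ n → count S? ∣ count (tuple? (suc n))
  count-S-∣ n = class-size-∣-count (tuple? (suc n)) E?
    (record
      { rfl = λ i a → a , refl ; symm = λ { i j a (b , e) → a , sym e }
      ; trns = λ { i j k a (b , e) (c , e′) → c , trans e e′ } ; closed = λ i j a → proj₁ })
    (count S?) (λ i a → sym (size i a))
    where
    E? : ∀ i j → Dec (AllS (decode {suc n} j) × tail (decode {suc n} i) ≡ tail (decode {suc n} j))
    E? i j = tuple? (suc n) j ×-dec ≡-dec _≟ᶠ_ (tail (decode {suc n} i)) (tail (decode {suc n} j))

    size : ∀ i → AllS (decode {suc n} i) → count S? ≡ count (E? i)
    size i a = count-bij S? (E? i) (λ x → encode (x ∷ tail (decode {suc n} i)))
      (λ x s → subst AllS (sym (decode-encode (x ∷ tail (decode {suc n} i)))) (s , tailS a)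
             , sym (cong tail (decode-encode (x ∷ tail (decode {suc n} i)))))
      (λ x y _ _ e → cong head (trans (sym (decode-encode (x ∷ tail (decode {suc n} i))))
                        (trans (cong decode e) (decode-encode (y ∷ tail (decode {suc n} i))))))
      (λ { j (b , e) → head (decode {suc n} j) , proj₁ b ,
           trans (cong (λ t → encode (head (decode {suc n} j) ∷ t)) e) (encode-decode {suc n} j) })
      where
      tailS : AllS (decode {suc n} i) → AllS (tail (decode {suc n} i))
      tailS (_ , ss) = ss

  Unit? : ∀ n → Decidable (λ (i : Fin (order ^ n)) → AllS (decode {n} i) × product (decode {n} i) ≡ ε)
  Unit? n i = tuple? n i ×-dec (product (decode {n} i) ≟ᶠ ε)

  -- Forgetting the head is a bijection, since the head must be the inverse of the product of the
  -- tail.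
  count-Unit : ∀ n → count (Unit? (suc n)) ≡ count (tuple? n)
  count-Unit n = count-bij (Unit? (suc n)) (tuple? n) (λ i → proj₂ (remQuot {order} (order ^ n) i))
    (λ i w → proj₂ (proj₁ w))
    (λ i j w w′ e → trans (sym (encode-decode {suc n} i)) (trans (cong encode (vectors i j w w′ e)) (encode-decode {suc n} j)))
    (λ j a → encode (product (decode {n} j) ⁻¹ ∷ decode {n} j) ,
       subst (λ v → AllS v × product v ≡ ε) (sym (decode-encode (product (decode {n} j) ⁻¹ ∷ decode {n} j)))
         ((⁻¹-closed (product-closed (decode {n} j) a) , a) , invˡ (product (decode {n} j))) ,
       trans (cong proj₂ (remQuot-combine (product (decode {n} j) ⁻¹) (encode (decode {n} j)))) (encode-decode {n} j))
    where
    vectors : ∀ i j → (AllS (decode {suc n} i) × product (decode {suc n} i) ≡ ε) →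
              (AllS (decode {suc n} j) × product (decode {suc n} j) ≡ ε) →
              proj₂ (remQuot {order} (order ^ n) i) ≡ proj₂ (remQuot {order} (order ^ n) j) →
              decode {suc n} i ≡ decode {suc n} j
    vectors i j (_ , e) (_ , e′) t = cong₂ _∷_
      (cancelʳ (product (decode {n} (proj₂ (remQuot {order} (order ^ n) i)))) _ _ (trans e (trans (sym e′) (cong (λ q → proj₁ (remQuot {order} (order ^ n) j) ∙ product (decode {n} q)) (sym t)))))
      (cong decode t)

  cauchy : ∀ {p} → Prime p → p ∣ count S? → ∃ λ g → S g × g ≢ ε × g ^ᵍ p ≡ ε
  cauchy {zero} pr _ = contradiction (prime⇒nonZero pr) λ ()
  cauchy {suc zero} pr _ = contradiction (prime⇒nonTrivial pr) λ ()
  cauchy {p@(suc (suc n))} pr p∣S = extract (any? (λ i → Fix? i ×-dec ¬? (i ≟ᶠ i₀)))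
    where
    ρ : Fin (order ^ p) → Fin (order ^ p)
    ρ i = encode (rotate (decode {p} i))
    open PrimeCycle pr ρ
    M : Fin (order ^ p) → Set
    M i = AllS (decode {p} i) × product (decode {p} i) ≡ ε
    rotate-M : (xs : Vec (Fin order) p) → AllS xs × product xs ≡ ε → AllS (rotate xs) × product (rotate xs) ≡ ε
    rotate-M (x ∷ xs) ((s , ss) , e) = AllS-∷ʳ xs x ss s ,
      trans (product-∷ʳ xs x) (cancelˡ x _ _ (trans (sym (assoc x (product xs) x)) (trans (cong (_∙ x) e) (trans (idˡ x) (sym (idʳ x))))))
    ρ-M : ∀ i → M i → M (ρ i)
    ρ-M i m = subst (λ v → AllS v × product v ≡ ε) (sym (decode-encode (rotate (decode {p} i)))) (rotate-M (decode {p} i) m)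
    decode-ρ : ∀ k i → decode {p} (iter ρ k i) ≡ iter rotate k (decode {p} i)
    decode-ρ zero    i = refl
    decode-ρ (suc k) i = trans (decode-encode (rotate (decode {p} (iter ρ k i)))) (cong rotate (decode-ρ k i))
    ρ-period : ∀ i → iter ρ p i ≡ i
    ρ-period i = trans (sym (encode-decode {p} _))
      (trans (cong encode (trans (decode-ρ p i) (rotate-period (decode {p} i)))) (encode-decode {p} i))
    Fix? = λ i → Unit? p i ×-dec (ρ i ≟ᶠ i)
    -- p divides |S|, which divides the number of (p - 1)-tuples because p - 1 ≥ 1; the tuples moved
    -- by the rotation come in cycles of length p.
    p∣Fix : p ∣ count Fix?
    p∣Fix = ∣m+n∣n⇒∣m (subst (p ∣_) (count-split (Unit? p) (λ i → ρ i ≟ᶠ i))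
        (subst (p ∣_) (sym (count-Unit (suc n))) (∣-trans p∣S (count-S-∣ n))))
      (moved-∣ (Unit? p) ρ-M (λ i _ → ρ-period i))
      where
      ∣m+n∣n⇒∣m : ∀ {d a b} → d ∣ a + b → d ∣ b → d ∣ a
      ∣m+n∣n⇒∣m {d} {a} {b} ds db = ∣m+n∣m⇒∣n (subst (d ∣_) (+-comm a b) ds) db
    units : ∀ k → Vec (Fin order) k
    units zero    = []
    units (suc k) = ε ∷ units k
    unitsS : ∀ k → AllS (units k)
    unitsS zero    = tt
    unitsS (suc k) = ε-closed , unitsS k
    product-units : ∀ k → product (units k) ≡ ε
    product-units zero    = refl
    product-units (suc k) = trans (idˡ _) (product-units k)
    units-∷ʳ : ∀ k → units k ∷ʳ ε ≡ ε ∷ units k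
    units-∷ʳ zero    = refl
    units-∷ʳ (suc k) = cong (ε ∷_) (units-∷ʳ k)
    -- The all-ε tuple is fixed, so the number of fixed tuples, a multiple of p, exceeds one.
    i₀ : Fin (order ^ p)
    i₀ = encode (units p)
    i₀-fixed : M i₀ × ρ i₀ ≡ i₀
    i₀-fixed = subst (λ v → AllS v × product v ≡ ε) (sym (decode-encode (units p))) (unitsS p , product-units p) ,
      cong encode (trans (cong rotate (decode-encode (units p))) (units-∷ʳ (suc n)))
    power : ∀ {k} g (xs : Vec (Fin order) k) → Constantly g xs → product xs ≡ g ^ᵍ k
    power g []       _        = refl
    power g (x ∷ xs) (refl , c) = cong (x ∙_) (power g xs c)
    constant-units : ∀ {k} (xs : Vec (Fin order) k) → Constantly ε xs → xs ≡ units k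
    constant-units []       _          = refl
    constant-units (x ∷ xs) (refl , c) = cong (ε ∷_) (constant-units xs c)
    element : (xs : Vec (Fin order) p) → AllS xs → product xs ≡ ε → rotate xs ≡ xs → xs ≢ units p →
              ∃ λ g → S g × g ≢ ε × g ^ᵍ p ≡ ε
    element (g ∷ xs) (s , _) e r ne = g , s ,
      (λ { refl → ne (constant-units (ε ∷ xs) (refl , rotate-fixed ε xs r)) }) ,
      trans (sym (power g (g ∷ xs) (refl , rotate-fixed g xs r))) e
    extract : Dec (∃ λ i → (M i × ρ i ≡ i) × i ≢ i₀) → ∃ λ g → S g × g ≢ ε × g ^ᵍ p ≡ ε
    extract (yes (i , ((a , e) , f) , ne)) = element (decode {p} i) a e
      (trans (sym (decode-encode (rotate (decode {p} i)))) (cong (decode {p}) f))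
      (λ u → ne (trans (sym (encode-decode {p} i)) (cong encode u)))
    extract (no none) = contradiction (∣1⇒≡1 (subst (p ∣_)
        (count-unique Fix? i₀ i₀-fixed (λ j w → decidable-stable (j ≟ᶠ i₀) (λ ne → none (j , w , ne)))) p∣Fix)) λ ()

-- Jordan's argument

module MovedPoints {Γ : FinGroup} {n : ℕ} (A : Action Γ n) {p : ℕ} (pr : Prime p)
  {H : Fin (FinGroup.order Γ) → Set} (sub : FinGroup.Subgroup Γ H)
  {O : Fin n → Set} (O? : Decidable O) (O-closed : ∀ {g x} → H g → O x → O (Action.act A g x)) where

  open FinGroup Γ
  open Action A
  open Subgroup sub

  module At (g : Fin order) (Hg : H g) (period : ∀ x → iter (act g) p x ≡ x) where
    open PrimeCycle pr (act g) public

    iter-O : ∀ t x → O x → O (iter (act g) t x)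
    iter-O t x o = subst O (act-^ g t x) (O-closed (^-closed t Hg) o)

    orbit-O : ∀ x y → O x → Orbit x y → O y
    orbit-O x _ o (i , refl) = iter-O (toℕ i) x o

    count-moved-orbit : ∀ x → act g x ≢ x → count (orbit? x) ≡ p
    count-moved-orbit x = count-orbit x (period x)

  module _ (small : count O? < p + p) where

    -- Both cycles have p elements inside O, which has fewer than 2p.
    orbits-meet : ∀ g g′ (Hg : H g) (Hg′ : H g′) (per : ∀ x → iter (act g) p x ≡ x)
      (per′ : ∀ x → iter (act g′) p x ≡ x) x x′ → O x → O x′ → act g x ≢ x → act g′ x′ ≢ x′ →
      ∃ λ z → At.Orbit g Hg per x z × At.Orbit g′ Hg′ per′ x′ z
    orbits-meet g g′ Hg Hg′ per per′ x x′ o o′ mv mv′ =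
      count-meet (At.orbit? g Hg per x) (At.orbit? g′ Hg′ per′ x′) O?
        (λ z → At.orbit-O g Hg per x z o) (λ z → At.orbit-O g′ Hg′ per′ x′ z o′)
        (subst (count O? <_) (sym (cong₂ _+_ (At.count-moved-orbit g Hg per x mv) (At.count-moved-orbit g′ Hg′ per′ x′ mv′))) small)

    -- Two cycles of the same g that meet coincide, so g has a single p-cycle on O.
    moved-connected : ∀ g (Hg : H g) (per : ∀ x → iter (act g) p x ≡ x) x y →
      O x → O y → act g x ≢ x → act g y ≢ y → At.Orbit g Hg per x y
    moved-connected g Hg per x y ox oy mx my =
      let z , xz , yz = orbits-meet g g Hg Hg per per x y ox oy mx my
      in At.orbit-trans g Hg per x z y (per x) xz (At.orbit-sym g Hg per y z (per y) yz)

module _ {Γ : FinGroup} {n : ℕ} (A : Action Γ n) where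
  open FinGroup Γ
  open Action A

  conj-iter : ∀ h g t x → iter (act (conj h g)) t (act h x) ≡ act h (iter (act g) t x)
  conj-iter h g zero    x = refl
  conj-iter h g (suc t) x = trans (cong (act (conj h g)) (conj-iter h g t x))
    (trans (act-conj h g (act h (iter (act g) t x))) (cong (λ y → act h (act g y)) (act-⁻¹ˡ h (iter (act g) t x))))

  conj-period : ∀ h g p → (∀ x → iter (act g) p x ≡ x) → ∀ x → iter (act (conj h g)) p x ≡ x
  conj-period h g p per x = begin
    iter (act (conj h g)) p x                        ≡⟨ cong (iter (act (conj h g)) p) (sym (act-⁻¹ʳ h x)) ⟩
    iter (act (conj h g)) p (act h (act (h ⁻¹) x))   ≡⟨ conj-iter h g p (act (h ⁻¹) x) ⟩
    act h (iter (act g) p (act (h ⁻¹) x))            ≡⟨ cong (act h) (per (act (h ⁻¹) x)) ⟩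
    act h (act (h ⁻¹) x)                             ≡⟨ act-⁻¹ʳ h x ⟩
    x ∎
    where open ≡-Reasoning

  conj-fixed : ∀ h g x → act g (act (h ⁻¹) x) ≡ act (h ⁻¹) x → act (conj h g) x ≡ x
  conj-fixed h g x e = trans (act-conj h g x) (trans (cong (act h) e) (act-⁻¹ʳ h x))

  conj-moved : ∀ h g x → act g (act (h ⁻¹) x) ≢ act (h ⁻¹) x → act (conj h g) x ≢ x
  conj-moved h g x mv e = mv (trans (sym (act-⁻¹ˡ h _)) (cong (act (h ⁻¹)) (trans (sym (act-conj h g x)) e)))

-- If p < |O| < 2p, any two conjugates of g move a common point of O, and g moves a single
-- p-cycle there.  For b ≠ a some conjugate moves b and fixes a: otherwise b may be taken
-- in the cycle X of g, and invariance under g makes every conjugate which moves one point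
-- of X move all of X, hence every point of the transitive set O lie in X.
module _ {Γ : FinGroup} {n : ℕ} (A : Action Γ n) {p : ℕ} (pr : Prime p)
  {H : Fin (FinGroup.order Γ) → Set} (H? : Decidable H) (sub : FinGroup.Subgroup Γ H)
  {O : Fin n → Set} (O? : Decidable O) (O-closed : ∀ {g x} → H g → O x → O (Action.act A g x))
  (transitive : ∀ {x y} → O x → O y → ∃ λ g → H g × Action.act A g x ≡ y)
  (p<O : p < count O?) (O<2p : count O? < p + p)
  (g : Fin (FinGroup.order Γ)) (Hg : H g) (per : ∀ x → iter (Action.act A g) p x ≡ x)
  (x₀ : Fin n) (Ox₀ : O x₀) (mv₀ : Action.act A g x₀ ≢ x₀) where

  open FinGroup Γ
  open Action A
  open Subgroup sub
  open MovedPoints A pr sub O? O-closed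
  open At g Hg per

  private
    -- Every H-conjugate of g that moves x also moves y.
    R : Fin n → Fin n → Set
    R x y = ∀ k → H k → act g (act k x) ≢ act k x → act g (act k y) ≢ act k y

    R-act : ∀ {x y} k → H k → R x y → R (act k x) (act k y)
    R-act k Hk r l Hl mv e = r (l ∙ k) (∙-closed Hl Hk)
      (λ e′ → mv (trans (cong (act g) (sym (act-∙ l k _))) (trans e′ (act-∙ l k _))))
      (trans (cong (act g) (act-∙ l k _)) (trans e (sym (act-∙ l k _))))

    R-iter : ∀ {x y} t → R x y → R (iter (act g) t x) (iter (act g) t y)
    R-iter t r = subst₂ R (act-^ g t _) (act-^ g t _) (R-act (g ^ᵍ t) (^-closed t Hg) r)

    R-moved : ∀ {y} → R x₀ y → act g y ≢ y
    R-moved r e = r ε ε-closed (λ e′ → mv₀ (trans (cong (act g) (sym (act-ε x₀))) (trans e′ (act-ε x₀))))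
      (trans (cong (act g) (act-ε _)) (trans e (sym (act-ε _))))

    R-trivial : ∀ y → O y → y ≢ x₀ → ¬ R x₀ y
    R-trivial y Oy y≢x₀ r = <⇒≱ p<O (≤-trans
        (count-mono O? (orbit? x₀) (λ z Oz → moved-connected O<2p g Hg per x₀ z Ox₀ Oz mv₀ (all-moved z Oz)))
        (≤-reflexive (count-moved-orbit x₀ mv₀)))
      where
      y-orbit : Orbit x₀ y
      y-orbit = moved-connected O<2p g Hg per x₀ y Ox₀ Oy mv₀ (R-moved r)
      t : ℕ
      t = toℕ (proj₁ y-orbit)
      p∤t : ¬ (p ∣ t)
      p∤t p∣t with t in eq
      ... | zero  = y≢x₀ (trans (sym (proj₂ y-orbit)) (cong (λ s → iter (act g) s x₀) eq))
      ... | suc _ = <⇒≱ (toℕ<n (proj₁ y-orbit)) (≤-trans (∣⇒≤ p∣t) (≤-reflexive (sym eq)))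
      -- With y = g^t x₀ and z = g^i x₀: a conjugate moving x₀ moves z, and translating R x₀ y by
      -- g^i shows that it then moves g^t z. As p does not divide t, these steps reach the whole
      -- cycle.
      step : ∀ z → O z × R x₀ z → O (iter (act g) t z) × R x₀ (iter (act g) t z)
      step z (Oz , rz) with moved-connected O<2p g Hg per x₀ z Ox₀ Oz mv₀ (R-moved rz)
      ... | i , refl = iter-O t _ Oz , λ k Hk mv → subst (R (iter (act g) (toℕ i) x₀)) shift (R-iter (toℕ i) r) k Hk (rz k Hk mv)
        where
        shift : iter (act g) (toℕ i) y ≡ iter (act g) t (iter (act g) (toℕ i) x₀)
        shift = trans (cong (iter (act g) (toℕ i)) (sym (proj₂ y-orbit))) (iter-comm (toℕ i) t x₀)
      cycle : ∀ z → Orbit x₀ z → R x₀ z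
      cycle z o = proj₂ (step-covers x₀ (per x₀) t p∤t (Ox₀ , λ k Hk mv → mv) step z o)
      cycle⁻¹ : ∀ z → Orbit x₀ z → R z x₀
      cycle⁻¹ z (i , refl) with orbit-sym x₀ z (per x₀) (i , refl)
      ... | j , e = subst (R z) (trans (iter-comm (toℕ i) (toℕ j) x₀) e) (R-iter (toℕ i) (cycle _ (j , refl)))
      -- The preimage of the cycle under k also has p elements of O, so it meets the cycle in some
      -- z. Then g moves k z, and R z x₀ makes it move k x₀.
      always : ∀ k → H k → act g (act k x₀) ≢ act k x₀
      always k Hk = let z , o , o′ = meet in cycle⁻¹ z o k Hk (orbit-moved x₀ (act k z) (per x₀) mv₀ o′)
        where
        pre? = λ z → orbit? x₀ (act k z)
        pre≡ : count pre? ≡ p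
        pre≡ = trans (count-act pre? (orbit? x₀) k (λ _ o → o) (λ z o → subst (Orbit x₀) (sym (act-⁻¹ʳ k z)) o))
                     (count-moved-orbit x₀ mv₀)
        meet : ∃ λ z → Orbit x₀ z × Orbit x₀ (act k z)
        meet = count-meet (orbit? x₀) pre? O? (λ z → orbit-O x₀ z Ox₀)
          (λ z o → subst O (act-⁻¹ˡ k z) (O-closed (⁻¹-closed Hk) (orbit-O x₀ (act k z) Ox₀ o)))
          (subst (count O? <_) (sym (cong₂ _+_ (count-moved-orbit x₀ mv₀) pre≡)) O<2p)
      all-moved : ∀ z → O z → act g z ≢ z
      all-moved z Oz with transitive Ox₀ Oz
      ... | k , Hk , refl = always k Hk

    separate : ∀ a b → O a → O b → b ≢ a →
      ∃ λ k → H k × act g (act k b) ≢ act k b × act g (act k a) ≡ act k a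
    separate a b Oa Ob b≢a
      with any? (λ k → H? k ×-dec ¬? (act g (act k b) ≟ᶠ act k b) ×-dec (act g (act k a) ≟ᶠ act k a))
    ... | yes w = w
    ... | no ¬w with transitive Ob Ox₀
    ...   | k , Hk , refl = contradiction
            (R-act k Hk (λ l Hl mv e → ¬w (l , Hl , mv , e)))
            (R-trivial (act k a) (O-closed Hk Oa) (λ e → b≢a (sym (act-injective k e))))

  -- Take two conjugates of g fixing a, one moving b and the other moving c. Their cycles through b
  -- and c meet, and powers of the two carry b to c by way of a common point.
  stabilizer-transitive : ∀ {a b c} → O a → O b → O c → b ≢ a → c ≢ a →
    ∃ λ h → H h × act h a ≡ a × act h b ≡ c
  stabilizer-transitive {a} {b} {c} Oa Ob Oc b≢a c≢a
    with separate a b Oa Ob b≢a | separate a c Oa Oc c≢a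
  ... | k , Hk , mvk , fixk | l , Hl , mvl , fixl =
    let z , bz , cz = orbits-meet O<2p gk gl Hgk Hgl perk perl b c Ob Oc
                        (conj-moved A (k ⁻¹) g b (subst (λ k → act g (act k b) ≢ act k b) (sym (⁻¹-⁻¹ k)) mvk))
                        (conj-moved A (l ⁻¹) g c (subst (λ l → act g (act l c) ≢ act l c) (sym (⁻¹-⁻¹ l)) mvl))
        i , ie = bz
        j , je = cz
        u = gk ^ᵍ toℕ i
        w = gl ^ᵍ toℕ j
    in w ⁻¹ ∙ u , ∙-closed (⁻¹-closed (^-closed (toℕ j) Hgl)) (^-closed (toℕ i) Hgk) ,
       trans (act-∙ (w ⁻¹) u a) (trans (cong (act (w ⁻¹)) (power-fixes gk (toℕ i) (fixes k fixk)))
         (act-to-⁻¹ w (power-fixes gl (toℕ j) (fixes l fixl)))) ,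
       trans (act-∙ (w ⁻¹) u b) (trans (cong (act (w ⁻¹)) (trans (act-^ gk (toℕ i) b) ie))
         (act-to-⁻¹ w (trans (act-^ gl (toℕ j) c) je)))
    where
    gk = conj (k ⁻¹) g
    gl = conj (l ⁻¹) g
    Hgk = ∙-closed (∙-closed (⁻¹-closed Hk) Hg) (⁻¹-closed (⁻¹-closed Hk))
    Hgl = ∙-closed (∙-closed (⁻¹-closed Hl) Hg) (⁻¹-closed (⁻¹-closed Hl))
    perk = conj-period A (k ⁻¹) g p per
    perl = conj-period A (l ⁻¹) g p per
    fixes : ∀ m → act g (act m a) ≡ act m a → act (conj (m ⁻¹) g) a ≡ a
    fixes m e = conj-fixed A (m ⁻¹) g a (subst (λ m → act g (act m a) ≡ act m a) (sym (⁻¹-⁻¹ m)) e)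
    power-fixes : ∀ q t → act q a ≡ a → act (q ^ᵍ t) a ≡ a
    power-fixes q t e = trans (act-^ q t a) (iter-fixed t)
      where
      iter-fixed : ∀ t → iter (act q) t a ≡ a
      iter-fixed zero    = refl
      iter-fixed (suc t) = trans (cong (act q) (iter-fixed t)) e

-- Flag-transitive imprimitive designs

count-≤2 : ∀ {n} {P : Fin n → Set} (P? : Decidable P) → count P? ≤ 2 →
  ∀ {a b c} → P a → P b → P c → a ≢ b → a ≢ c → b ≡ c
count-≤2 {P = P} P? le {a} {b} {c} pa pb pc a≢b a≢c with b ≟ᶠ c
... | yes e = e
... | no b≢c = contradiction le (<⇒≱ (≤-trans (≤-reflexive (sym three)) (count-mono abc? P? sub)))
  where
  bc? = λ i → (i ≟ᶠ b) ⊎-dec (i ≟ᶠ c)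
  abc? = λ i → (i ≟ᶠ a) ⊎-dec bc? i
  three : count abc? ≡ 3
  three = trans (count-⊎ (_≟ᶠ a) bc? (λ { i refl (inj₁ e) → a≢b e ; i refl (inj₂ e) → a≢c e }))
    (cong₂ _+_ (count-≡ a) (trans (count-⊎ (_≟ᶠ b) (_≟ᶠ c) (λ { i refl e → b≢c e }))
      (cong₂ _+_ (count-≡ b) (count-≡ c))))
  sub : ∀ i → i ≡ a ⊎ (i ≡ b ⊎ i ≡ c) → P i
  sub i (inj₁ refl) = pa
  sub i (inj₂ (inj₁ refl)) = pb
  sub i (inj₂ (inj₂ refl)) = pc

-- A flag-transitive design with an invariant partition into N classes of size s.  A block
-- meets m classes, in ℓ points each; c₁ blocks meet a given class, c₂ meet two given
-- classes, and h₂ pass through a given point and meet a given class not containing it.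
record ImprimitiveDesign : Set₁ where
  field
    Γ       : FinGroup
    v nb N  : ℕ
    points  : Action Γ v
    blocks  : Action Γ nb
    classes : Action Γ N
  open FinGroup Γ public
  open Action points public using () renaming (act to _·_)
  open Action blocks public using () renaming (act to _·ᴮ_)
  open Action classes public using () renaming (act to _·ᶜ_)
  field
    I       : Fin v → Fin nb → Set
    I?      : ∀ x j → Dec (I x j)
    cl      : Fin v → Fin N
    cl-act  : ∀ g x → cl (g · x) ≡ g ·ᶜ cl x
    I-act   : ∀ g {x j} → I x j → I (g · x) (g ·ᴮ j)
    faithful : ∀ g → (∀ x → g · x ≡ x) → g ≡ ε
    flag-transitive : ∀ {x j y l} → I x j → I y l → ∃ λ g → g · x ≡ y × g ·ᴮ j ≡ l
    k r lam ℓ s m c₁ c₂ h₂ : ℕ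
    block-count : ∀ j → count (λ x → I? x j) ≡ k
    point-count : ∀ x → count (λ j → I? x j) ≡ r
    pair-count  : ∀ {x y} → x ≢ y → count (λ j → I? x j ×-dec I? y j) ≡ lam
    class-count : ∀ c → count (λ x → cl x ≟ᶠ c) ≡ s
    meet-count  : ∀ {x j} → I x j → count (λ y → (cl y ≟ᶠ cl x) ×-dec I? y j) ≡ ℓ
    m-eq  : m * ℓ ≡ k
    c₁-eq : c₁ * ℓ ≡ s * r
    h₂-eq : h₂ * ℓ ≡ s * lam
    c₂-eq : c₂ * ℓ ≡ s * h₂
    .{{ℓ≢0}} : NonZero ℓ
    .{{m≢0}} : NonZero m
    .{{s≢0}} : NonZero s
    .{{r≢0}} : NonZero r
    .{{lam≢0}} : NonZero lam

  open ≡-Reasoning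

  Meets : Fin N → Fin nb → Set
  Meets c j = ∃ λ x → cl x ≡ c × I x j

  meets? : ∀ c j → Dec (Meets c j)
  meets? c j = any? (λ x → (cl x ≟ᶠ c) ×-dec I? x j)

  meets-act : ∀ g {c j} → Meets c j → Meets (g ·ᶜ c) (g ·ᴮ j)
  meets-act g (x , refl , i) = g · x , cl-act g x , I-act g i

  meets-⁻¹ : ∀ g {c j} → Meets (g ·ᶜ c) j → Meets c ((g ⁻¹) ·ᴮ j)
  meets-⁻¹ g {c} {j} w = subst (λ d → Meets d ((g ⁻¹) ·ᴮ j)) (Action.act-⁻¹ˡ classes g c) (meets-act (g ⁻¹) w)

  class-point : ∀ c → ∃ λ x → cl x ≡ c
  class-point c = count-witness (λ x → cl x ≟ᶠ c) (subst (1 ≤_) (sym (class-count c)) (>-nonZero⁻¹ s))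

  block-point : ∀ j → ∃ λ x → I x j
  block-point j = count-witness (λ x → I? x j) (subst (1 ≤_) (trans m-eq (sym (block-count j)))
    (*-mono-≤ (>-nonZero⁻¹ m) (>-nonZero⁻¹ ℓ)))

  point-block : ∀ x → ∃ λ j → I x j
  point-block x = count-witness (λ j → I? x j) (subst (1 ≤_) (sym (point-count x)) (>-nonZero⁻¹ r))

  pair-block : ∀ {x y} → x ≢ y → ∃ λ j → I x j × I y j
  pair-block x≢y = count-witness _ (subst (1 ≤_) (sym (pair-count x≢y)) (>-nonZero⁻¹ lam))

  point-transitive : ∀ x y → ∃ λ g → g · x ≡ y
  point-transitive x y with flag-transitive (proj₂ (point-block x)) (proj₂ (point-block y))
  ... | g , e , _ = g , e

  class-meet-count : ∀ {c j} → Meets c j → count (λ y → (cl y ≟ᶠ c) ×-dec I? y j) ≡ ℓ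
  class-meet-count (x , refl , i) = meet-count i

  count-m : ∀ j → count (λ c → meets? c j) ≡ m
  count-m j = *-cancelʳ-≡ _ m ℓ (begin
    count (λ c → meets? c j) * ℓ  ≡⟨ biregular (λ c → meets? c j) (λ x → I? x j) (λ c x → cl x ≟ᶠ c) ℓ 1
        (λ c w → trans (count-cong _ (λ y → (cl y ≟ᶠ c) ×-dec I? y j) (λ _ (a , b) → b , a) (λ _ (a , b) → b , a)) (class-meet-count w))
        (λ x i → count-unique (λ c → meets? c j ×-dec (cl x ≟ᶠ c)) (cl x) ((x , refl , i) , refl) (λ c w → sym (proj₂ w))) ⟩
    count (λ x → I? x j) * 1      ≡⟨ trans (*-identityʳ _) (block-count j) ⟩
    k                             ≡⟨ sym m-eq ⟩
    m * ℓ ∎)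

  count-c₁ : ∀ c → count (λ j → meets? c j) ≡ c₁
  count-c₁ c = *-cancelʳ-≡ _ c₁ ℓ (begin
    count (λ j → meets? c j) * ℓ  ≡⟨ sym (biregular (λ x → cl x ≟ᶠ c) (λ j → meets? c j) I? r ℓ
        (λ { x e → trans (count-cong _ (I? x) (λ _ → proj₂) (λ j i → (x , e , i) , i)) (point-count x) })
        (λ j → class-meet-count)) ⟩
    count (λ x → cl x ≟ᶠ c) * r   ≡⟨ cong (_* r) (class-count c) ⟩
    s * r                         ≡⟨ sym c₁-eq ⟩
    c₁ * ℓ ∎)

  count-h₂ : ∀ x {c} → cl x ≢ c → count (λ j → I? x j ×-dec meets? c j) ≡ h₂
  count-h₂ x {c} x≢c = *-cancelʳ-≡ _ h₂ ℓ (begin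
    count (λ j → I? x j ×-dec meets? c j) * ℓ  ≡⟨ sym (biregular (λ y → cl y ≟ᶠ c) (λ j → I? x j ×-dec meets? c j) I? lam ℓ
        (λ y e → trans (count-cong _ (λ j → I? x j ×-dec I? y j) (λ _ ((a , _) , b) → a , b) (λ j (a , b) → (a , y , e , b) , b))
           (pair-count (λ { refl → x≢c e })))
        (λ j w → class-meet-count (proj₂ w))) ⟩
    count (λ y → cl y ≟ᶠ c) * lam              ≡⟨ cong (_* lam) (class-count c) ⟩
    s * lam                                    ≡⟨ sym h₂-eq ⟩
    h₂ * ℓ ∎)

  count-c₂ : ∀ {c d} → c ≢ d → count (λ j → meets? c j ×-dec meets? d j) ≡ c₂
  count-c₂ {c} {d} c≢d = *-cancelʳ-≡ _ c₂ ℓ (begin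
    count (λ j → meets? c j ×-dec meets? d j) * ℓ  ≡⟨ sym (biregular (λ x → cl x ≟ᶠ c) (λ j → meets? c j ×-dec meets? d j) I? h₂ ℓ
        (λ x e → trans (count-cong _ (λ j → I? x j ×-dec meets? d j) (λ _ ((_ , a) , b) → b , a) (λ j (a , b) → ((x , e , a) , b) , a))
           (count-h₂ x (λ e′ → c≢d (trans (sym e) e′))))
        (λ j w → class-meet-count (proj₁ w))) ⟩
    count (λ x → cl x ≟ᶠ c) * h₂                   ≡⟨ cong (_* h₂) (class-count c) ⟩
    s * h₂                                         ≡⟨ sym c₂-eq ⟩
    c₂ * ℓ ∎)

  Stab : Fin N → Fin order → Set
  Stab a g = g ·ᶜ a ≡ a

  stab? : ∀ a → Decidable (Stab a)
  stab? a g = g ·ᶜ a ≟ᶠ a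

  stab-subgroup : ∀ a → Subgroup (Stab a)
  stab-subgroup a = record
    { ε-closed = Action.act-ε classes a
    ; ∙-closed = λ {x} {y} ex ey → trans (Action.act-∙ classes x y a) (trans (cong (x ·ᶜ_) ey) ex)
    ; ⁻¹-closed = λ {x} ex → Action.act-to-⁻¹ classes x ex }

  stab-block-transitive : ∀ a {j l} → Meets a j → Meets a l → ∃ λ g → Stab a g × g ·ᴮ j ≡ l
  stab-block-transitive a (x , refl , i) (y , e , i′) with flag-transitive i i′
  ... | g , gx , gj = g , trans (sym (cl-act g x)) (trans (cong cl gx) e) , gj

  -- Orbit-stabilizer: an element carrying one point of the class to another fixes the class, so the
  -- stabilizer is transitive on its s points and the fibres of g ↦ g x are equal.
  s∣stab : ∀ a → s ∣ count (stab? a)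
  s∣stab a = subst (s ∣_) (sym (trans eq (cong (_* F) (class-count a)))) (m∣m*n F)
    where
    x = proj₁ (class-point a)
    cx : cl x ≡ a
    cx = proj₂ (class-point a)
    F : ℕ
    F = count (λ g → stab? a g ×-dec (g · x ≟ᶠ x))
    eq : count (stab? a) ≡ count (λ y → cl y ≟ᶠ a) * F
    eq = count-fibres (stab? a) (λ y → cl y ≟ᶠ a) (_· x) F
      (λ g e → trans (cl-act g x) (trans (cong (g ·ᶜ_) cx) e))
      fibre
      where
      open Subgroup (stab-subgroup a)
      fibre : ∀ y → cl y ≡ a → count (λ g → stab? a g ×-dec (g · x ≟ᶠ y)) ≡ count (λ g → stab? a g ×-dec (g · x ≟ᶠ x))
      fibre y cy with point-transitive x y
      ... | h , refl = sym (count-bij (λ g → stab? a g ×-dec (g · x ≟ᶠ x)) (λ g → stab? a g ×-dec (g · x ≟ᶠ (h · x))) (h ∙_)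
        (λ g (e , f) → ∙-closed sh e , trans (Action.act-∙ points h g x) (cong (h ·_) f))
        (λ g g′ _ _ → cancelˡ h g g′)
        (λ g (e , f) → h ⁻¹ ∙ g , (∙-closed (⁻¹-closed sh) e ,
            trans (Action.act-∙ points (h ⁻¹) g x) (trans (cong ((h ⁻¹) ·_) f) (Action.act-⁻¹ˡ points h x))) ,
          trans (sym (assoc h (h ⁻¹) g)) (trans (cong (_∙ g) (invʳ h)) (idˡ g))))
        where
        sh : Stab a h
        sh = trans (cong (h ·ᶜ_) (sym cx)) (trans (sym (cl-act h x)) cy)

  prime-element : ∀ {p} → Prime p → p ∣ s → ∀ a → ∃ λ g → Stab a g × g ≢ ε × g ^ᵍ p ≡ ε
  prime-element pr p∣s a = Cauchy.cauchy Γ (stab? a) (stab-subgroup a) pr (∣-trans p∣s (s∣stab a))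

  -- An element fixing all classes maps each block to a block related to it in this way.
  SameShape : Fin nb → Fin nb → Set
  SameShape j l = ∀ c → (Meets c j → Meets c l) × (Meets c l → Meets c j)

  sameShape? : ∀ j l → Dec (SameShape j l)
  sameShape? j l = all? (λ c → (meets? c j →-dec meets? c l) ×-dec (meets? c l →-dec meets? c j))

  shape-refl : ∀ {j} → SameShape j j
  shape-refl c = (λ w → w) , (λ w → w)

  shape-sym : ∀ {j l} → SameShape j l → SameShape l j
  shape-sym e c = proj₂ (e c) , proj₁ (e c)

  shape-trans : ∀ {i j l} → SameShape i j → SameShape j l → SameShape i l
  shape-trans e f c = (λ w → proj₁ (f c) (proj₁ (e c) w)) , (λ w → proj₂ (e c) (proj₂ (f c) w))

  shape-act : ∀ g {j l} → SameShape j l → SameShape (g ·ᴮ j) (g ·ᴮ l)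
  shape-act g {j} {l} e c = half j l (λ d → proj₁ (e d)) , half l j (λ d → proj₂ (e d))
    where
    half : ∀ j l → (∀ d → Meets d j → Meets d l) → Meets c (g ·ᴮ j) → Meets c (g ·ᴮ l)
    half j l f w = subst (λ d → Meets d (g ·ᴮ l)) (Action.act-⁻¹ʳ classes g c)
      (meets-act g (f ((g ⁻¹) ·ᶜ c) (subst (Meets _) (Action.act-⁻¹ˡ blocks g j) (meets-act (g ⁻¹) w))))

  shape-act⁻¹ : ∀ g {j l} → SameShape (g ·ᴮ j) l → SameShape j ((g ⁻¹) ·ᴮ l)
  shape-act⁻¹ g {j} {l} e = subst (λ i → SameShape i ((g ⁻¹) ·ᴮ l)) (Action.act-⁻¹ˡ blocks g j) (shape-act (g ⁻¹) e)

  mates? : ∀ x j l → Dec (I x l × SameShape j l)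
  mates? x j l = I? x l ×-dec sameShape? j l

  -- By flag-transitivity the same for all flags; its divisors decide whether an element of order p
  -- can fix every class.
  mates : Fin v → Fin nb → ℕ
  mates x j = count (mates? x j)

  mates-const : ∀ {x j y l} → I x j → I y l → mates x j ≡ mates y l
  mates-const {x} {j} {y} {l} i i′ with flag-transitive i i′
  ... | g , refl , refl = Action.count-act blocks (mates? x j) (mates? (g · x) (g ·ᴮ j)) g
      (λ l (a , e) → I-act g a , shape-act g e)
      (λ l (a , e) → subst (λ y → I y ((g ⁻¹) ·ᴮ l)) (Action.act-⁻¹ˡ points g x) (I-act (g ⁻¹) a) , shape-act⁻¹ g e)

  shape-class : Fin nb → ℕ
  shape-class j = count (sameShape? j)

  shape-class-const : ∀ j l → shape-class j ≡ shape-class l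
  shape-class-const j l with flag-transitive (proj₂ (block-point j)) (proj₂ (block-point l))
  ... | g , _ , refl = Action.count-act blocks (sameShape? j) (sameShape? (g ·ᴮ j)) g
      (λ _ → shape-act g) (λ _ → shape-act⁻¹ g)

  module _ {x₀ j₀} (i₀ : I x₀ j₀) where

    -- A set of blocks through x that is closed under `SameShape` is a union of groups of mates.
    mates-∣-closed : {P : Fin nb → Set} (P? : Decidable P) (x : Fin v) → (∀ j → P j → I x j) →
      (∀ j l → P j → I x l → SameShape j l → P l) → mates x₀ j₀ ∣ count P?
    mates-∣-closed P? x inc closed = class-size-∣-count P? (mates? x)
      (record { rfl = λ j pj → inc j pj , shape-refl
              ; symm = λ j l pj (_ , e) → inc j pj , shape-sym e
              ; trns = λ i j l pi (_ , e) (a , f) → a , shape-trans e f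
              ; closed = λ j l pj (a , e) → closed j l pj a e })
      (mates x₀ j₀) (λ j pj → mates-const (inc j pj) i₀)

    mates∣r : mates x₀ j₀ ∣ r
    mates∣r = subst (mates x₀ j₀ ∣_) (point-count x₀)
      (mates-∣-closed (I? x₀) x₀ (λ _ i → i) (λ _ _ _ i _ → i))

    mates∣h₂ : ∀ {c} → cl x₀ ≢ c → mates x₀ j₀ ∣ h₂
    mates∣h₂ {c} ne = subst (mates x₀ j₀ ∣_) (count-h₂ x₀ ne)
      (mates-∣-closed (λ j → I? x₀ j ×-dec meets? c j) x₀ (λ _ → proj₁) (λ j l (_ , w) i e → i , proj₁ (e c) w))

    -- Count the flags (x, l) with x in the class of x₀ and l of the shape of j₀: each of the θ
    -- blocks has ℓ such points, each such point has `mates` blocks. Moreover θ divides the number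
    -- of blocks.
    mates∣ℓb : mates x₀ j₀ ∣ ℓ * nb
    mates∣ℓb = ∣-trans (divides (count P?) (sym eq)) (subst (_∣ ℓ * nb) (*-comm ℓ θ) (*-monoʳ-∣ ℓ θ∣b))
      where
      θ = shape-class j₀
      θ∣b : θ ∣ nb
      θ∣b = subst (θ ∣_) (count-all (λ j → j ≟ᶠ j) (λ _ → refl))
        (class-size-∣-count (λ j → j ≟ᶠ j) sameShape?
          (record { rfl = λ _ _ → shape-refl ; symm = λ _ _ _ → shape-sym ; trns = λ _ _ _ _ → shape-trans ; closed = λ _ _ _ _ → refl })
          θ (λ j _ → shape-class-const j j₀))
      P? : Decidable (λ x → cl x ≡ cl x₀ × ∃ λ l → SameShape j₀ l × I x l)
      P? x = (cl x ≟ᶠ cl x₀) ×-dec any? (λ l → sameShape? j₀ l ×-dec I? x l)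
      eq : count P? * mates x₀ j₀ ≡ θ * ℓ
      eq = biregular P? (sameShape? j₀) I? (mates x₀ j₀) ℓ
        (λ { x (_ , l , e , i) → trans (count-cong _ (mates? x l)
               (λ l′ (e′ , i′) → i′ , shape-trans (shape-sym e) e′) (λ l′ (i′ , e′) → shape-trans e e′ , i′))
             (mates-const i i₀) })
        (λ l e → trans (count-cong _ (λ y → (cl y ≟ᶠ cl x₀) ×-dec I? y l) (λ _ ((a , _) , i) → a , i) (λ y (a , i) → (a , l , e , i) , i))
           (class-meet-count (proj₁ (e (cl x₀)) (x₀ , refl , i₀))))

  module ClassFixing (g : Fin order) (fix : ∀ c → g ·ᶜ c ≡ c) where

    same-shape : ∀ j → SameShape j (g ·ᴮ j)
    same-shape j c = (λ w → subst (λ d → Meets d (g ·ᴮ j)) (fix c) (meets-act g w)) ,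
      λ w → subst (Meets c) (Action.act-⁻¹ˡ blocks g j) (meets-⁻¹ g (subst (λ d → Meets d (g ·ᴮ j)) (sym (fix c)) w))

    cl-fixed : ∀ x → cl (g · x) ≡ cl x
    cl-fixed x = trans (cl-act g x) (fix (cl x))

    -- With a single block of each shape through each point, the block through x and g x
    -- is fixed by g, so it contains the whole g-orbit of x.
    mates≢1 : ∀ {p} → Prime p → ℓ < p → g ^ᵍ p ≡ ε → ∀ {x} → g · x ≢ x →
      (∀ {y j} → I y j → mates y j ≡ 1) → ⊥
    mates≢1 {p} pr ℓ<p gp {x} mv one = <⇒≱ ℓ<p (≤-trans (≤-reflexive (sym (count-orbit x (Action.act-period points g p gp x) mv)))
        (≤-trans (count-mono (orbit? x) (λ y → (cl y ≟ᶠ cl x) ×-dec I? y j) inside) (≤-reflexive (meet-count ix))))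
      where
      open PrimeCycle pr (g ·_)
      jw = pair-block (λ e → mv (sym e))
      j = proj₁ jw
      ix : I x j
      ix = proj₁ (proj₂ jw)
      igx : I (g · x) j
      igx = proj₂ (proj₂ jw)
      gj≡j : g ·ᴮ j ≡ j
      gj≡j with g ·ᴮ j ≟ᶠ j
      ... | yes e = e
      ... | no ne = ⊥-elim (two (one igx))
        where
        pair? = λ l → (l ≟ᶠ j) ⊎-dec (l ≟ᶠ (g ·ᴮ j))
        pair≡2 : count pair? ≡ 2
        pair≡2 = trans (count-⊎ (_≟ᶠ j) (_≟ᶠ (g ·ᴮ j)) (λ { l refl e → ne (sym e) })) (cong₂ _+_ (count-≡ j) (count-≡ (g ·ᴮ j)))
        two : mates (g · x) j ≡ 1 → ⊥
        two e = <⇒≱ {1} {2} (s≤s (s≤s z≤n)) (subst₂ _≤_ pair≡2 e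
          (count-mono pair? (mates? (g · x) j)
            (λ { l (inj₁ refl) → igx , shape-refl ; l (inj₂ refl) → I-act g ix , same-shape j })))
      inside : ∀ y → Orbit x y → cl y ≡ cl x × I y j
      inside _ (i , refl) = go (toℕ i)
        where
        go : ∀ t → cl (iter (g ·_) t x) ≡ cl x × I (iter (g ·_) t x) j
        go zero    = refl , ix
        go (suc t) = trans (cl-fixed _) (proj₁ (go t)) , subst (I _) gj≡j (I-act g (proj₂ (go t)))

  module _ {p : ℕ} (pr : Prime p) (2<p : 2 < p) (ℓ≡2 : ℓ ≡ 2) (two : ∀ {y j} → I y j → mates y j ≡ 2)
    (g : Fin order) (fix : ∀ c → g ·ᶜ c ≡ c) (gp : g ^ᵍ p ≡ ε) {α : Fin v} (mv : g · α ≢ α) where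

    Mate : Fin v → Set
    Mate β = cl β ≡ cl α × β ≢ α

    mate? : Decidable Mate
    mate? β = (cl β ≟ᶠ cl α) ×-dec ¬? (β ≟ᶠ α)

    third : ∀ {x y z j} → I x j → I y j → I z j → cl y ≡ cl x → cl z ≡ cl x → x ≢ y → x ≢ z → y ≡ z
    third {x} {j = j} ix iy iz ey ez = count-≤2 (λ y → (cl y ≟ᶠ cl x) ×-dec I? y j) (≤-reflexive (trans (meet-count ix) ℓ≡2))
      (refl , ix) (ey , iy) (ez , iz)

    -- Some block through α and β has the same shape as some block through α and γ. With two blocks
    -- of each shape at α, and two points of the class on each, this pairs up the other points of
    -- the class.
    Hat : Fin v → Fin v → Set
    Hat β γ = ∃ λ l → ∃ λ l′ → (I α l × I β l) × (I α l′ × I γ l′) × SameShape l l′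

    hat? : ∀ β γ → Dec (Hat β γ)
    hat? β γ = any? (λ l → any? (λ l′ → (I? α l ×-dec I? β l) ×-dec (I? α l′ ×-dec I? γ l′) ×-dec sameShape? l l′))

    hat-sym : ∀ {β γ} → Hat β γ → Hat γ β
    hat-sym (l , l′ , a , b , e) = l′ , l , b , a , shape-sym e

    -- Let h carry α and a block through α and g α to α and a block through α and β. It must send g
    -- α to the only other point of the class on that block, which is β; so h g h⁻¹ sends α to β.
    translate : ∀ {β} → Mate β → ∃ λ h → (∀ c → h ·ᶜ c ≡ c) × (∀ x → iter (h ·_) p x ≡ x) × h · α ≡ β
    translate {β} (cβ , β≢α) with pair-block (λ e → mv (sym e)) | pair-block (λ e → β≢α (sym e))
    ... | l₀ , iα , igα | l , jα , jβ with flag-transitive iα jα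
    ... | h , hα , refl = conj h g ,
        (λ c → conj-fixed classes h g c (fix ((h ⁻¹) ·ᶜ c))) ,
        conj-period points h g p (Action.act-period points g p gp) ,
        trans (Action.act-conj points h g α) (trans (cong (λ y → h · (g · y)) (Action.act-to-⁻¹ points h hα))
          (third jα (I-act h igα) jβ hgα-class cβ
            (λ e → mv (Action.act-injective points h (trans (sym e) (sym hα)))) (λ e → β≢α (sym e))))
      where
      hgα-class : cl (h · (g · α)) ≡ cl α
      hgα-class = trans (cl-act h (g · α)) (trans (cong (h ·ᶜ_) (trans (cl-act g α) (fix (cl α))))
        (trans (sym (cl-act h α)) (cong cl hα)))

    -- The element h of `translate` fixes all classes, so h⁻¹ takes a block l through α and β to a
    -- block of the same shape through γ = h⁻¹ α and α. No third block of this shape passes through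
    -- α.
    hat-unique : ∀ {β} → Mate β → ∃ λ γ → Mate γ × γ ≢ β × Hat β γ × (∀ δ → Mate δ → δ ≢ β → Hat β δ → δ ≡ γ)
    hat-unique {β} (cβ , β≢α) with translate (cβ , β≢α)
    ... | h , hfix , per , hα = γ , (cγ , γ≢α) , γ≢β , exists , unique
      where
      γ = (h ⁻¹) · α
      hγ : h · γ ≡ α
      hγ = Action.act-⁻¹ʳ points h α
      cγ : cl γ ≡ cl α
      cγ = trans (sym (hfix (cl γ))) (trans (sym (cl-act h γ)) (cong cl hγ))
      γ≢α : γ ≢ α
      γ≢α e = β≢α (trans (sym hα) (trans (cong (h ·_) (sym e)) hγ))
      -- Equality would give h² α = α, impossible for odd p because h moves α.
      γ≢β : γ ≢ β
      γ≢β e = β≢α (trans (sym hα) (iter-coprime (h ·_) 2 p α (prime-coprime-< 2 pr (s≤s z≤n) 2<p)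
        (trans (cong (h ·_) hα) (trans (cong (h ·_) (sym e)) hγ)) (per α)))
      back : ∀ {l} → I α l → I β l → I γ ((h ⁻¹) ·ᴮ l) × I α ((h ⁻¹) ·ᴮ l)
      back iα iβ = I-act (h ⁻¹) iα , subst (λ y → I y _) (Action.act-to-⁻¹ points h hα) (I-act (h ⁻¹) iβ)
      open ClassFixing
      h⁻¹fix : ∀ c → (h ⁻¹) ·ᶜ c ≡ c
      h⁻¹fix c = Action.act-to-⁻¹ classes h (hfix c)
      exists : Hat β γ
      exists with pair-block (λ e → β≢α (sym e))
      ... | l , iα , iβ = l , (h ⁻¹) ·ᴮ l , (iα , iβ) , (proj₂ (back iα iβ) , proj₁ (back iα iβ)) , same-shape (h ⁻¹) h⁻¹fix l
      unique : ∀ δ → Mate δ → δ ≢ β → Hat β δ → δ ≡ γ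
      unique δ (cδ , δ≢α) δ≢β (l , l′ , (iα , iβ) , (jα , jδ) , e) =
        third jα jδ (subst (I γ) (sym l′≡) (proj₁ (back iα iβ))) cδ cγ (λ e → δ≢α (sym e)) (λ e → γ≢α (sym e))
        where
        -- Both sides differ from l, and only two blocks of this shape contain α.
        l′≡ : l′ ≡ (h ⁻¹) ·ᴮ l
        l′≡ = count-≤2 (mates? α l) (≤-reflexive (two iα)) (iα , shape-refl) (jα , e)
          (proj₂ (back iα iβ) , same-shape (h ⁻¹) h⁻¹fix l)
          (λ { refl → δ≢β (third iα jδ iβ cδ cβ (λ e → δ≢α (sym e)) (λ e → β≢α (sym e))) })
          (λ q → γ≢β (third iα (subst (I γ) (sym q) (proj₁ (back iα iβ))) iβ cγ cβ (λ e → γ≢α (sym e)) (λ e → β≢α (sym e))))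

    -- β ↦ h⁻¹ α, for h ∈ G fixing all classes with h α = β, pairs up the s − 1 other
    -- points of the class of α.
    mates≡2⇒odd : 2 ∣ s ∸ 1
    mates≡2⇒odd = subst (2 ∣_) count-mate (class-size-∣-count mate? E?
      (record
        { rfl = λ β w → w , inj₁ refl
        ; symm = λ β γ w (w′ , e) → w , [ (λ e → inj₁ (sym e)) , (λ q → inj₂ (hat-sym q)) ]′ e
        ; trns = trns
        ; closed = λ _ _ _ → proj₁ }) 2 size)
      where
      E? : ∀ β γ → Dec (Mate γ × (γ ≡ β ⊎ Hat β γ))
      E? β γ = mate? γ ×-dec ((γ ≟ᶠ β) ⊎-dec hat? β γ)
      trns : ∀ β γ δ → Mate β → Mate γ × (γ ≡ β ⊎ Hat β γ) → Mate δ × (δ ≡ γ ⊎ Hat γ δ) → Mate δ × (δ ≡ β ⊎ Hat β δ)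
      trns β γ δ wβ (wγ , inj₁ refl) e = e
      trns β γ δ wβ e (wδ , inj₁ refl) = e
      trns β γ δ wβ (wγ , inj₂ q) (wδ , inj₂ q′) with γ ≟ᶠ β | δ ≟ᶠ γ
      ... | yes refl | _ = wδ , inj₂ q′
      ... | _ | yes refl = wδ , inj₂ q
      ... | no γ≢β | no δ≢γ with hat-unique wγ
      ...   | _ , _ , _ , _ , u = wδ , inj₁ (trans (u δ wδ δ≢γ q′) (sym (u β wβ (λ e → γ≢β (sym e)) (hat-sym q))))
      size : ∀ β → Mate β → count (E? β) ≡ 2
      size β w with hat-unique w
      ... | γ , wγ , γ≢β , q , u = trans (count-cong (E? β) (λ δ → (δ ≟ᶠ β) ⊎-dec (δ ≟ᶠ γ))
              (λ { δ (_ , inj₁ e) → inj₁ e ; δ (wδ , inj₂ q′) → split δ wδ q′ })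
              (λ { δ (inj₁ refl) → w , inj₁ refl ; δ (inj₂ refl) → wγ , inj₂ q }))
            (trans (count-⊎ (_≟ᶠ β) (_≟ᶠ γ) (λ { δ refl e → γ≢β (sym e) })) (cong₂ _+_ (count-≡ β) (count-≡ γ)))
        where
        split : ∀ δ → Mate δ → Hat β δ → δ ≡ β ⊎ δ ≡ γ
        split δ wδ q′ with δ ≟ᶠ β
        ... | yes e = inj₁ e
        ... | no ne = inj₂ (u δ wδ ne q′)
      count-mate : count mate? ≡ s ∸ 1
      count-mate = sym (begin
        s ∸ 1                                                      ≡⟨ cong (_∸ 1) (sym (class-count (cl α))) ⟩
        count (λ β → cl β ≟ᶠ cl α) ∸ 1                             ≡⟨ cong (_∸ 1) (count-split (λ β → cl β ≟ᶠ cl α) (_≟ᶠ α)) ⟩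
        (count (λ β → (cl β ≟ᶠ cl α) ×-dec (β ≟ᶠ α)) + count mate?) ∸ 1
          ≡⟨ cong (λ t → (t + count mate?) ∸ 1) (count-unique (λ β → (cl β ≟ᶠ cl α) ×-dec (β ≟ᶠ α)) α (refl , refl) (λ _ → proj₂)) ⟩
        count mate? ∎)

count-remove : ∀ {n} {P : Fin n → Set} (P? : Decidable P) {x} → P x →
  count P? ≡ suc (count (λ i → P? i ×-dec ¬? (i ≟ᶠ x)))
count-remove P? {x} px = trans (count-split P? (_≟ᶠ x))
  (cong (_+ count (λ i → P? i ×-dec ¬? (i ≟ᶠ x)))
    (count-unique (λ i → P? i ×-dec (i ≟ᶠ x)) x (px , refl) (λ _ → proj₂)))

count-≢ : ∀ {n} (x : Fin n) → suc (count (λ y → ¬? (y ≟ᶠ x))) ≡ n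
count-≢ x = trans (cong suc (count-cong _ _ (λ _ ne → refl , ne) (λ _ → proj₂)))
  (trans (sym (count-remove (λ y → y ≟ᶠ y) {x} refl)) (count-all (λ y → y ≟ᶠ y) (λ _ → refl)))

module Orbits {Γ : FinGroup} {n : ℕ} (A : Action Γ n) {H : Fin (FinGroup.order Γ) → Set}
  (H? : Decidable H) (sub : FinGroup.Subgroup Γ H) where

  open FinGroup Γ
  open Action A
  open Subgroup sub

  InOrbit : Fin n → Fin n → Set
  InOrbit x y = ∃ λ h → H h × act h x ≡ y

  inOrbit? : ∀ x y → Dec (InOrbit x y)
  inOrbit? x y = any? (λ h → H? h ×-dec (act h x ≟ᶠ y))

  inOrbit-refl : ∀ {x} → InOrbit x x
  inOrbit-refl = ε , ε-closed , act-ε _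

  inOrbit-sym : ∀ {x y} → InOrbit x y → InOrbit y x
  inOrbit-sym (h , Hh , e) = h ⁻¹ , ⁻¹-closed Hh , act-to-⁻¹ h e

  inOrbit-trans : ∀ {x y z} → InOrbit x y → InOrbit y z → InOrbit x z
  inOrbit-trans (h , Hh , refl) (h′ , Hh′ , refl) = h′ ∙ h , ∙-closed Hh′ Hh , act-∙ h′ h _

  inOrbit-act : ∀ {x y g} → H g → InOrbit x y → InOrbit x (act g y)
  inOrbit-act Hg o = inOrbit-trans o (_ , Hg , refl)

  inOrbit-transitive : ∀ {x y z} → InOrbit x y → InOrbit x z → InOrbit y z
  inOrbit-transitive o o′ = inOrbit-trans (inOrbit-sym o) o′

module DesignTools (D : ImprimitiveDesign) where

  open ImprimitiveDesign D

  meets-inv : ∀ {g c j} → g ·ᶜ c ≡ c → Meets c j → Meets c (g ·ᴮ j)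
  meets-inv {g} e w = subst (λ d → Meets d (g ·ᴮ _)) e (meets-act g w)

  stabilizer : {H : Fin order → Set} → Subgroup H → ∀ w → Subgroup (λ g → H g × Stab w g)
  stabilizer sub w = record
    { ε-closed = ε-closed sub , ε-closed (stab-subgroup w)
    ; ∙-closed = λ (h , e) (h′ , e′) → ∙-closed sub h h′ , ∙-closed (stab-subgroup w) e e′
    ; ⁻¹-closed = λ {x} (h , e) → ⁻¹-closed sub h , ⁻¹-closed (stab-subgroup w) {x} e }
    where open Subgroup

  count-meeting-const : {H : Fin order → Set} (sub : Subgroup H) {Q : Fin nb → Set} (Q? : Decidable Q) →
    (∀ {h j} → H h → Q j → Q (h ·ᴮ j)) → ∀ {h c} → H h →
    count (λ j → Q? j ×-dec meets? c j) ≡ count (λ j → Q? j ×-dec meets? (h ·ᶜ c) j)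
  count-meeting-const sub Q? inv {h} {c} Hh = Action.count-act blocks _ _ h
    (λ j (q , w) → inv Hh q , meets-act h w)
    (λ j (q , w) → inv (Subgroup.⁻¹-closed sub Hh) q , meets-⁻¹ h w)

  module _ (a : Fin N) {O : Fin N → Set} (O? : Decidable O)
    (O-closed : ∀ {g c} → Stab a g → O c → O (g ·ᶜ c)) (a∉O : ¬ O a) where

    private
      j₀ : Fin nb
      j₀ = proj₁ (point-block (proj₁ (class-point a)))
      w₀ : Meets a j₀
      w₀ = proj₁ (class-point a) , proj₂ (class-point a) , proj₂ (point-block (proj₁ (class-point a)))

    trace : ℕ
    trace = count (λ c → O? c ×-dec meets? c j₀)

    -- By flag-transitivity the stabilizer of a is transitive on the blocks meeting a.
    trace-const : ∀ {j} → Meets a j → count (λ c → O? c ×-dec meets? c j) ≡ trace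
    trace-const w with stab-block-transitive a w₀ w
    ... | g , ga , refl = sym (Action.count-act classes _ _ g
        (λ c (o , w) → O-closed ga o , meets-act g w)
        (λ c (o , w) → O-closed (Subgroup.⁻¹-closed (stab-subgroup a) {g} ga) o ,
          subst (Meets _) (Action.act-⁻¹ˡ blocks g j₀) (meets-act (g ⁻¹) w)))

    -- Double counting of blocks meeting a against the classes of O that they meet; it restricts the
    -- orbit lengths of the stabilizer of a.
    trace-eq : c₁ * trace ≡ count O? * c₂
    trace-eq = trans (cong (_* trace) (sym (count-c₁ a)))
      (biregular (λ j → meets? a j) O? (λ j c → meets? c j) trace c₂ (λ j → trace-const)
        (λ c o → count-c₂ (λ { refl → a∉O o })))

  orbit-avoids : ∀ {a c} → c ≢ a → ¬ Orbits.InOrbit classes (stab? a) (stab-subgroup a) c a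
  orbit-avoids c≢a (h , ha , e) = c≢a (Action.act-injective classes h (trans e (sym ha)))

  moved-class : ∀ {p} → Prime p → p ∣ s → (∀ g → (∀ c → g ·ᶜ c ≡ c) → g ^ᵍ p ≡ ε → g ≢ ε → ⊥) →
    ∀ a → ∃ λ g → Stab a g × g ^ᵍ p ≡ ε × ∃ λ c → g ·ᶜ c ≢ c
  moved-class pr p∣s excluded a with prime-element pr p∣s a
  ... | g , ga , g≢ε , gp with any? (λ c → ¬? (g ·ᶜ c ≟ᶠ c))
  ...   | yes w = g , ga , gp , w
  ...   | no none = ⊥-elim (excluded g (λ c → decidable-stable (g ·ᶜ c ≟ᶠ c) (λ ne → none (c , ne))) gp g≢ε)

  moved-point : ∀ g → g ≢ ε → ∃ λ x → g · x ≢ x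
  moved-point g ne with any? (λ x → ¬? (g · x ≟ᶠ x))
  ... | yes w = w
  ... | no none = ⊥-elim (ne (faithful g (λ x → decidable-stable (g · x ≟ᶠ x) (λ ne → none (x , ne)))))

  other-class : 2 ≤ N → ∀ a → ∃ λ c → a ≢ c
  other-class le a with any? (λ c → ¬? (a ≟ᶠ c))
  ... | yes w = w
  ... | no none = contradiction (≤-trans le (≤-reflexive (trans (sym (count-all (λ c → c ≟ᶠ a)
          (λ c → sym (decidable-stable (a ≟ᶠ c) (λ ne → none (c , ne)))))) (count-≡ a)))) λ { (s≤s ()) }

-- Blocks meeting classes in pairs

-- The designs 2-(100,12,2) and 2-(484,24,2), for p = 5 and p = 11.
record PairParameters (D : ImprimitiveDesign) : Set where
  open ImprimitiveDesign D
  field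
    q : ℕ

  p : ℕ
  p = 3 + q

  field
    pr  : Prime p
    ℓ≡2 : ℓ ≡ 2
    N≡  : N ≡ 2 * p
    s≡  : s ≡ 2 * p
    r≡  : r ≡ 2 * (5 + 2 * q)
    m≡  : m ≡ 4 + q
    h₂≡ : h₂ ≡ 2 * p
    c₁≡ : c₁ ≡ 2 * p * (5 + 2 * q)
    c₂≡ : c₂ ≡ 2 * (p * p)
    -- The quotient p²(p - 2)/(2p - 3) would be the number of blocks meeting four suitable classes.
    indivisible : ¬ (3 + 2 * q ∣ p * p * (1 + q))

module PairCase (D : ImprimitiveDesign) (params : PairParameters D) where

  open ImprimitiveDesign D
  open PairParameters params
  open DesignTools D

  -- The number of mates divides h₂ = 2p and r = 4p - 2, hence 2 h₂ - r = 2. The value 1 would put p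
  -- > 2 points of a class on one block; the value 2 would make s - 1 = 2p - 1 even.
  no-class-fixing : ∀ g → (∀ c → g ·ᶜ c ≡ c) → g ^ᵍ p ≡ ε → g ≢ ε → ⊥
  no-class-fixing g fix gp ne with moved-point g ne
  ... | α , mv with pair-block (λ e → mv (sym e))
  ... | j , iα , _ with prime⇒irreducible prime[2] n∣2
    where
    n∣2 : mates α j ∣ 2
    n∣2 = ∣m+n∣m⇒∣n (subst (mates α j ∣_) (eqn q) (∣-trans
            (mates∣h₂ iα (proj₂ (other-class (subst (2 ≤_) (sym N≡) (*-monoʳ-≤ 2 {1} {3 + q} (s≤s z≤n))) (cl α))))
            (subst (_∣ 2 * (2 * p)) (sym h₂≡) (n∣m*n 2))))
          (subst (mates α j ∣_) r≡ (mates∣r iα))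
      where
      eqn : ∀ q → 2 * (2 * (3 + q)) ≡ 2 * (5 + 2 * q) + 2
      eqn = solve-∀
  ...   | inj₁ one = ClassFixing.mates≢1 g fix pr (subst (_< p) (sym ℓ≡2) (s≤s (s≤s (s≤s z≤n)))) gp mv
            (λ i → trans (mates-const i iα) one)
  ...   | inj₂ two = contradiction (∣1⇒≡1 (∣m+n∣m⇒∣n (subst (2 ∣_) odd even) (m∣m*n (q + 2)))) λ ()
    where
    even : 2 ∣ s ∸ 1
    even = mates≡2⇒odd pr (s≤s (s≤s (s≤s z≤n))) ℓ≡2 (λ i → trans (mates-const i iα) two) g fix gp mv
    odd : s ∸ 1 ≡ 2 * (q + 2) + 1
    odd = cong (_∸ 1) (trans s≡ (eqn q))
      where
      eqn : ∀ q → 2 * (3 + q) ≡ suc (2 * (q + 2) + 1)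
      eqn = solve-∀

  module Chain (a : Fin N) (g : Fin order) (ga : Stab a g) (per : ∀ c → iter (g ·ᶜ_) p c ≡ c)
    (x₀ : Fin N) (mv : g ·ᶜ x₀ ≢ x₀) where

    fixed≢x₀ : ∀ {c} → g ·ᶜ c ≡ c → x₀ ≢ c
    fixed≢x₀ fc refl = mv fc

    open Orbits classes (stab? a) (stab-subgroup a)

    Ω₁? : Decidable (λ c → c ≢ a)
    Ω₁? c = ¬? (c ≟ᶠ a)

    count-Ω₁ : count Ω₁? ≡ 5 + 2 * q
    count-Ω₁ = suc-injective (trans (count-≢ a) (trans N≡ (eqn q)))
      where
      eqn : ∀ q → 2 * (3 + q) ≡ suc (5 + 2 * q)
      eqn = solve-∀

    -- If a block meeting a meets t classes of the orbit, then (2p - 1) t = p |orbit|. Since 2p - 1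
    -- is prime to p, it divides the orbit length.
    Ω₁-orbit : ∀ c → c ≢ a → InOrbit x₀ c
    Ω₁-orbit = count-full (inOrbit? x₀) Ω₁? (λ c o → λ { refl → orbit-avoids (fixed≢x₀ ga) o })
      (≤-trans (≤-reflexive count-Ω₁) (∣⇒≤ {{>-nonZero (count-pos (inOrbit? x₀) x₀ inOrbit-refl)}} u∣O))
      where
      t : ℕ
      t = trace a (inOrbit? x₀) inOrbit-act (orbit-avoids (fixed≢x₀ ga))
      eq : (5 + 2 * q) * t ≡ p * count (inOrbit? x₀)
      eq = *-cancelˡ-≡ _ _ (2 * p) (begin
        2 * p * ((5 + 2 * q) * t)               ≡⟨ sym (*-assoc (2 * p) (5 + 2 * q) t) ⟩
        2 * p * (5 + 2 * q) * t                 ≡⟨ cong (_* t) (sym c₁≡) ⟩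
        c₁ * t                                  ≡⟨ trace-eq a (inOrbit? x₀) inOrbit-act (orbit-avoids (fixed≢x₀ ga)) ⟩
        count (inOrbit? x₀) * c₂                ≡⟨ cong (count (inOrbit? x₀) *_) c₂≡ ⟩
        count (inOrbit? x₀) * (2 * (p * p))     ≡⟨ eqn (count (inOrbit? x₀)) p ⟩
        2 * p * (p * count (inOrbit? x₀)) ∎)
        where
        open ≡-Reasoning
        eqn : ∀ o p → o * (2 * (p * p)) ≡ 2 * p * (p * o)
        eqn = solve-∀
      u∣O : 5 + 2 * q ∣ count (inOrbit? x₀)
      u∣O = coprime-divisor (λ {d} (d∣u , d∣p) → ∣1⇒≡1 (∣m+n∣m⇒∣n
          (subst (d ∣_) (eqn q) (∣-trans d∣p (n∣m*n 2))) d∣u)) (subst (5 + 2 * q ∣_) eq (m∣m*n t))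
        where
        eqn : ∀ q → 2 * (3 + q) ≡ 5 + 2 * q + 1
        eqn = solve-∀

    -- A set O of n classes on which the stabilizer H of its complement is transitive; f blocks
    -- meet every class of the complement, and each of these meets t classes of O.
    record Stage (n t f : ℕ) : Set₁ where
      field
        {H} : Fin order → Set
        H? : Decidable H
        sub : Subgroup H
        {O} : Fin N → Set
        O? : Decidable O
        O-closed : ∀ {g x} → H g → O x → O (g ·ᶜ x)
        transitive : ∀ {x y} → O x → O y → ∃ λ g → H g × g ·ᶜ x ≡ y
        count-O : count O? ≡ n
        Hg : H g
        Ox₀ : O x₀
        {Q} : Fin nb → Set
        Q? : Decidable Q
        Q-closed : ∀ {h j} → H h → Q j → Q (h ·ᴮ j)
        count-Q : count Q? ≡ f
        Q-trace : ∀ j → Q j → count (λ c → O? c ×-dec meets? c j) ≡ t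

      f′ : ℕ
      f′ = count (λ j → Q? j ×-dec meets? x₀ j)

      count-extended : ∀ c → O c → count (λ j → Q? j ×-dec meets? c j) ≡ f′
      count-extended c Oc with transitive Oc Ox₀
      ... | h , Hh , refl = count-meeting-const sub Q? Q-closed {h} Hh

      f′-eq : f * t ≡ n * f′
      f′-eq = subst₂ (λ f n → f * t ≡ n * f′) count-Q count-O
        (biregular Q? O? (λ j c → meets? c j) t f′ Q-trace count-extended)

      module _ (p<n : p < n) (n<2p : n < p + p) where
        private
          p<O = subst (p <_) (sym count-O) p<n
          O<2p = subst (_< p + p) (sym count-O) n<2p

        -- On fewer than 2p classes g has only one p-cycle, which does not exhaust O.
        fixed-class : ∃ λ w → O w × g ·ᶜ w ≡ w
        fixed-class with any? (λ w → O? w ×-dec (g ·ᶜ w ≟ᶠ w))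
        ... | yes w = w
        ... | no none = contradiction (≤-trans
            (count-mono O? (orbit? x₀) (λ y Oy → moved-connected O<2p g Hg per x₀ y Ox₀ Oy mv (λ e → none (y , Oy , e))))
            (≤-reflexive (count-moved-orbit x₀ mv))) (<⇒≱ p<O)
          where
          open MovedPoints classes pr sub O? O-closed
          open At g Hg per

        w : Fin N
        w = proj₁ fixed-class

        Ow : O w
        Ow = proj₁ (proj₂ fixed-class)

        -- A class w of O fixed by g joins the complement. Jordan's argument makes the stabilizer of
        -- w transitive on the rest, and g still belongs to it and still moves x₀.
        next : Stage (n ∸ 1) (t ∸ 1) f′
        next = record
          { H? = λ h → H? h ×-dec stab? w h
          ; sub = stabilizer sub w
          ; O? = λ c → O? c ×-dec ¬? (c ≟ᶠ w)
          ; O-closed = λ {h} (Hh , hw) (Oc , ne) → O-closed Hh Oc , λ e → ne (Action.act-injective classes h (trans e (sym hw)))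
          ; transitive = λ (Ox , nx) (Oy , ny) → regroup (stabilizer-transitive classes pr H? sub O? O-closed
              transitive p<O O<2p g Hg per x₀ Ox₀ mv Ow Ox Oy nx ny)
          ; count-O = cong (_∸ 1) (trans (sym (count-remove O? Ow)) count-O)
          ; Hg = Hg , proj₂ (proj₂ fixed-class)
          ; Ox₀ = Ox₀ , fixed≢x₀ (proj₂ (proj₂ fixed-class))
          ; Q? = λ j → Q? j ×-dec meets? w j
          ; Q-closed = λ {h} (Hh , hw) (Qj , wj) → Q-closed Hh Qj , meets-inv {h} hw wj
          ; count-Q = count-extended w Ow
          ; Q-trace = λ j (Qj , wj) → trans
              (count-cong _ (λ c → (O? c ×-dec meets? c j) ×-dec ¬? (c ≟ᶠ w))
                (λ c ((o , ne) , me) → (o , me) , ne) (λ c ((o , me) , ne) → (o , ne) , me))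
              (cong (_∸ 1) (trans (sym (count-remove (λ c → O? c ×-dec meets? c j) (Ow , wj))) (Q-trace j Qj))) }
          where
          regroup : ∀ {x y} → (∃ λ h → H h × h ·ᶜ w ≡ w × h ·ᶜ x ≡ y) → ∃ λ h → (H h × h ·ᶜ w ≡ w) × h ·ᶜ x ≡ y
          regroup (h , Hh , hw , e) = h , (Hh , hw) , e

    stage₁ : Stage (5 + 2 * q) (3 + q) (2 * p * (5 + 2 * q))
    stage₁ = record
      { H? = stab? a ; sub = stab-subgroup a ; O? = Ω₁?
      ; O-closed = λ {h} ha ne e → ne (Action.act-injective classes h (trans e (sym ha)))
      ; transitive = λ nx ny → inOrbit-transitive (Ω₁-orbit _ nx) (Ω₁-orbit _ ny)
      ; count-O = count-Ω₁ ; Hg = ga ; Ox₀ = fixed≢x₀ ga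
      ; Q? = λ j → meets? a j
      ; Q-closed = λ {h} ha → meets-inv {h} ha
      ; count-Q = trans (count-c₁ a) c₁≡
      ; Q-trace = λ j aj → suc-injective (trans
          (cong suc (count-cong _ (λ c → meets? c j ×-dec ¬? (c ≟ᶠ a)) (λ c (ne , me) → me , ne) (λ c (me , ne) → ne , me)))
          (trans (sym (count-remove (λ c → meets? c j) aj)) (trans (count-m j) m≡))) }

    step : ∀ {n t f} f′ → Stage (suc n) (suc t) f → f * suc t ≡ suc n * f′ →
           p < suc n → suc n < p + p → Stage n t f′
    step {n} {t} f′ S eq p<n n<2p = subst (Stage n t)
      (*-cancelˡ-≡ (Stage.f′ S) f′ (suc n) (trans (sym (Stage.f′-eq S)) eq)) (Stage.next S p<n n<2p)

    -- The block counts run from 2p(2p - 1) to 2p(2p - 1) · p/(2p - 1) = 2p², then to 2p² · (p -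
    -- 1)/(2p - 2) = p². The next factor (p - 2)/(2p - 3) gives no integer.
    stage₂ : Stage (4 + 2 * q) (2 + q) (2 * (p * p))
    stage₂ = step (2 * (p * p)) stage₁ (eq q) (subst (p <_) (eq₁ q) (m<m+n p {suc (suc q)} (s≤s z≤n))) (≤-reflexive (eq₂ q))
      where
      eq : ∀ q → 2 * (3 + q) * (5 + 2 * q) * (3 + q) ≡ (5 + 2 * q) * (2 * ((3 + q) * (3 + q)))
      eq = solve-∀
      eq₁ : ∀ q → 3 + q + suc (suc q) ≡ 5 + 2 * q
      eq₁ = solve-∀
      eq₂ : ∀ q → suc (5 + 2 * q) ≡ 3 + q + (3 + q)
      eq₂ = solve-∀

    stage₃ : Stage (3 + 2 * q) (1 + q) (p * p)
    stage₃ = step (p * p) stage₂ (eq q) (subst (p <_) (eq₁ q) (m<m+n p {suc q} (s≤s z≤n))) (subst (4 + 2 * q <_) (eq₂ q) (n≤1+n _))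
      where
      eq : ∀ q → 2 * ((3 + q) * (3 + q)) * (2 + q) ≡ (4 + 2 * q) * ((3 + q) * (3 + q))
      eq = solve-∀
      eq₁ : ∀ q → 3 + q + suc q ≡ 4 + 2 * q
      eq₁ = solve-∀
      eq₂ : ∀ q → suc (5 + 2 * q) ≡ 3 + q + (3 + q)
      eq₂ = solve-∀

    last-stage : ∀ {n t f} → Stage n t f → n ∣ f * t
    last-stage {n} S = subst (n ∣_) (sym (Stage.f′-eq S)) (m∣m*n (Stage.f′ S))

    impossible : ⊥
    impossible = indivisible (last-stage stage₃)

  impossible : ⊥
  impossible with moved-class pr (subst (p ∣_) (sym s≡) (n∣m*n 2)) no-class-fixing (subst Fin (sym N≡) zero)
  ... | g , ga , gp , x₀ , mv = Chain.impossible _ g ga (Action.act-period classes g p gp) x₀ mv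

-- Blocks meeting classes in triples

-- Ordered pairs are carried by `Fin (n * n)`, so that `count` and `Action` also serve binary
-- relations.
module Pairs {n : ℕ} where

  fst snd : Fin (n * n) → Fin n
  fst z = proj₁ (remQuot {n} n z)
  snd z = proj₂ (remQuot {n} n z)

  pair : Fin n → Fin n → Fin (n * n)
  pair = combine

  fst-pair : ∀ x y → fst (pair x y) ≡ x
  fst-pair x y = cong proj₁ (remQuot-combine x y)

  snd-pair : ∀ x y → snd (pair x y) ≡ y
  snd-pair x y = cong proj₂ (remQuot-combine x y)

  pair-η : ∀ z → pair (fst z) (snd z) ≡ z
  pair-η = combine-remQuot {n} n

  pairs? : {R : Fin n → Fin n → Set} → (∀ x y → Dec (R x y)) → Decidable (λ z → R (fst z) (snd z))
  pairs? R? z = R? (fst z) (snd z)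

  count-pairs : {P : Fin n → Set} {R : Fin n → Fin n → Set} (P? : Decidable P) (R? : ∀ x y → Dec (R x y)) (q : ℕ) →
    (∀ x y → R x y → P x) → (∀ x → P x → count (R? x) ≡ q) → count (pairs? R?) ≡ count P? * q
  count-pairs {P} {R} P? R? q sub rows = count-fibres (pairs? R?) P? fst q (λ z r → sub _ _ r)
    (λ x px → trans (sym (count-bij (R? x) (λ z → pairs? R? z ×-dec (fst z ≟ᶠ x)) (pair x)
      (λ y r → subst₂ R (sym (fst-pair x y)) (sym (snd-pair x y)) r , fst-pair x y)
      (λ y y′ _ _ e → trans (sym (snd-pair x y)) (trans (cong snd e) (snd-pair x y′)))
      (λ { z (r , refl) → snd z , r , pair-η z })))
      (rows x px))

  pairAction : {Γ : FinGroup} → Action Γ n → Action Γ (n * n)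
  pairAction A = record
    { act = λ g z → pair (act g (fst z)) (act g (snd z))
    ; act-ε = λ z → trans (cong₂ pair (act-ε (fst z)) (act-ε (snd z))) (pair-η z)
    ; act-∙ = λ g h z → cong₂ pair
        (trans (act-∙ g h (fst z)) (cong (act g) (sym (fst-pair _ _))))
        (trans (act-∙ g h (snd z)) (cong (act g) (sym (snd-pair _ _)))) }
    where open Action A

  count-pairs-act : {Γ : FinGroup} (A : Action Γ n) {R S : Fin n → Fin n → Set} (R? : ∀ x y → Dec (R x y))
    (S? : ∀ x y → Dec (S x y)) (g : Fin (FinGroup.order Γ)) →
    (∀ x y → R x y → S (Action.act A g x) (Action.act A g y)) →
    (∀ x y → S x y → R (Action.act A (FinGroup._⁻¹ Γ g) x) (Action.act A (FinGroup._⁻¹ Γ g) y)) →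
    count (pairs? R?) ≡ count (pairs? S?)
  count-pairs-act A {R} {S} R? S? g to from = Action.count-act (pairAction A) (pairs? R?) (pairs? S?) g
    (λ z r → subst₂ S (sym (fst-pair _ _)) (sym (snd-pair _ _)) (to _ _ r))
    (λ z r → subst₂ R (sym (fst-pair _ _)) (sym (snd-pair _ _)) (from _ _ r))

open Pairs

opaque
  coprime-55-37 : Coprime 55 37
  coprime-55-37 = toWitness {a? = coprime? 55 37} tt

-- For an orbit of length 55: 6845 = c₂ blocks meet a and x₀, and each meets 36 of the 54 remaining
-- classes of the orbit.
short-indivisible : ∀ f o φ → f ≡ 6845 → o ≡ 54 → f * 36 ≡ o * φ → ⊥
short-indivisible _ _ φ refl refl e = from-no (54 ∣? 246420) (divides φ (trans e (*-comm 54 φ)))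

-- For a block meeting t classes of one half and 74 - t of the other, this is 185 times the number
-- of ordered pairs of distinct classes that it meets within a half.
halves : ℕ → ℕ
halves t = (t * (t ∸ 1) + (74 ∸ t) * (74 ∸ t ∸ 1)) * 185

halves-indivisible : ∀ t → t < 75 → ¬ (108 ∣ halves t)
halves-indivisible t t<75 d = subst (λ t → halves t % 108 ≢ 0) (toℕ-fromℕ< t<75)
  (toWitness {a? = all? (λ (i : Fin 75) → ¬? (halves (toℕ i) % 108 ≟ 0))} tt (fromℕ< t<75)) (n∣m⇒m%n≡0 (halves t) 108 d)

-- The design 2-(12321,225,5).
record TripleParameters (D : ImprimitiveDesign) : Set where
  open ImprimitiveDesign D
  field
    p   : ℕ
    p≡  : p ≡ 37
    pr  : Prime p
    ℓ≡3 : ℓ ≡ 3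
    N≡  : N ≡ 111
    s≡  : s ≡ 111
    r≡  : r ≡ 275
    b≡  : nb ≡ 15059
    m≡  : m ≡ 75
    h₂≡ : h₂ ≡ 185
    c₁≡ : c₁ ≡ 10175
    c₂≡ : c₂ ≡ 6845

module TripleCase (D : ImprimitiveDesign) (params : TripleParameters D) where

  open ImprimitiveDesign D
  open TripleParameters params
  open DesignTools D

  p∣s : p ∣ s
  p∣s = subst₂ _∣_ (sym p≡) (sym s≡) (divides 3 refl)

  -- The number of mates divides r = 275, h₂ = 185 and ℓ b = 45177, which have no common factor, so
  -- it is 1.
  no-class-fixing : ∀ g → (∀ c → g ·ᶜ c ≡ c) → g ^ᵍ p ≡ ε → g ≢ ε → ⊥
  no-class-fixing g fix gp ne with moved-point g ne
  ... | α , mv with pair-block (λ e → mv (sym e))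
  ... | j , iα , _ = ClassFixing.mates≢1 g fix pr (subst₂ _<_ (sym ℓ≡3) (sym p≡) (from-yes (3 <? 37))) gp mv
          (λ i → trans (mates-const i iα) (∣1⇒≡1 n∣1))
    where
    n : ℕ
    n = mates α j
    n∣275 : n ∣ 275
    n∣275 = subst (n ∣_) r≡ (mates∣r iα)
    n∣185 : n ∣ 185
    n∣185 = subst (n ∣_) h₂≡ (mates∣h₂ iα (proj₂ (other-class (subst (2 ≤_) (sym N≡) (from-yes (2 ≤? 111))) (cl α))))
    n∣45177 : n ∣ 45177
    n∣45177 = subst (n ∣_) (cong₂ _*_ ℓ≡3 b≡) (mates∣ℓb iα)
    n∣5 : n ∣ 5
    n∣5 = ∣m+n∣m⇒∣n {n} {550} {5} (∣n⇒∣m*n 3 n∣185) (∣n⇒∣m*n 2 n∣275)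
    n∣2 : n ∣ 2
    n∣2 = ∣m+n∣m⇒∣n {n} {45175} {2} n∣45177 (∣n⇒∣m*n 9035 n∣5)
    n∣1 : n ∣ 1
    n∣1 = ∣m+n∣m⇒∣n {n} {4} {1} n∣5 (∣n⇒∣m*n 2 n∣2)

  module Stabilizer (a : Fin N) where

    Ω : Fin N → Set
    Ω c = c ≢ a

    Ω? : Decidable Ω
    Ω? c = ¬? (c ≟ᶠ a)

    count-Ω : count Ω? ≡ 110
    count-Ω = suc-injective (trans (count-≢ a) N≡)

    Ω-act : ∀ {h c} → Stab a h → Ω c → Ω (h ·ᶜ c)
    Ω-act {h} ha ne e = ne (Action.act-injective classes h (trans e (sym ha)))

    open Subgroup (stab-subgroup a)
    open Orbits classes (stab? a) (stab-subgroup a)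

    -- Counting triples (j, x, y) with x, y ∈ S(j) and T x y, where S(j) is the set of the
    -- classes met by the block j.
    module Relation {T : Fin N → Fin N → Set} (T? : ∀ x y → Dec (T x y)) (T-Ω : ∀ x y → T x y → Ω x)
      (T-act : ∀ {h x y} → Stab a h → T x y → T (h ·ᶜ x) (h ·ᶜ y))
      (q : ℕ) (neighbours : ∀ x → Ω x → count (T? x) ≡ q)
      (single : ∀ {x y x′ y′} → T x y → T x′ y′ → ∃ λ h → Stab a h × h ·ᶜ x ≡ x′ × h ·ᶜ y ≡ y′) where

      Triple : Fin nb → Fin N → Fin N → Set
      Triple j x y = T x y × Meets x j × Meets y j

      triple? : ∀ j x y → Dec (Triple j x y)
      triple? j x y = T? x y ×-dec meets? x j ×-dec meets? y j

      opaque
        weight : Fin nb → ℕ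
        weight j = count (pairs? (triple? j))

        weight≡count : ∀ j → weight j ≡ count (pairs? (triple? j))
        weight≡count j = refl

      weight-const : ∀ {j l} → Meets a j → Meets a l → weight j ≡ weight l
      weight-const {j} aj al with stab-block-transitive a aj al
      ... | h , ha , refl = trans (weight≡count j) (trans (count-pairs-act classes (triple? j) (triple? (h ·ᴮ j)) h
        (λ x y (t , mx , my) → T-act {h} ha t , meets-act h mx , meets-act h my)
        (λ x y (t , mx , my) → T-act {h ⁻¹} (⁻¹-closed {h} ha) t , back mx , back my)) (sym (weight≡count (h ·ᴮ j))))
        where
        back : ∀ {c} → Meets c (h ·ᴮ j) → Meets ((h ⁻¹) ·ᶜ c) j
        back w = subst (Meets _) (Action.act-⁻¹ˡ blocks h j) (meets-act (h ⁻¹) w)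

      -- φ counts the blocks meeting a and both classes of a pair in T. The double count c₁ · weight
      -- = 110 · q · φ is divided by 55, using c₁ = 55 · 185.
      weight-eq : ∀ {x₀ y₀} → T x₀ y₀ → ∃ λ φ → ∀ {j} → Meets a j → weight j * 185 ≡ q * φ * 2
      weight-eq {x₀} {y₀} t₀ = φ₀ , λ {j} aj → cancel-55 (weight j) q φ₀ (begin
          c₁ * weight j                               ≡⟨ cong (_* weight j) (sym (count-c₁ a)) ⟩
          count (λ l → meets? a l) * weight j         ≡⟨ biregular (λ l → meets? a l) (pairs? T?) (λ l z → meets? (fst z) l ×-dec meets? (snd z) l)
                                                           (weight j) φ₀ (λ l al → trans (sym (weight≡count′ l)) (weight-const al aj)) (λ z → φ-const) ⟩
          count (pairs? T?) * φ₀                      ≡⟨ cong (_* φ₀) (count-pairs Ω? T? q T-Ω neighbours) ⟩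
          count Ω? * q * φ₀ ∎)
        where
        open ≡-Reasoning
        cancel-55 : ∀ w q φ → c₁ * w ≡ count Ω? * q * φ → w * 185 ≡ q * φ * 2
        cancel-55 w q φ e = *-cancelʳ-≡ (w * 185) (q * φ * 2) 55 (begin
          w * 185 * 55          ≡⟨ trans (*-assoc w 185 55) (*-comm w 10175) ⟩
          10175 * w             ≡⟨ cong (_* w) (sym c₁≡) ⟩
          c₁ * w                ≡⟨ e ⟩
          count Ω? * q * φ      ≡⟨ trans (cong (λ n → n * q * φ) count-Ω) (*-assoc 110 q φ) ⟩
          110 * (q * φ)         ≡⟨ trans (*-comm 110 (q * φ)) (sym (*-assoc (q * φ) 2 55)) ⟩
          q * φ * 2 * 55 ∎)
        φ : Fin N → Fin N → ℕ
        φ x y = count (λ j → meets? a j ×-dec (meets? x j ×-dec meets? y j))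
        φ₀ = φ x₀ y₀
        weight≡count′ : ∀ l → weight l ≡ count (λ z → pairs? T? z ×-dec meets? (fst z) l ×-dec meets? (snd z) l)
        weight≡count′ l = weight≡count l
        φ-const : ∀ {x y} → T x y → φ x y ≡ φ₀
        φ-const t with single t t₀
        ... | h , ha , refl , refl = Action.count-act blocks _ _ h
          (λ j (wa , wx , wy) → meets-inv {h} ha wa , meets-act h wx , meets-act h wy)
          (λ j (wa , wx , wy) → meets-inv {h ⁻¹} (⁻¹-closed {h} ha) wa , meets-⁻¹ h wx , meets-⁻¹ h wy)

    trace-of : (j : Fin nb) → Meets a j → count (λ c → Ω? c ×-dec meets? c j) ≡ 74
    trace-of j aj = suc-injective (trans
      (cong suc (count-cong _ (λ c → meets? c j ×-dec ¬? (c ≟ᶠ a)) (λ c (ne , me) → me , ne) (λ c (me , ne) → ne , me)))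
      (trans (sym (count-remove (λ c → meets? c j) aj)) (trans (count-m j) m≡)))

    -- 185 (t(t-1) + u(u-1)) with t + u = 74 is never divisible by 108, already modulo 27.
    module TwoHalves {T : Fin N → Fin N → Set} (T? : ∀ x y → Dec (T x y))
      (T-act : ∀ {h x y} → Stab a h → T x y → T (h ·ᶜ x) (h ·ᶜ y))
      (single : ∀ {x y x′ y′} → T x y → T x′ y′ → ∃ λ h → Stab a h × h ·ᶜ x ≡ x′ × h ·ᶜ y ≡ y′)
      (T-Ω : ∀ {x y} → T x y → Ω x) (T-irrefl : ∀ {x} → ¬ T x x) (T-sym : ∀ {x y} → T x y → T y x)
      (T-trans : ∀ {x y z} → T x y → T y z → x ≢ z → T x z)
      (neighbours : ∀ x → Ω x → count (T? x) ≡ 54) {x₀ : Fin N} (Ωx₀ : Ω x₀) where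

      module R = Relation T? (λ _ _ → T-Ω) T-act 54 neighbours single

      Class : Fin N → Fin N → Set
      Class x y = y ≡ x ⊎ T x y

      class? : ∀ x y → Dec (Class x y)
      class? x y = (y ≟ᶠ x) ⊎-dec T? x y

      count-class : ∀ x → Ω x → count (class? x) ≡ 55
      count-class x Ωx = trans (count-⊎ (_≟ᶠ x) (T? x) (λ { y refl t → T-irrefl t }))
        (cong₂ _+_ (count-≡ x) (neighbours x Ωx))

      Ω-class : ∀ {x y} → Ω x → Class x y → Ω y
      Ω-class Ωx (inj₁ refl) = Ωx
      Ω-class Ωx (inj₂ t)    = T-Ω (T-sym t)

      A? : Decidable (Class x₀)
      A? = class? x₀

      B : Fin N → Set
      B y = Ω y × ¬ Class x₀ y

      B? : Decidable B
      B? y = Ω? y ×-dec ¬? (A? y)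

      class-sym : ∀ {x y} → Class x y → Class y x
      class-sym (inj₁ refl) = inj₁ refl
      class-sym (inj₂ t)    = inj₂ (T-sym t)

      class-trans : ∀ {x y z} → Class x y → Class y z → Class x z
      class-trans (inj₁ refl) c = c
      class-trans c (inj₁ refl) = c
      class-trans {x} {y} {z} (inj₂ t) (inj₂ t′) with z ≟ᶠ x
      ... | yes e = inj₁ e
      ... | no ne = inj₂ (T-trans t t′ (λ e → ne (sym e)))

      count-B : count B? ≡ 55
      count-B = +-cancelˡ-≡ 55 _ _ (trans (cong (_+ count B?) (sym (trans
        (count-cong (λ y → Ω? y ×-dec A? y) A? (λ _ → proj₂) (λ y c → Ω-class Ωx₀ c , c)) (count-class x₀ Ωx₀))))
        (trans (sym (count-split Ω? A?)) count-Ω))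

      -- The class of x has 55 elements and avoids that of x₀, so it fills B.
      B-class : ∀ x y → B x → B y → Class x y
      B-class x y (Ωx , ¬x) By = count-full (class? x) B?
        (λ z c → Ω-class Ωx c , λ c₀ → ¬x (class-trans c₀ (class-sym c)))
        (≤-reflexive (trans count-B (sym (count-class x Ωx)))) y By

      -- Within a half T is just inequality, so for each class met there are t - 1 choices of a
      -- second one.
      half-weight : {P : Fin N → Set} (P? : Decidable P) (j : Fin nb) →
        (∀ x y → P x → P y → Class x y) → (∀ x y → P x → T x y → P y) →
        let t = count (λ x → P? x ×-dec meets? x j) in
        count (λ z → pairs? (R.triple? j) z ×-dec P? (fst z)) ≡ t * (t ∸ 1)
      half-weight {P} P? j same closed = count-pairs (λ x → P? x ×-dec meets? x j) (λ x y → R.triple? j x y ×-dec P? x) _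
        (λ x y ((_ , mx , _) , px) → px , mx)
        (λ x (px , mx) → trans (count-cong _ (λ y → (P? y ×-dec meets? y j) ×-dec ¬? (y ≟ᶠ x))
            (λ { y ((t , _ , my) , _) → (closed x y px t , my) , λ { refl → T-irrefl t } })
            (λ y ((py , my) , ne) → (other (same x y px py) ne , mx , my) , px))
          (cong (_∸ 1) (sym (count-remove (λ y → P? y ×-dec meets? y j) (px , mx)))))
        where
        other : ∀ {x y} → Class x y → y ≢ x → T x y
        other (inj₁ e) ne = contradiction e ne
        other (inj₂ t) _  = t

      impossible : ∀ {y₀} → T x₀ y₀ → ∀ {j} → Meets a j → ⊥
      impossible t₀ {j} aj = halves-indivisible t t<75
          (108∣halves (R.weight j) (proj₁ (R.weight-eq t₀)) weight≡ (proj₂ (R.weight-eq t₀) aj))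
        where
        108∣halves : ∀ w φ {h} → w ≡ h → w * 185 ≡ 54 * φ * 2 → 108 ∣ h * 185
        108∣halves w φ refl e = divides φ (trans e (trans (cong (_* 2) (*-comm 54 φ)) (*-assoc φ 54 2)))
        t u : ℕ
        t = count (λ x → A? x ×-dec meets? x j)
        u = count (λ x → B? x ×-dec meets? x j)
        t+u : t + u ≡ 74
        t+u = trans (cong₂ _+_
            (count-cong _ (λ x → (Ω? x ×-dec meets? x j) ×-dec A? x) (λ x (c , mx) → (Ω-class Ωx₀ c , mx) , c) (λ x ((_ , mx) , c) → c , mx))
            (count-cong _ (λ x → (Ω? x ×-dec meets? x j) ×-dec ¬? (A? x)) (λ x ((o , c) , mx) → (o , mx) , c) (λ x ((o , mx) , c) → (o , c) , mx)))
          (trans (sym (count-split (λ x → Ω? x ×-dec meets? x j) A?)) (trace-of j aj))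
        weight≡ : R.weight j ≡ t * (t ∸ 1) + (74 ∸ t) * (74 ∸ t ∸ 1)
        weight≡ = trans (R.weight≡count j) (trans (count-split (pairs? (R.triple? j)) (λ z → A? (fst z))) (cong₂ _+_
          (half-weight A? j (λ x y c c′ → class-trans (class-sym c) c′) (λ x y c t → class-trans c (inj₂ t)))
          (trans (count-cong _ (λ z → pairs? (R.triple? j) z ×-dec B? (fst z))
              (λ z (tr , na) → tr , T-Ω (proj₁ tr) , na) (λ z (tr , _ , na) → tr , na))
            (trans (half-weight B? j B-class (λ x y (Ωx , na) t → T-Ω (T-sym t) , λ c → na (class-trans c (inj₂ (T-sym t)))))
              (cong (λ u → u * (u ∸ 1)) (trans (sym (m+n∸m≡n t u)) (cong (_∸ t) t+u)))))))
        t<75 : t < 75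
        t<75 = s≤s (≤-trans (m≤m+n t u) (≤-reflexive t+u))

    module Chain (g : Fin order) (ga : Stab a g) (per : ∀ c → iter (g ·ᶜ_) p c ≡ c)
      (x₀ : Fin N) (mv : g ·ᶜ x₀ ≢ x₀) where

      x₀≢a : Ω x₀
      x₀≢a refl = mv ga

      a∉ : ¬ InOrbit x₀ a
      a∉ = orbit-avoids x₀≢a

      orbit⊆Ω : ∀ c → InOrbit x₀ c → Ω c
      orbit⊆Ω c o refl = a∉ o

      t : ℕ
      t = trace a (inOrbit? x₀) inOrbit-act a∉

      t-eq : t * 55 ≡ count (inOrbit? x₀) * 37
      t-eq = reduce t (count (inOrbit? x₀)) (trace-eq a (inOrbit? x₀) inOrbit-act a∉)
        where
        reduce : ∀ t o → c₁ * t ≡ o * c₂ → t * 55 ≡ o * 37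
        reduce t o e = *-cancelʳ-≡ (t * 55) (o * 37) 185 (begin
          t * 55 * 185    ≡⟨ trans (*-assoc t 55 185) (*-comm t 10175) ⟩
          10175 * t       ≡⟨ cong (_* t) (sym c₁≡) ⟩
          c₁ * t          ≡⟨ e ⟩
          o * c₂          ≡⟨ trans (cong (o *_) c₂≡) (sym (*-assoc o 37 185)) ⟩
          o * 37 * 185 ∎)
          where open ≡-Reasoning

      -- From 55 t = 37 · |orbit|, the length is a positive multiple of 55 not exceeding 110.
      orbit-size : count (inOrbit? x₀) ≡ 55 ⊎ count (inOrbit? x₀) ≡ 110
      orbit-size = sizes (count (inOrbit? x₀)) t t-eq (count-pos (inOrbit? x₀) x₀ inOrbit-refl)
        (≤-trans (count-mono (inOrbit? x₀) Ω? orbit⊆Ω) (≤-reflexive count-Ω))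
        where
        multiple : ∀ q → 1 ≤ q * 55 → q * 55 ≤ 110 → q * 55 ≡ 55 ⊎ q * 55 ≡ 110
        multiple 1 _ _ = inj₁ refl
        multiple 2 _ _ = inj₂ refl
        multiple (suc (suc (suc q))) _ le = contradiction le (<⇒≱ (≤-trans (from-yes (111 ≤? 165)) (*-monoˡ-≤ 55 {3} {3 + q} (s≤s (s≤s (s≤s z≤n))))))
        sizes : ∀ o t → t * 55 ≡ o * 37 → 1 ≤ o → o ≤ 110 → o ≡ 55 ⊎ o ≡ 110
        sizes o t e = from (coprime-divisor {55} {37} {o} coprime-55-37 (divides t (trans (*-comm 37 o) (sym e))))
          where
          from : ∀ {o} → 55 ∣ o → 1 ≤ o → o ≤ 110 → o ≡ 55 ⊎ o ≡ 110
          from (divides q refl) = multiple q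

      -- Since 37 < 55 < 74, Jordan's argument applies directly, and all pairs (x₀, c) in the orbit
      -- lie in equally many blocks' traces along with a. Each block meeting a meets t = 37 classes
      -- of the orbit.
      module Short (o≡55 : count (inOrbit? x₀) ≡ 55) where

        y₀ : Fin N
        y₀ = g ·ᶜ x₀

        O′? : Decidable (λ c → InOrbit x₀ c × c ≢ x₀)
        O′? c = inOrbit? x₀ c ×-dec ¬? (c ≟ᶠ x₀)

        count-O′ : count O′? ≡ 54
        count-O′ = suc-injective (trans (sym (count-remove (inOrbit? x₀) inOrbit-refl)) o≡55)

        two-transitive : ∀ c → InOrbit x₀ c → c ≢ x₀ → ∃ λ h → Stab a h × h ·ᶜ x₀ ≡ x₀ × h ·ᶜ c ≡ y₀
        two-transitive c o ne = stabilizer-transitive classes pr (stab? a) (stab-subgroup a) (inOrbit? x₀) inOrbit-act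
          inOrbit-transitive (subst₂ _<_ (sym p≡) (sym o≡55) (from-yes (37 <? 55)))
          (subst₂ (λ o p → o < p + p) (sym o≡55) (sym p≡) (from-yes (55 <? 74)))
          g ga per x₀ inOrbit-refl mv inOrbit-refl o (inOrbit-act ga inOrbit-refl) ne mv

        Q? = λ j → meets? a j ×-dec meets? x₀ j

        φ : ℕ
        φ = count (λ j → Q? j ×-dec meets? y₀ j)

        φ-const : ∀ c → InOrbit x₀ c × c ≢ x₀ → count (λ j → Q? j ×-dec meets? c j) ≡ φ
        φ-const c (o , ne) = from (two-transitive c o ne)
          where
          from : (∃ λ h → Stab a h × h ·ᶜ x₀ ≡ x₀ × h ·ᶜ c ≡ y₀) → count (λ j → Q? j ×-dec meets? c j) ≡ φ
          from (h , ha , hx , hc) = subst (λ d → count (λ j → Q? j ×-dec meets? c j) ≡ count (λ j → Q? j ×-dec meets? d j)) hc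
            (count-meeting-const (stabilizer (stab-subgroup a) x₀) Q?
              (λ {k} (ka , kx) (wa , wx) → meets-inv {k} ka wa , meets-inv {k} kx wx) {h} (ha , hx))

        impossible : ⊥
        impossible = short-indivisible (count Q?) (count O′?) φ (trans (count-c₂ (λ e → x₀≢a (sym e))) c₂≡) count-O′
            (biregular Q? O′? (λ j c → meets? c j) 36 φ rows φ-const)
          where
          t≡37 : t ≡ 37
          t≡37 = *-cancelʳ-≡ t 37 55 (trans t-eq (cong (_* 37) o≡55))
          rows : ∀ j → Meets a j × Meets x₀ j → count (λ c → O′? c ×-dec meets? c j) ≡ 36
          rows j (wa , wx) = suc-injective (trans
            (cong suc (count-cong _ (λ c → (inOrbit? x₀ c ×-dec meets? c j) ×-dec ¬? (c ≟ᶠ x₀))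
               (λ c ((o , ne) , me) → (o , me) , ne) (λ c ((o , me) , ne) → (o , ne) , me)))
            (trans (sym (count-remove (λ c → inOrbit? x₀ c ×-dec meets? c j) (inOrbit-refl , wx)))
              (trans (trace-const a (inOrbit? x₀) inOrbit-act a∉ wa) t≡37)))

-- The 111-class case with an orbit of length 110.

count-inclusion-exclusion : ∀ {n} {P Q U : Fin n → Set} (P? : Decidable P) (Q? : Decidable Q) (U? : Decidable U) →
  (∀ i → P i → U i) → (∀ i → Q i → U i) → count P? + count Q? ≤ count U? + count (λ i → P? i ×-dec Q? i)
count-inclusion-exclusion P? Q? U? pu qu = begin
  count P? + count Q?                                                              ≡⟨ cong (_+ count Q?) (count-split P? Q?) ⟩
  count (λ i → P? i ×-dec Q? i) + count (λ i → P? i ×-dec ¬? (Q? i)) + count Q?    ≡⟨ trans (+-assoc (count (λ i → P? i ×-dec Q? i)) _ (count Q?)) (+-comm (count (λ i → P? i ×-dec Q? i)) _) ⟩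
  count (λ i → P? i ×-dec ¬? (Q? i)) + count Q? + count (λ i → P? i ×-dec Q? i)
    ≡⟨ cong (_+ count (λ i → P? i ×-dec Q? i)) (sym (count-⊎ (λ i → P? i ×-dec ¬? (Q? i)) Q? (λ i → proj₂))) ⟩
  count (λ i → (P? i ×-dec ¬? (Q? i)) ⊎-dec Q? i) + count (λ i → P? i ×-dec Q? i)
    ≤⟨ +-monoˡ-≤ _ (count-mono _ U? (λ i → [ (λ w → pu i (proj₁ w)) , qu i ]′)) ⟩
  count U? + count (λ i → P? i ×-dec Q? i) ∎
  where open ≤-Reasoning

module Linked {Γ : FinGroup} {n : ℕ} (A : Action Γ n) {H : Fin (FinGroup.order Γ) → Set}
  (H? : Decidable H) (sub : FinGroup.Subgroup Γ H) (g : Fin (FinGroup.order Γ)) where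

  open FinGroup Γ
  open Action A
  open Subgroup sub

  -- Every H-conjugate of g that moves x also moves y. Here g may have two cycles, so the relation
  -- need not reduce to equality.
  R : Fin n → Fin n → Set
  R x y = ∀ h → H h → act g (act h x) ≢ act h x → act g (act h y) ≢ act h y

  opaque
    R? : ∀ x y → Dec (R x y)
    R? x y = all? (λ h → H? h →-dec (¬? (act g (act h x) ≟ᶠ act h x) →-dec ¬? (act g (act h y) ≟ᶠ act h y)))

  R-act : ∀ {x y k} → H k → R x y → R (act k x) (act k y)
  R-act {k = k} Hk r l Hl mv e = r (l ∙ k) (∙-closed Hl Hk)
    (λ e′ → mv (trans (cong (act g) (sym (act-∙ l k _))) (trans e′ (act-∙ l k _))))
    (trans (cong (act g) (act-∙ l k _)) (trans e (sym (act-∙ l k _))))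

  R-moved : ∀ {x y} → R x y → act g x ≢ x → act g y ≢ y
  R-moved r mv e = r ε ε-closed (λ e′ → mv (trans (cong (act g) (sym (act-ε _))) (trans e′ (act-ε _))))
    (trans (cong (act g) (act-ε _)) (trans e (sym (act-ε _))))

  unlinked : ∀ {x y} → ¬ R x y → ∃ λ h → H h × act g (act h x) ≢ act h x × act g (act h y) ≡ act h y
  unlinked {x} {y} ¬r = from (any? (λ h → H? h ×-dec ¬? (act g (act h x) ≟ᶠ act h x) ×-dec (act g (act h y) ≟ᶠ act h y)))
    where
    from : Dec (∃ λ h → H h × act g (act h x) ≢ act h x × act g (act h y) ≡ act h y) →
           ∃ λ h → H h × act g (act h x) ≢ act h x × act g (act h y) ≡ act h y
    from (yes w) = w
    from (no ¬w) = ⊥-elim (¬r (λ h Hh mv e → ¬w (h , Hh , mv , e)))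

-- x is 37 or 74, and 222 = 2 · 110 + 2 is a multiple of both.
divides-two : ∀ {s x} → s ∣ 110 → s ∣ x → 37 ∣ x → 1 ≤ x → x ≤ 110 → s ∣ 2
divides-two {s} s110 sx (divides 1 refl) _ _ = ∣m+n∣m⇒∣n {s} {220} {2} (∣n⇒∣m*n 6 sx) (∣n⇒∣m*n 2 s110)
divides-two {s} s110 sx (divides 2 refl) _ _ = ∣m+n∣m⇒∣n {s} {220} {2} (∣n⇒∣m*n 3 sx) (∣n⇒∣m*n 2 s110)
divides-two s110 sx (divides (suc (suc (suc q))) refl) _ le =
  contradiction le (<⇒≱ (≤-trans (from-yes (111 ≤? 111)) (*-monoˡ-≤ 37 {3} {3 + q} (s≤s (s≤s (s≤s z≤n))))))

-- Linked classes of size 2. Of the 74² ordered pairs of classes met besides a, 74 + w are linked, w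
-- counting the classes met along with their partner. The other W = 5402 - w satisfy 185 W = 216 φ,
-- which fails for every w from 38 to 74.
partner-arithmetic : ∀ W L w q s φ → L ≡ 74 + w → L + W ≡ 5476 → 148 ≤ 110 + w → w ≤ 74 →
  s ≡ 2 → s + q ≡ 110 → W * 185 ≡ q * φ * 2 → ⊥
partner-arithmetic W _ w q _ φ refl e lo hi refl e′ eq = checked (+-cancelˡ-≤ 110 38 w lo)
    (n∣m⇒m%n≡0 ((5402 ∸ w) * 185) 216 (divides φ (trans (cong (_* 185) {5402 ∸ w} {W} (sym W≡))
      (trans eq (trans (cong (λ q → q * φ * 2) (+-cancelˡ-≡ 2 q 108 e′)) (trans (cong (_* 2) (*-comm 108 φ)) (*-assoc φ 108 2)))))))
  where
  W≡ : W ≡ 5402 ∸ w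
  W≡ = trans (sym (m+n∸m≡n w W)) (cong (_∸ w) (+-cancelˡ-≡ 74 (w + W) 5402 (trans (sym (+-assoc 74 w W)) e)))
  checked : 38 ≤ w → (5402 ∸ w) * 185 % 216 ≢ 0
  checked lo = subst (λ w → 38 ≤ w → (5402 ∸ w) * 185 % 216 ≢ 0) (toℕ-fromℕ< (s≤s hi))
    (toWitness {a? = all? (λ (i : Fin 75) → (38 ≤? toℕ i) →-dec ¬? ((5402 ∸ toℕ i) * 185 % 216 ≟ 0))} tt (fromℕ< (s≤s hi))) lo

-- The stabilizer of a is transitive on the other 110 classes.  The conjugates of g cut out
-- linked classes of size 1 or 2 (the size divides 110 and the 37 or 74 classes moved by g).
-- The orbits of the stabilizer of a and x₀ on the classes not linked to x₀ contain a 37-cycle,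
-- so there are one or two of them.
record LongOrbitElement (D : ImprimitiveDesign) (params : TripleParameters D) (a : Fin (ImprimitiveDesign.N D)) : Set where
  open ImprimitiveDesign D
  open TripleParameters params
  open TripleCase.Stabilizer D params a
  field
    g   : Fin order
    ga  : Stab a g
    per : ∀ c → iter (g ·ᶜ_) p c ≡ c
    x₀  : Fin N
    Ωx₀ : Ω x₀
    mv  : g ·ᶜ x₀ ≢ x₀
    transitive : ∀ {x y} → Ω x → Ω y → ∃ λ h → Stab a h × h ·ᶜ x ≡ y

module LongOrbit (D : ImprimitiveDesign) (params : TripleParameters D) (a : Fin (ImprimitiveDesign.N D))
  (element : LongOrbitElement D params a) where

  open ImprimitiveDesign D
  open TripleParameters params
  open TripleCase.Stabilizer D params a
  open LongOrbitElement element
  open TripleCase D params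
  open DesignTools D
  open Subgroup (stab-subgroup a)
  open Linked classes (stab? a) (stab-subgroup a) g

  E : Fin N → Fin N → Set
  E x y = Ω y × R x y

  E? : ∀ x y → Dec (E x y)
  E? x y = Ω? y ×-dec R? x y

  E-refl : ∀ {x} → Ω x → E x x
  E-refl Ωx = Ωx , λ _ _ m → m

  E-trans : ∀ {x y z} → E x y → E y z → E x z
  E-trans (_ , r) (Ωz , r′) = Ωz , λ h Hh m → r′ h Hh (r h Hh m)

  E-act : ∀ {h x y} → Stab a h → E x y → E (h ·ᶜ x) (h ·ᶜ y)
  E-act {h} ha (Ωy , r) = Ω-act {h} ha Ωy , R-act {k = h} ha r

  E-act⁻¹ : ∀ {h x y} → Stab a h → E (h ·ᶜ x) y → E x ((h ⁻¹) ·ᶜ y)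
  E-act⁻¹ {h} {x} {y} ha e = subst (λ z → E z ((h ⁻¹) ·ᶜ y)) (Action.act-⁻¹ˡ classes h x) (E-act {h ⁻¹} (⁻¹-closed {h} ha) e)

  opaque
    s₀ : ℕ
    s₀ = count (E? x₀)

    count-E : ∀ x → Ω x → count (E? x) ≡ s₀
    count-E x Ωx = from (transitive Ωx₀ Ωx)
      where
      from : (∃ λ h → Stab a h × h ·ᶜ x₀ ≡ x) → count (E? x) ≡ count (E? x₀)
      from (h , ha , refl) = sym (Action.count-act classes (E? x₀) (E? (h ·ᶜ x₀)) h
        (λ y e → E-act {h} ha e) (λ y e → E-act⁻¹ {h} ha e))

  -- Being linked is visibly only reflexive and transitive. But E y lies in E x, and both sets have
  -- s₀ elements, so they agree.
  E-sym : ∀ {x y} → Ω x → E x y → E y x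
  E-sym {x} {y} Ωx e = count-full (E? y) (E? x) (λ z e′ → E-trans e e′)
    (≤-reflexive (trans (count-E x Ωx) (sym (count-E y (proj₁ e))))) x (E-refl Ωx)

  E-equivalence : IsEquivalenceOn Ω E
  E-equivalence = record { rfl = λ _ → E-refl ; symm = λ _ _ → E-sym ; trns = λ _ _ _ _ → E-trans ; closed = λ _ _ _ → proj₁ }

  s₀∣110 : s₀ ∣ 110
  s₀∣110 = subst (s₀ ∣_) count-Ω (class-size-∣-count Ω? E? E-equivalence s₀ count-E)

  X? : Decidable (λ c → Ω c × g ·ᶜ c ≢ c)
  X? c = Ω? c ×-dec ¬? (g ·ᶜ c ≟ᶠ c)

  s₀-small : s₀ ≡ 1 ⊎ s₀ ≡ 2
  s₀-small = prime⇒irreducible prime[2] (divides-two s₀∣110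
    (class-size-∣-count X? E? (record
      { rfl = λ _ w → E-refl (proj₁ w) ; symm = λ _ _ w → E-sym (proj₁ w) ; trns = λ _ _ _ _ → E-trans
      ; closed = λ _ _ (_ , m) (Ωy , r) → Ωy , R-moved r m }) s₀ (λ c w → count-E c (proj₁ w)))
    (subst (_∣ count X?) p≡ (PrimeCycle.moved-∣ pr (g ·ᶜ_) Ω? (λ _ → Ω-act {g} ga) (λ c _ → per c)))
    (count-pos X? x₀ (Ωx₀ , mv))
    (≤-trans (count-mono X? Ω? (λ _ → proj₁)) (≤-reflexive count-Ω)))

  s₀≤2 : s₀ ≤ 2
  s₀≤2 = [ (λ e → ≤-trans (≤-reflexive e) (s≤s z≤n)) , ≤-reflexive ]′ s₀-small

  1≤s₀ : 1 ≤ s₀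
  1≤s₀ = [ (λ e → ≤-reflexive (sym e)) , (λ e → ≤-trans (s≤s z≤n) (≤-reflexive (sym e))) ]′ s₀-small

  separate : ∀ {b c} → ¬ E b c → Ω b → Ω c →
    ∃ λ g′ → (Stab a g′ × Stab b g′) × (∀ d → iter (g′ ·ᶜ_) p d ≡ d) × g′ ·ᶜ c ≢ c
  separate {b} {c} ¬e Ωb Ωc = from (unlinked (λ r → ¬e (E-sym Ωc (Ωb , r))))
    where
    from : (∃ λ h → Stab a h × g ·ᶜ (h ·ᶜ c) ≢ h ·ᶜ c × g ·ᶜ (h ·ᶜ b) ≡ h ·ᶜ b) →
           ∃ λ g′ → (Stab a g′ × Stab b g′) × (∀ d → iter (g′ ·ᶜ_) p d ≡ d) × g′ ·ᶜ c ≢ c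
    from (h , ha , m , f) = conj (h ⁻¹) g ,
      ((∙-closed {h ⁻¹ ∙ g} {(h ⁻¹) ⁻¹} (∙-closed {h ⁻¹} {g} (⁻¹-closed {h} ha) ga) (⁻¹-closed {h ⁻¹} (⁻¹-closed {h} ha))) ,
       conj-fixed classes (h ⁻¹) g b (subst (λ h → g ·ᶜ (h ·ᶜ b) ≡ h ·ᶜ b) (sym (⁻¹-⁻¹ h)) f)) ,
      conj-period classes (h ⁻¹) g p per ,
      conj-moved classes (h ⁻¹) g c (subst (λ h → g ·ᶜ (h ·ᶜ c) ≢ h ·ᶜ c) (sym (⁻¹-⁻¹ h)) m)

  Far : Fin N → Fin N → Set
  Far x y = Ω y × ¬ E x y

  far? : ∀ x y → Dec (Far x y)
  far? x y = Ω? y ×-dec ¬? (E? x y)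

  far-act : ∀ {h x y} → Stab a h → Far x y → Far (h ·ᶜ x) (h ·ᶜ y)
  far-act {h} {x} {y} ha (Ωy , ¬e) = Ω-act {h} ha Ωy ,
    λ e → ¬e (subst (E x) (Action.act-⁻¹ˡ classes h y) (E-act⁻¹ {h} ha e))

  far-sym : ∀ {x y} → Ω x → Far x y → Far y x
  far-sym Ωx (Ωy , ¬e) = Ωx , λ e → ¬e (E-sym Ωy e)

  count-far : ∀ x → Ω x → s₀ + count (far? x) ≡ 110
  count-far x Ωx = trans (cong (_+ count (far? x)) (sym (trans
      (count-cong (λ y → Ω? y ×-dec E? x y) (E? x) (λ _ → proj₂) (λ y e → proj₁ e , e)) (count-E x Ωx))))
    (trans (sym (count-split Ω? (E? x))) count-Ω)

  K : Fin order → Set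
  K h = Stab a h × Stab x₀ h

  K? : Decidable K
  K? h = stab? a h ×-dec stab? x₀ h

  K-subgroup : Subgroup K
  K-subgroup = stabilizer (stab-subgroup a) x₀

  module O = Orbits classes K? K-subgroup

  orbit-far : ∀ {c d} → Far x₀ c → O.InOrbit c d → Far x₀ d
  orbit-far far (h , (ha , hx) , refl) = subst (λ x → Far x _) hx (far-act {h} ha far)

  orbit-Ω-closed : ∀ {c h d} → K h → O.InOrbit c d → O.InOrbit c (h ·ᶜ d)
  orbit-Ω-closed {h = h} Kh = O.inOrbit-act {g = h} Kh

  K-element : ∀ {c} → Far x₀ c → ∃ λ g′ → K g′ × (∀ d → iter (g′ ·ᶜ_) p d ≡ d) × g′ ·ᶜ c ≢ c
  K-element (Ωc , ¬e) = separate ¬e Ωx₀ Ωc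

  orbit-large : ∀ {c} → Far x₀ c → 37 ≤ count (O.inOrbit? c)
  orbit-large {c} far = from (K-element far)
    where
    from : (∃ λ g′ → K g′ × (∀ d → iter (g′ ·ᶜ_) p d ≡ d) × g′ ·ᶜ c ≢ c) → 37 ≤ count (O.inOrbit? c)
    from (g′ , Kg′ , per′ , m) = ≤-trans (≤-reflexive (trans (sym p≡) (sym (A.count-moved-orbit c m))))
      (count-mono (A.orbit? c) (O.inOrbit? c) (λ d → A.orbit-O c d O.inOrbit-refl))
      where
      module A = MovedPoints.At classes pr K-subgroup (O.inOrbit? c) (λ {h} {d} → orbit-Ω-closed {c} {h} {d}) g′ Kg′ per′

  orbit-sizes : ∀ {c c′} → Far x₀ c → Far x₀ c′ → ¬ O.InOrbit c c′ → (∀ d → Far x₀ d → O.InOrbit c d ⊎ O.InOrbit c′ d) →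
    s₀ + (count (O.inOrbit? c) + count (O.inOrbit? c′)) ≡ 110
  orbit-sizes {c} {c′} fc fc′ apart cover = trans (cong (s₀ +_) (trans (sym (count-⊎ (O.inOrbit? c) (O.inOrbit? c′)
      (λ d r r′ → apart (O.inOrbit-trans r (O.inOrbit-sym r′)))))
    (count-cong _ (far? x₀) (λ d → [ orbit-far fc , orbit-far fc′ ]′) cover))) (count-far x₀ Ωx₀)

  private
    j₀ : Fin nb
    j₀ = proj₁ (point-block (proj₁ (class-point a)))

    aj₀ : Meets a j₀
    aj₀ = proj₁ (class-point a) , proj₂ (class-point a) , proj₂ (point-block (proj₁ (class-point a)))

  -- If K is transitive on the classes far from x₀, the far pairs form a single orbit of the
  -- stabilizer of a, so `Relation` applies to them.
  module OneOrbit (c : Fin N) (far-c : Far x₀ c) (all-far : ∀ d → Far x₀ d → O.InOrbit c d) where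

    T : Fin N → Fin N → Set
    T x y = Ω x × Far x y

    single : ∀ {x y x′ y′} → T x y → T x′ y′ → ∃ λ h → Stab a h × h ·ᶜ x ≡ x′ × h ·ᶜ y ≡ y′
    single {x} {y} {x′} {y′} (Ωx , f) (Ωx′ , f′) = from (transitive Ωx Ωx₀) (transitive Ωx′ Ωx₀)
      where
      from : (∃ λ h → Stab a h × h ·ᶜ x ≡ x₀) → (∃ λ h → Stab a h × h ·ᶜ x′ ≡ x₀) →
             ∃ λ h → Stab a h × h ·ᶜ x ≡ x′ × h ·ᶜ y ≡ y′
      from (h , ha , hx) (h′ , ha′ , hx′) = join (O.inOrbit-transitive
          (all-far (h ·ᶜ y) (subst (λ z → Far z (h ·ᶜ y)) hx (far-act {h} ha f)))
          (all-far (h′ ·ᶜ y′) (subst (λ z → Far z (h′ ·ᶜ y′)) hx′ (far-act {h′} ha′ f′))))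
        where
        join : O.InOrbit (h ·ᶜ y) (h′ ·ᶜ y′) → ∃ λ h → Stab a h × h ·ᶜ x ≡ x′ × h ·ᶜ y ≡ y′
        join (k , (ka , kx) , e) = h′ ⁻¹ ∙ (k ∙ h) ,
          ∙-closed {h′ ⁻¹} {k ∙ h} (⁻¹-closed {h′} ha′) (∙-closed {k} {h} ka ha) ,
          via x x′ (trans (cong (k ·ᶜ_) hx) (trans kx (sym hx′))) , via y y′ e
          where
          via : ∀ z z′ → k ·ᶜ (h ·ᶜ z) ≡ h′ ·ᶜ z′ → (h′ ⁻¹ ∙ (k ∙ h)) ·ᶜ z ≡ z′
          via z z′ e = trans (Action.act-∙ classes (h′ ⁻¹) (k ∙ h) z)
            (Action.act-to-⁻¹ classes h′ (trans (sym e) (sym (Action.act-∙ classes k h z))))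

    q : ℕ
    q = count (far? x₀)

    count-T : ∀ x → Ω x → count (λ y → Ω? x ×-dec far? x y) ≡ q
    count-T x Ωx = trans (count-cong _ (far? x) (λ _ → proj₂) (λ _ f → Ωx , f))
      (+-cancelˡ-≡ s₀ _ _ (trans (count-far x Ωx) (sym (count-far x₀ Ωx₀))))

    module R = Relation (λ x y → Ω? x ×-dec far? x y) (λ _ _ → proj₁)
      (λ {h} ha (Ωx , f) → Ω-act {h} ha Ωx , far-act {h} ha f) q count-T single

    S : Fin N → Set
    S x = Ω x × Meets x j₀

    S? : Decidable S
    S? x = Ω? x ×-dec meets? x j₀

    count-S : count S? ≡ 74
    count-S = trace-of j₀ aj₀

    linked? : ∀ x y → Dec (S x × S y × E x y)
    linked? x y = S? x ×-dec S? y ×-dec E? x y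

    -- A block meeting a meets 74 other classes; the 74² ordered pairs of these are either linked or
    -- far.
    weight-linked : count (pairs? linked?) + R.weight j₀ ≡ 5476
    weight-linked = trans (cong₂ _+_
        (count-cong (pairs? linked?) (λ z → pairs? square? z ×-dec E? (fst z) (snd z))
          (λ z (a , b , e) → (a , b) , e) (λ z ((a , b) , e) → a , b , e))
        (trans (R.weight≡count j₀) (count-cong (pairs? (R.triple? j₀)) (λ z → pairs? square? z ×-dec ¬? (E? (fst z) (snd z)))
          (λ z ((Ωx , Ωy , ne) , mx , my) → ((Ωx , mx) , (Ωy , my)) , ne)
          (λ z (((Ωx , mx) , (Ωy , my)) , ne) → (Ωx , Ωy , ne) , mx , my))))
      (trans (sym (count-split (pairs? square?) (λ z → E? (fst z) (snd z))))
        (trans (count-pairs S? square? 74 (λ _ _ → proj₁) (λ x sx → trans (count-cong _ S? (λ _ → proj₂) (λ _ sy → sx , sy)) count-S))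
          (cong (_* 74) {count S?} {74} count-S)))
      where
      square? : ∀ x y → Dec (S x × S y)
      square? x y = S? x ×-dec S? y

    weight-eq : ∃ λ φ → R.weight j₀ * 185 ≡ q * φ * 2
    weight-eq = from (R.weight-eq {x₀} {c} (Ωx₀ , far-c))
      where
      from : (∃ λ φ → ∀ {j} → Meets a j → R.weight j * 185 ≡ q * φ * 2) → ∃ λ φ → R.weight j₀ * 185 ≡ q * φ * 2
      from (φ , eq) = φ , eq aj₀

    -- Only the 74 diagonal pairs are linked, so 5402 · 185 = 999370 would be a multiple of q = 109.
    impossible₁ : s₀ ≡ 1 → ⊥
    impossible₁ s₀≡1 = from weight-eq
      where
      W≡74 : count (pairs? linked?) ≡ 74
      W≡74 = trans (count-pairs S? linked? 1 (λ _ _ → proj₁) (λ x sx → count-unique (linked? x) x (sx , sx , E-refl (proj₁ sx))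
        (λ y (_ , _ , e) → single-class x y (proj₁ sx) e))) (trans (*-identityʳ _) count-S)
        where
        single-class : ∀ x y → Ω x → E x y → y ≡ x
        single-class x y Ωx e = from (y ≟ᶠ x)
          where
          from : Dec (y ≡ x) → y ≡ x
          from (yes e) = e
          from (no ne) = contradiction (≤-trans (≤-reflexive (sym (trans (count-⊎ (_≟ᶠ y) (_≟ᶠ x) (λ { z refl e → ne e }))
              (cong₂ _+_ (count-≡ y) (count-≡ x)))))
            (≤-trans (count-mono (λ z → (z ≟ᶠ y) ⊎-dec (z ≟ᶠ x)) (E? x) (λ { z (inj₁ refl) → e ; z (inj₂ refl) → E-refl Ωx }))
              (≤-reflexive (trans (count-E x Ωx) s₀≡1)))) (λ { (s≤s ()) })
      arith : ∀ w W q s φ → W ≡ 74 → W + w ≡ 5476 → s ≡ 1 → s + q ≡ 110 → w * 185 ≡ q * φ * 2 → ⊥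
      arith w _ q _ φ refl e refl e′ eq = from-no (109 ∣? 999370) (divides (φ * 2) (trans (cong (_* 185) {5402} {w} (sym (+-cancelˡ-≡ 74 w 5402 e)))
        (trans eq (trans (cong (λ q → q * φ * 2) (+-cancelˡ-≡ 1 q 109 e′)) (trans (*-assoc 109 φ 2) (*-comm 109 (φ * 2)))))))
      from : (∃ λ φ → R.weight j₀ * 185 ≡ q * φ * 2) → ⊥
      from (φ , eq) = arith (R.weight j₀) (count (pairs? linked?)) q s₀ φ W≡74 weight-linked s₀≡1 (count-far x₀ Ωx₀) eq

    impossible₂ : s₀ ≡ 2 → ⊥
    impossible₂ s₀≡2 = from weight-eq
      where
      Partner : Fin N → Fin N → Set
      Partner x y = E x y × y ≢ x

      partner? : ∀ x y → Dec (Partner x y)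
      partner? x y = E? x y ×-dec ¬? (y ≟ᶠ x)

      count-partner : ∀ x → Ω x → count (partner? x) ≡ 1
      count-partner x Ωx = suc-injective (trans (sym (count-remove (E? x) (E-refl Ωx))) (trans (count-E x Ωx) s₀≡2))

      -- The partners of the classes in S. There are again 74 of them among 110 classes, so at least
      -- 38 lie in S.
      S′? : Decidable (λ x → Ω x × ∃ λ y → S y × Partner x y)
      S′? x = Ω? x ×-dec any? (λ y → S? y ×-dec partner? x y)

      unique-partner : ∀ {x y z} → Ω x → Partner x y → Partner x z → z ≡ y
      unique-partner {x} Ωx (ey , ny) (ez , nz) = sym (count-≤2 (E? x) (≤-reflexive (trans (count-E x Ωx) s₀≡2))
        (E-refl Ωx) ey ez (λ e → ny (sym e)) (λ e → nz (sym e)))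

      count-S′ : count S′? ≡ 74
      count-S′ = trans (sym (*-identityʳ _)) (trans (biregular S′? S? partner? 1 1
        (λ { x (Ωx , y , sy , py) → count-unique (λ z → S? z ×-dec partner? x z) y (sy , py) (λ z w → unique-partner Ωx py (proj₂ w)) })
        (λ y sy → trans (count-cong (λ x → S′? x ×-dec partner? x y) (partner? y)
            (λ x ((Ωx , _) , (e , n)) → E-sym Ωx e , λ e → n (sym e))
            (λ x (e , n) → (proj₁ e , y , sy , (E-sym (proj₁ sy) e , λ e → n (sym e))) , (E-sym (proj₁ sy) e , λ e → n (sym e))))
          (count-partner y (proj₁ sy))))
        (trans (*-identityʳ _) count-S))

      w : ℕ
      w = count (λ x → S? x ×-dec S′? x)

      w-large : 148 ≤ 110 + w
      w-large = subst₂ _≤_ (cong₂ _+_ count-S count-S′) (cong (_+ w) {count Ω?} {110} count-Ω)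
        (count-inclusion-exclusion S? S′? Ω? (λ _ → proj₁) (λ _ → proj₁))

      w-small : w ≤ 74
      w-small = ≤-trans (count-mono _ S? (λ _ → proj₁)) (≤-reflexive count-S)

      W≡ : count (pairs? linked?) ≡ 74 + w
      W≡ = trans (count-split (pairs? linked?) (λ z → snd z ≟ᶠ fst z)) (cong₂ _+_
        (trans (count-pairs S? (λ x y → linked? x y ×-dec (y ≟ᶠ x)) 1 (λ _ _ w → proj₁ (proj₁ w))
            (λ x sx → count-unique _ x ((sx , sx , E-refl (proj₁ sx)) , refl) (λ _ → proj₂)))
          (trans (*-identityʳ _) count-S))
        (trans (count-pairs (λ x → S? x ×-dec S′? x) (λ x y → linked? x y ×-dec ¬? (y ≟ᶠ x)) 1
            (λ x y ((sx , sy , e) , ne) → sx , proj₁ sx , y , sy , e , ne)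
            (λ { x (sx , _ , y , sy , e , ne) → count-unique _ y ((sx , sy , e) , ne)
                 (λ z ((_ , _ , e′) , ne′) → unique-partner (proj₁ sx) (e , ne) (e′ , ne′)) }))
          (*-identityʳ _)))

      from : (∃ λ φ → R.weight j₀ * 185 ≡ q * φ * 2) → ⊥
      from (φ , eq) = partner-arithmetic (R.weight j₀) (count (pairs? linked?)) w q s₀ φ W≡ weight-linked w-large w-small s₀≡2 (count-far x₀ Ωx₀) eq

    impossible : ⊥
    impossible = [ impossible₁ , impossible₂ ]′ s₀-small

  module Orbital (c : Fin N) (far-c : Far x₀ c) where

    -- The orbital of (x₀, c) under the stabilizer of a; its pairs with first entry x₀ form the
    -- K-orbit of c.
    τ : Fin N → Fin N → Set
    τ x y = ∃ λ h → Stab a h × h ·ᶜ x₀ ≡ x × h ·ᶜ c ≡ y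

    opaque
      τ? : ∀ x y → Dec (τ x y)
      τ? x y = any? (λ h → stab? a h ×-dec (h ·ᶜ x₀ ≟ᶠ x) ×-dec (h ·ᶜ c ≟ᶠ y))

    o : ℕ
    o = count (O.inOrbit? c)

    τ-act : ∀ {h x y} → Stab a h → τ x y → τ (h ·ᶜ x) (h ·ᶜ y)
    τ-act {h} ha (k , ka , refl , refl) = h ∙ k , ∙-closed {h} {k} ha ka ,
      Action.act-∙ classes h k x₀ , Action.act-∙ classes h k c

    τ-single : ∀ {x y x′ y′} → τ x y → τ x′ y′ → ∃ λ h → Stab a h × h ·ᶜ x ≡ x′ × h ·ᶜ y ≡ y′
    τ-single (k , ka , refl , refl) (k′ , ka′ , refl , refl) = k′ ∙ k ⁻¹ , ∙-closed {k′} {k ⁻¹} ka′ (⁻¹-closed {k} ka) ,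
      via x₀ , via c
      where
      via : ∀ z → (k′ ∙ k ⁻¹) ·ᶜ (k ·ᶜ z) ≡ k′ ·ᶜ z
      via z = trans (Action.act-∙ classes k′ (k ⁻¹) (k ·ᶜ z)) (cong (k′ ·ᶜ_) (Action.act-⁻¹ˡ classes k z))

    τ-Ω : ∀ {x y} → τ x y → Ω x
    τ-Ω (h , ha , refl , _) = Ω-act {h} ha Ωx₀

    τ-far : ∀ {x y} → τ x y → Far x y
    τ-far (h , ha , refl , refl) = far-act {h} ha far-c

    τ-orbit : ∀ {y} → τ x₀ y → O.InOrbit c y
    τ-orbit (h , ha , hx , hc) = h , (ha , hx) , hc

    orbit-τ : ∀ {y} → O.InOrbit c y → τ x₀ y
    orbit-τ (h , (ha , hx) , hc) = h , ha , hx , hc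

    τ-neighbour : ∀ x → Ω x → ∃ λ y → τ x y
    τ-neighbour x Ωx = from (transitive Ωx₀ Ωx)
      where
      from : (∃ λ h → Stab a h × h ·ᶜ x₀ ≡ x) → ∃ λ y → τ x y
      from (h , ha , hx) = h ·ᶜ c , h , ha , hx , refl

    count-τ : ∀ x → Ω x → count (τ? x) ≡ o
    count-τ x Ωx = from (transitive Ωx₀ Ωx)
      where
      from : (∃ λ h → Stab a h × h ·ᶜ x₀ ≡ x) → count (τ? x) ≡ o
      from (h , ha , refl) = sym (Action.count-act classes (O.inOrbit? c) (τ? (h ·ᶜ x₀)) h
        (λ y r → τ-act {h} ha (orbit-τ r))
        (λ y t → τ-orbit (subst (λ z → τ z ((h ⁻¹) ·ᶜ y)) (Action.act-⁻¹ˡ classes h x₀) (τ-act {h ⁻¹} (⁻¹-closed {h} ha) t))))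

    -- All pairs of an orbital are conjugate, so one reversible pair suffices.
    τ-symmetric : ∀ {x y} → τ x y → τ y x → ∀ {z w} → τ z w → τ w z
    τ-symmetric {x} {y} t t′ t″ = from (τ-single t t″)
      where
      from : ∀ {z w} → (∃ λ h → Stab a h × h ·ᶜ x ≡ z × h ·ᶜ y ≡ w) → τ w z
      from (h , ha , refl , refl) = τ-act {h} ha t′

  -- The larger orbit has between 54 and 72 elements, so Jordan's argument makes the stabilizer
  -- of a and x₀ two-transitive on it: it is a clique of one of the relations τ and σ, and this
  -- relation splits the 110 classes into two halves of 55.
  module TwoOrbits (c c′ : Fin N) (far-c : Far x₀ c) (far-c′ : Far x₀ c′) (apart : ¬ O.InOrbit c c′)
    (cover : ∀ d → Far x₀ d → O.InOrbit c d ⊎ O.InOrbit c′ d)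
    (large : 56 ≤ count (O.inOrbit? c) + s₀) where

    open Orbital c far-c
    open Orbital c′ far-c′ renaming
      ( τ to σ; τ? to σ?; o to o′; τ-act to σ-act; τ-single to σ-single; τ-Ω to σ-Ω; τ-far to σ-far
      ; τ-orbit to σ-orbit; orbit-τ to orbit-σ; count-τ to count-σ; τ-symmetric to σ-symmetric; τ-neighbour to σ-neighbour)

    sizes : s₀ + (o + o′) ≡ 110
    sizes = orbit-sizes far-c far-c′ apart cover

    54≤o : 54 ≤ o
    54≤o = +-cancelʳ-≤ 2 54 o (≤-trans large (+-monoʳ-≤ o s₀≤2))

    -- The other orbit takes at least 37 and the linked class of x₀ at least 1 of the 110 classes.
    o≤72 : o ≤ 72
    o≤72 = bound s₀ o o′ sizes 1≤s₀ (orbit-large far-c′)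
      where
      bound : ∀ s o o′ → s + (o + o′) ≡ 110 → 1 ≤ s → 37 ≤ o′ → o ≤ 72
      bound s o o′ e 1≤s 37≤o′ = +-cancelʳ-≤ 38 o 72 (begin
        o + 38          ≡⟨ trans (sym (+-assoc o 37 1)) (+-comm (o + 37) 1) ⟩
        1 + (o + 37)    ≤⟨ +-mono-≤ 1≤s (+-monoʳ-≤ o 37≤o′) ⟩
        s + (o + o′)    ≡⟨ e ⟩
        110 ∎)
        where open ≤-Reasoning

    second : ∃ λ e → O.InOrbit c e × e ≢ c
    second = count-witness (λ e → O.inOrbit? c e ×-dec ¬? (e ≟ᶠ c))
      (s≤s⁻¹ (≤-trans (≤-trans (from-yes (2 ≤? 54)) 54≤o) (≤-reflexive (count-remove (O.inOrbit? c) O.inOrbit-refl))))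

    e₀ : Fin N
    e₀ = proj₁ second

    e₀-orbit : O.InOrbit c e₀
    e₀-orbit = proj₁ (proj₂ second)

    e₀≢c : e₀ ≢ c
    e₀≢c = proj₂ (proj₂ second)

    K-two-transitive : ∀ {d e} → O.InOrbit c d → O.InOrbit c e → d ≢ e → ∃ λ h → K h × h ·ᶜ c ≡ d × h ·ᶜ e₀ ≡ e
    K-two-transitive {d} {e} rd re d≢e = move rd
      where
      move : O.InOrbit c d → ∃ λ h → K h × h ·ᶜ c ≡ d × h ·ᶜ e₀ ≡ e
      move (k , Kk , kc) = fix (K-element far-c)
        where
        fix : (∃ λ g′ → K g′ × (∀ d → iter (g′ ·ᶜ_) p d ≡ d) × g′ ·ᶜ c ≢ c) → ∃ λ h → K h × h ·ᶜ c ≡ d × h ·ᶜ e₀ ≡ e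
        fix (g′ , Kg′ , per′ , m) = join (stabilizer-transitive classes pr K? K-subgroup (O.inOrbit? c)
            (λ {h} {x} → orbit-Ω-closed {c} {h} {x}) O.inOrbit-transitive
            (≤-trans (s≤s (≤-reflexive p≡)) (≤-trans (from-yes (38 ≤? 54)) 54≤o))
            (≤-trans (s≤s o≤72) (≤-trans (from-yes (73 ≤? 74)) (≤-reflexive (sym (cong₂ _+_ p≡ p≡)))))
            g′ Kg′ per′ c O.inOrbit-refl m rd (orbit-Ω-closed {c} {k} {e₀} Kk e₀-orbit) re
            (λ e → e₀≢c (Action.act-injective classes k (trans e (sym kc)))) (λ e → d≢e (sym e)))
          where
          join : (∃ λ l → K l × l ·ᶜ d ≡ d × l ·ᶜ (k ·ᶜ e₀) ≡ e) → ∃ λ h → K h × h ·ᶜ c ≡ d × h ·ᶜ e₀ ≡ e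
          join (l , Kl , ld , le) = l ∙ k , Subgroup.∙-closed K-subgroup {l} {k} Kl Kk ,
            trans (Action.act-∙ classes l k c) (trans (cong (l ·ᶜ_) kc) ld) , trans (Action.act-∙ classes l k e₀) le

    -- Transport x to x₀, where the τ-neighbours form the orbit on which K is two-transitive.
    neighbour-pair : ∀ {x d e} → τ x d → τ x e → d ≢ e → ∃ λ h → Stab a h × h ·ᶜ c ≡ d × h ·ᶜ e₀ ≡ e
    neighbour-pair {x} {d} {e} td te d≢e = from (transitive Ωx₀ (τ-Ω td))
      where
      from : (∃ λ k → Stab a k × k ·ᶜ x₀ ≡ x) → ∃ λ h → Stab a h × h ·ᶜ c ≡ d × h ·ᶜ e₀ ≡ e
      from (k , ka , kx) = lift (K-two-transitive (pull td) (pull te) (λ e → d≢e (Action.act-injective classes (k ⁻¹) e)))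
        where
        pull : ∀ {y} → τ x y → O.InOrbit c ((k ⁻¹) ·ᶜ y)
        pull {y} t = τ-orbit (subst (λ z → τ z ((k ⁻¹) ·ᶜ y)) (Action.act-to-⁻¹ classes k kx) (τ-act {k ⁻¹} (⁻¹-closed {k} ka) t))
        lift : (∃ λ h → K h × h ·ᶜ c ≡ (k ⁻¹) ·ᶜ d × h ·ᶜ e₀ ≡ (k ⁻¹) ·ᶜ e) → ∃ λ h → Stab a h × h ·ᶜ c ≡ d × h ·ᶜ e₀ ≡ e
        lift (h , (ha , _) , hc , he) = k ∙ h , ∙-closed {k} {h} ka ha , up c d hc , up e₀ e he
          where
          up : ∀ y z → h ·ᶜ y ≡ (k ⁻¹) ·ᶜ z → (k ∙ h) ·ᶜ y ≡ z
          up y z q = trans (Action.act-∙ classes k h y) (trans (cong (k ·ᶜ_) q) (Action.act-⁻¹ʳ classes k z))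

    Invariant : (Fin N → Fin N → Set) → Set
    Invariant T = ∀ {h x y} → Stab a h → T x y → T (h ·ᶜ x) (h ·ᶜ y)

    -- All pairs of distinct τ-neighbours of a class are conjugate to (c, e₀). Applied to E, τ and
    -- σ, this makes every τ-neighbourhood look alike.
    spread : {T : Fin N → Fin N → Set} → Invariant T → T c e₀ → ∀ {x d e} → τ x d → τ x e → d ≢ e → T d e
    spread {T} inv t td te d≢e = from (neighbour-pair td te d≢e)
      where
      from : ∀ {d e} → (∃ λ h → Stab a h × h ·ᶜ c ≡ d × h ·ᶜ e₀ ≡ e) → T d e
      from (h , ha , refl , refl) = inv {h} ha t

    τx₀c : τ x₀ c
    τx₀c = orbit-τ O.inOrbit-refl

    τx₀e₀ : τ x₀ e₀
    τx₀e₀ = orbit-τ e₀-orbit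

    far-cases : ∀ {x y} → Ω x → Far x y → τ x y ⊎ σ x y
    far-cases {x} {y} Ωx f = from (transitive Ωx Ωx₀)
      where
      from : (∃ λ h → Stab a h × h ·ᶜ x ≡ x₀) → τ x y ⊎ σ x y
      from (h , ha , hx) = [ (λ r → inj₁ (down τ (λ {k} {x} {y} → τ-act {k} {x} {y}) (orbit-τ r))) , (λ r → inj₂ (down σ (λ {k} {x} {y} → σ-act {k} {x} {y}) (orbit-σ r))) ]′
          (cover (h ·ᶜ y) (subst (λ z → Far z (h ·ᶜ y)) hx (far-act {h} ha f)))
        where
        down : (T : Fin N → Fin N → Set) → Invariant T → T x₀ (h ·ᶜ y) → T x y
        down T inv t = subst₂ T (Action.act-to-⁻¹ classes h hx) (Action.act-⁻¹ˡ classes h y) (inv {h ⁻¹} (⁻¹-closed {h} ha) t)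

    exclusive : ∀ {x y} → τ x y → ¬ σ x y
    exclusive (h , ha , hx , hc) (h′ , ha′ , hx′ , hc′) = apart (O.inOrbit-sym (h ⁻¹ ∙ h′ ,
      (∙-closed {h ⁻¹} {h′} (⁻¹-closed {h} ha) ha′ , trans (Action.act-∙ classes (h ⁻¹) h′ x₀) (Action.act-to-⁻¹ classes h (trans hx (sym hx′)))) ,
      trans (Action.act-∙ classes (h ⁻¹) h′ c′) (Action.act-to-⁻¹ classes h (trans hc (sym hc′)))))

    far-irrefl : ∀ {x} → ¬ Far x x
    far-irrefl (Ωx , ne) = ne (E-refl Ωx)

    -- Otherwise the whole orbit, of at least 54 classes, would be linked to c, against s₀ ≤ 2.
    not-linked : ¬ E c e₀
    not-linked e = <⇒≱ (≤-trans (from-yes (3 ≤? 54)) 54≤o) (≤-trans (count-mono (O.inOrbit? c) (E? c) sub)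
        (≤-trans (≤-reflexive (count-E c (proj₁ far-c))) s₀≤2))
      where
      sub : ∀ d → O.InOrbit c d → E c d
      sub d r = from (d ≟ᶠ c)
        where
        from : Dec (d ≡ c) → E c d
        from (yes refl) = E-refl (proj₁ far-c)
        from (no ne) = spread (λ {h} {x} {y} → E-act {h} {x} {y}) e τx₀c (orbit-τ r) (λ e → ne (sym e))

    -- Neighbourhoods of τ are cliques, so τ together with equality is an equivalence with classes
    -- of size o + 1. This divides 110 and lies between 55 and 73, so it is 55.
    module Clique (t : τ c e₀) where

      τ-sym : ∀ {x y} → τ x y → τ y x
      τ-sym = τ-symmetric t (spread (λ {h} {x} {y} → τ-act {h} {x} {y}) t τx₀e₀ τx₀c e₀≢c)

      τ-trans : ∀ {x y z} → τ x y → τ y z → x ≢ z → τ x z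
      τ-trans t₁ t₂ ne = spread (λ {h} {x} {y} → τ-act {h} {x} {y}) t (τ-sym t₁) t₂ ne

      class? : ∀ x y → Dec (Ω y × (y ≡ x ⊎ τ x y))
      class? x y = Ω? y ×-dec ((y ≟ᶠ x) ⊎-dec τ? x y)

      o+1∣110 : 1 + o ∣ 110
      o+1∣110 = subst (1 + o ∣_) count-Ω (class-size-∣-count Ω? class? (record
        { rfl = λ x Ωx → Ωx , inj₁ refl
        ; symm = λ { x y Ωx (_ , inj₁ refl) → Ωx , inj₁ refl ; x y Ωx (_ , inj₂ t) → Ωx , inj₂ (τ-sym t) }
        ; trns = λ { x y z Ωx (_ , inj₁ refl) e → e ; x y z Ωx e (_ , inj₁ refl) → e
                   ; x y z Ωx (_ , inj₂ t) (Ωz , inj₂ t′) → Ωz , joined x z t t′ (z ≟ᶠ x) }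
        ; closed = λ _ _ _ → proj₁ }) (1 + o)
        (λ x Ωx → trans (count-cong (class? x) (λ y → (y ≟ᶠ x) ⊎-dec τ? x y) (λ _ → proj₂)
            (λ { y (inj₁ refl) → Ωx , inj₁ refl ; y (inj₂ t) → proj₁ (τ-far t) , inj₂ t }))
          (trans (count-⊎ (_≟ᶠ x) (τ? x) (λ { y refl t → far-irrefl (τ-far t) })) (cong₂ _+_ (count-≡ x) (count-τ x Ωx)))))
        where
        joined : ∀ x z {y} → τ x y → τ y z → Dec (z ≡ x) → z ≡ x ⊎ τ x z
        joined x z t t′ (yes e) = inj₁ e
        joined x z t t′ (no ne) = inj₂ (τ-trans t t′ (λ e → ne (sym e)))

      o≡54 : o ≡ 54
      o≡54 = solve o 54≤o o≤72 o+1∣110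
        where
        solve : ∀ o → 54 ≤ o → o ≤ 72 → 1 + o ∣ 110 → o ≡ 54
        solve o lo hi (divides 0 ())
        solve o lo hi (divides 1 e) = contradiction hi (<⇒≱ (subst (72 <_) (suc-injective (trans e (*-identityˡ (1 + o)))) (from-yes (72 <? 109))))
        solve o lo hi (divides 2 e) = suc-injective (sym (*-cancelˡ-≡ 55 (1 + o) 2 e))
        solve o lo hi (divides (suc (suc (suc q))) e) = contradiction (≤-trans (*-mono-≤ {3} {3 + q} (s≤s (s≤s (s≤s z≤n))) (s≤s lo)) (≤-reflexive (sym e)))
          (<⇒≱ (from-yes (110 <? 165)))

      impossible : ⊥
      impossible = TwoHalves.impossible τ? (λ {h} {x} {y} → τ-act {h} {x} {y}) τ-single τ-Ω (λ t → far-irrefl (τ-far t)) τ-sym τ-trans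
        (λ x Ωx → trans (count-τ x Ωx) o≡54) Ωx₀ τx₀c aj₀

    -- Distinct τ-neighbours are σ-related. The τ-neighbours of b and the other classes linked to b
    -- form a σ-clique Z b of o + s₀ - 1 elements, and this turns σ into the relation with two
    -- halves of 55.
    module Independent (t : σ c e₀) where

      σ-sym : ∀ {x y} → σ x y → σ y x
      σ-sym = σ-symmetric t (spread (λ {h} {x} {y} → σ-act {h} {x} {y}) t τx₀e₀ τx₀c e₀≢c)

      τ-sym : ∀ {x y} → τ x y → τ y x
      τ-sym {x} {y} t₁ = [ (λ t₂ → t₂) , (λ s → ⊥-elim (exclusive t₁ (σ-sym s))) ]′
        (far-cases (proj₁ (τ-far t₁)) (far-sym (τ-Ω t₁) (τ-far t₁)))

      pair-σ : ∀ {x d e} → τ x d → τ x e → d ≢ e → σ d e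
      pair-σ = spread (λ {h} {x} {y} → σ-act {h} {x} {y}) t

      Linked′ : Fin N → Fin N → Set
      Linked′ b w = E b w × w ≢ b

      -- w is far from y because b is. Were it a τ-neighbour of y, then b and w would be σ-related
      -- and hence far, but they are linked.
      linked-σ : ∀ {y b w} → τ y b → Linked′ b w → σ y w
      linked-σ {y} {b} {w} tb (e , ne) = [ (λ tw → ⊥-elim (proj₂ (σ-far (pair-σ tb tw (λ e → ne (sym e)))) e)) , (λ s → s) ]′
        (far-cases (τ-Ω tb) (proj₁ e , λ e′ → proj₂ (τ-far tb) (E-trans e′ (E-sym (proj₁ (τ-far tb)) e))))

      Z : Fin N → Fin N → Set
      Z b w = τ b w ⊎ Linked′ b w

      Z? : ∀ b w → Dec (Z b w)
      Z? b w = τ? b w ⊎-dec (E? b w ×-dec ¬? (w ≟ᶠ b))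

      Z-pairs : ∀ {b x z} → Ω b → Z b x → Z b z → x ≢ z → σ x z
      Z-pairs Ωb (inj₁ t₁) (inj₁ t₂) ne = pair-σ t₁ t₂ ne
      Z-pairs Ωb (inj₁ t₁) (inj₂ l)  ne = linked-σ (τ-sym t₁) l
      Z-pairs Ωb (inj₂ l)  (inj₁ t₂) ne = σ-sym (linked-σ (τ-sym t₂) l)
      Z-pairs {b} Ωb (inj₂ (e , n)) (inj₂ (e′ , n′)) ne = ⊥-elim (ne (count-≤2 (E? b)
        (≤-trans (≤-reflexive (count-E b Ωb)) s₀≤2) (E-refl Ωb) e e′ (λ q → n (sym q)) (λ q → n′ (sym q))))

      count-Z : ∀ b → Ω b → suc (count (Z? b)) ≡ o + s₀
      count-Z b Ωb = trans (cong suc (count-⊎ (τ? b) (λ w → E? b w ×-dec ¬? (w ≟ᶠ b)) (λ w t l → proj₂ (τ-far t) (proj₁ l))))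
        (trans (sym (+-suc (count (τ? b)) _)) (cong₂ _+_ (count-τ b Ωb)
          (trans (sym (count-remove (E? b) (E-refl Ωb))) (count-E b Ωb))))

      Z∖? : ∀ b y w → Dec (Z b w × w ≢ y)
      Z∖? b y w = Z? b w ×-dec ¬? (w ≟ᶠ y)

      count-Z∖ : ∀ {b y} → τ b y → suc (suc (count (Z∖? b y))) ≡ o + s₀
      count-Z∖ {b} {y} t = trans (cong suc (sym (count-remove (Z? b) {y} (inj₁ t)))) (count-Z b (τ-Ω t))

      Z∖⊆σ : ∀ {b y} → τ b y → ∀ w → Z b w × w ≢ y → σ y w
      Z∖⊆σ t w (z , ne) = Z-pairs (τ-Ω t) (inj₁ t) z (λ e → ne (sym e))

      -- Removing c from Z x₀ leaves o + s₀ - 2 ≥ 54 classes that are σ-related to c, while o′ = 110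
      -- - (o + s₀) ≤ 54.
      o′≡54 : o′ ≡ 54
      o′≡54 = solve o o′ s₀ (count (Z∖? x₀ c)) sizes large (count-Z∖ τx₀c)
        (≤-trans (count-mono (Z∖? x₀ c) (σ? c) (Z∖⊆σ τx₀c)) (≤-reflexive (count-σ c (proj₁ far-c))))
        where
        solve : ∀ o o′ s z → s + (o + o′) ≡ 110 → 56 ≤ o + s → suc (suc z) ≡ o + s → z ≤ o′ → o′ ≡ 54
        solve o o′ s z e big z≡ z≤o′ = ≤-antisym
          (+-cancelˡ-≤ 56 o′ 54 (≤-trans (+-monoˡ-≤ o′ big) (≤-reflexive total)))
          (≤-trans (s≤s⁻¹ (s≤s⁻¹ (≤-trans big (≤-reflexive (sym z≡))))) z≤o′)
          where
          total : o + s + o′ ≡ 110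
          total = trans (cong (_+ o′) (+-comm o s)) (trans (+-assoc s o o′) e)

      σ⊆Z : ∀ {b y} → τ b y → ∀ w → σ y w → Z b w × w ≢ y
      σ⊆Z {b} {y} t = count-full (Z∖? b y) (σ? y) (Z∖⊆σ t)
        (≤-trans (≤-reflexive (trans (count-σ y (proj₁ (τ-far t))) o′≡54))
          (s≤s⁻¹ (s≤s⁻¹ (≤-trans large (≤-reflexive (sym (count-Z∖ t)))))))

      -- For a τ-neighbour b of y, both x and z lie in the σ-clique Z b, since by size σ y is Z b
      -- without y.
      σ-trans : ∀ {x y z} → σ x y → σ y z → x ≢ z → σ x z
      σ-trans {x} {y} {z} s₁ s₂ ne = from (τ-neighbour y (σ-Ω s₂))
        where
        from : (∃ λ b → τ y b) → σ x z
        from (b , tb) = Z-pairs (proj₁ (τ-far tb)) (proj₁ (σ⊆Z (τ-sym tb) x (σ-sym s₁))) (proj₁ (σ⊆Z (τ-sym tb) z s₂)) ne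

      impossible : ⊥
      impossible = TwoHalves.impossible σ? (λ {h} {x} {y} → σ-act {h} {x} {y}) σ-single σ-Ω (λ t → far-irrefl (σ-far t)) σ-sym σ-trans
        (λ x Ωx → trans (count-σ x Ωx) o′≡54) Ωx₀ (orbit-σ O.inOrbit-refl) aj₀

    impossible : ⊥
    impossible = [ Clique.impossible , Independent.impossible ]′
      (far-cases (proj₁ far-c) (proj₁ (orbit-far far-c e₀-orbit) , not-linked))

  impossible : ⊥
  impossible = first (count-witness (far? x₀) far-exists)
    where
    far-exists : 1 ≤ count (far? x₀)
    far-exists = +-cancelˡ-≤ 2 1 _ (≤-trans (from-yes (3 ≤? 110)) (≤-trans (≤-reflexive (sym (count-far x₀ Ωx₀)))
      (+-monoˡ-≤ (count (far? x₀)) s₀≤2)))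
    first : (∃ λ c → Far x₀ c) → ⊥
    first (c , fc) = second (any? (λ d → far? x₀ d ×-dec ¬? (O.inOrbit? c d)))
      where
      second : Dec (∃ λ d → Far x₀ d × ¬ O.InOrbit c d) → ⊥
      second (no none) = OneOrbit.impossible c fc (λ d f → decidable-stable (O.inOrbit? c d) (λ n → none (d , f , n)))
      second (yes (c′ , fc′ , apart)) = pick (56 ≤? count (O.inOrbit? c) + s₀)
        where
        cover : ∀ d → Far x₀ d → O.InOrbit c d ⊎ O.InOrbit c′ d
        cover d f = from (O.inOrbit? c d) (O.inOrbit? c′ d)
          where
          from : Dec (O.InOrbit c d) → Dec (O.InOrbit c′ d) → O.InOrbit c d ⊎ O.InOrbit c′ d
          from (yes r) _ = inj₁ r
          from _ (yes r) = inj₂ r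
          from (no n) (no n′) = contradiction (≤-trans three-orbits (≤-trans
              (count-mono (λ e → O.inOrbit? c e ⊎-dec (O.inOrbit? c′ e ⊎-dec O.inOrbit? d e)) Ω?
                (λ e → [ (λ r → proj₁ (orbit-far fc r)) , [ (λ r → proj₁ (orbit-far fc′ r)) , (λ r → proj₁ (orbit-far f r)) ]′ ]′))
              (≤-reflexive count-Ω))) (<⇒≱ (from-yes (110 <? 111)))
            where
            three-orbits : 111 ≤ count (λ e → O.inOrbit? c e ⊎-dec (O.inOrbit? c′ e ⊎-dec O.inOrbit? d e))
            three-orbits = ≤-trans (+-mono-≤ (orbit-large fc) (+-mono-≤ (orbit-large fc′) (orbit-large f)))
              (≤-reflexive (sym (trans (count-⊎ (O.inOrbit? c) (λ e → O.inOrbit? c′ e ⊎-dec O.inOrbit? d e)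
                  (λ e r → [ (λ r′ → apart (O.inOrbit-trans r (O.inOrbit-sym r′))) , (λ r′ → n (O.inOrbit-trans r (O.inOrbit-sym r′))) ]′))
                (cong (count (O.inOrbit? c) +_) (count-⊎ (O.inOrbit? c′) (O.inOrbit? d)
                  (λ e r r′ → n′ (O.inOrbit-trans r (O.inOrbit-sym r′))))))))
        -- (o + s₀) + (o′ + s₀) = 110 + s₀ ≥ 111, so one of the two sums is at least 56; the orbits
        -- are ordered accordingly.
        pick : Dec (56 ≤ count (O.inOrbit? c) + s₀) → ⊥
        pick (yes big) = TwoOrbits.impossible c c′ fc fc′ apart cover big
        pick (no small) = TwoOrbits.impossible c′ c fc′ fc (λ r → apart (O.inOrbit-sym r)) (λ d f → swap (cover d f)) (other s₀ _ _ (orbit-sizes fc fc′ apart cover) 1≤s₀ (s≤s⁻¹ (≰⇒> small)))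
          where
          swap : ∀ {A B : Set} → A ⊎ B → B ⊎ A
          swap (inj₁ x) = inj₂ x
          swap (inj₂ y) = inj₁ y
          other : ∀ s o o′ → s + (o + o′) ≡ 110 → 1 ≤ s → o + s ≤ 55 → 56 ≤ o′ + s
          other s o o′ e 1≤s le = +-cancelˡ-≤ 55 56 (o′ + s) (begin
            111                 ≤⟨ s≤s (≤-reflexive (sym e)) ⟩
            1 + (s + (o + o′))  ≤⟨ +-monoˡ-≤ _ 1≤s ⟩
            s + (s + (o + o′))  ≡⟨ rearrange s o o′ ⟩
            o + s + (o′ + s)    ≤⟨ +-monoˡ-≤ (o′ + s) le ⟩
            55 + (o′ + s) ∎)
            where
            open ≤-Reasoning
            rearrange : ∀ s o o′ → s + (s + (o + o′)) ≡ o + s + (o′ + s)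
            rearrange = solve-∀

triple-impossible : (D : ImprimitiveDesign) → TripleParameters D → ⊥
triple-impossible D params = start (moved-class pr p∣s no-class-fixing a)
  where
  open ImprimitiveDesign D
  open TripleParameters params
  open TripleCase D params
  open DesignTools D
  a : Fin N
  a = subst Fin (sym N≡) zero
  open Stabilizer a
  start : (∃ λ g → Stab a g × g ^ᵍ p ≡ ε × ∃ λ c → g ·ᶜ c ≢ c) → ⊥
  start (g , ga , gp , x₀ , mv) = [ Short.impossible , long ]′ orbit-size
    where
    per : ∀ c → iter (g ·ᶜ_) p c ≡ c
    per = Action.act-period classes g p gp
    open Chain g ga per x₀ mv
    open Orbits classes (stab? a) (stab-subgroup a)
    long : count (inOrbit? x₀) ≡ 110 → ⊥
    long o≡110 = LongOrbit.impossible D params a (record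
      { g = g ; ga = ga ; per = per ; x₀ = x₀ ; Ωx₀ = x₀≢a ; mv = mv
      ; transitive = λ {x} {y} Ωx Ωy → inOrbit-transitive (reach x Ωx) (reach y Ωy) })
      where
      reach : ∀ c → Ω c → InOrbit x₀ c
      reach = count-full (inOrbit? x₀) Ω? orbit⊆Ω (≤-reflexive (trans count-Ω (sym o≡110)))

-- Arithmetic of the parameters

-- Modulo k, A is -a.
∣-complement : ∀ {k} A a M → k ≡ A + a → k ∣ A * M → k ∣ a * M
∣-complement {k} A a M e d = ∣m+n∣m⇒∣n (subst (k ∣_) (trans (cong (_* M) e) (*-distribʳ-+ M A a)) (m∣m*n M)) d

-- The variables are predecessors, e = ℓ - 1, c = s - 1, δ = d - 1 and K = k - 1, to avoid truncated
-- subtraction; suc δ * c + δ is v - 1.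
module Parameters (e c δ K b r lam : ℕ) (1≤e : 1 ≤ e) (1≤c : 1 ≤ c) (1≤δ : 1 ≤ δ) (1≤lam : 1 ≤ lam)
  (point-pairs : r * K ≡ (suc δ * c + δ) * lam) (class-pairs : c * lam ≡ r * e)
  (flags : b * suc K ≡ suc δ * suc c * r) (fisher : suc δ * suc c ≤ b) where

  private
    instance
      e≢0 = >-nonZero 1≤e
      lam≢0 = >-nonZero 1≤lam

    1≤r : 1 ≤ r
    1≤r = n≢0⇒n>0 (λ { refl → <⇒≢ (*-mono-≤ 1≤c 1≤lam) (sym class-pairs) })

    instance
      r≢0 = >-nonZero 1≤r

  classes-eq : K * c ≡ e * (suc δ * c + δ)
  classes-eq = *-cancelˡ-≡ _ _ r (begin
    r * (K * c)                     ≡⟨ sym (*-assoc r K c) ⟩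
    r * K * c                       ≡⟨ cong (_* c) point-pairs ⟩
    (suc δ * c + δ) * lam * c       ≡⟨ trans (*-assoc (suc δ * c + δ) lam c) (cong ((suc δ * c + δ) *_) (trans (*-comm lam c) class-pairs)) ⟩
    (suc δ * c + δ) * (r * e)       ≡⟨ swap (suc δ * c + δ) r e ⟩
    r * (e * (suc δ * c + δ)) ∎)
    where
    open ≡-Reasoning
    swap : ∀ V r e → V * (r * e) ≡ r * (e * V)
    swap = solve-∀

  K>ed : e * suc δ < K
  K>ed = *-cancelʳ-< c (e * suc δ) K (subst (e * suc δ * c <_) (sym (trans classes-eq (expand e (suc δ) c δ)))
    (m<m+n (e * suc δ * c) (*-mono-≤ 1≤e 1≤δ)))
    where
    expand : ∀ e d c δ → e * (d * c + δ) ≡ e * d * c + e * δ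
    expand = solve-∀

  x : ℕ
  x = K ∸ e * suc δ

  1≤x : 1 ≤ x
  1≤x = m<n⇒0<n∸m K>ed

  K≡ : e * suc δ + x ≡ K
  K≡ = m+[n∸m]≡n (<⇒≤ K>ed)

  xc≡eδ : x * c ≡ e * δ
  xc≡eδ = +-cancelˡ-≡ (e * suc δ * c) _ _ (trans (sym (*-distribʳ-+ c (e * suc δ) x))
    (trans (cong (_* c) K≡) (trans classes-eq (expand e (suc δ) c δ))))
    where
    expand : ∀ e d c δ → e * (d * c + δ) ≡ e * d * c + e * δ
    expand = solve-∀

  rx≡ : r * x ≡ lam * δ
  rx≡ = *-cancelˡ-≡ _ _ e (begin
    e * (r * x)      ≡⟨ swap e r x ⟩
    r * e * x        ≡⟨ cong (_* x) (sym class-pairs) ⟩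
    c * lam * x      ≡⟨ swap′ c lam x ⟩
    x * c * lam      ≡⟨ cong (_* lam) xc≡eδ ⟩
    e * δ * lam      ≡⟨ trans (*-assoc e δ lam) (cong (e *_) (*-comm δ lam)) ⟩
    e * (lam * δ) ∎)
    where
    open ≡-Reasoning
    swap : ∀ e r x → e * (r * x) ≡ r * e * x
    swap = solve-∀
    swap′ : ∀ c l x → c * l * x ≡ x * c * l
    swap′ = solve-∀

  k≤r : suc K ≤ r
  k≤r = *-cancelˡ-≤ (suc δ * suc c) (≤-trans (*-monoˡ-≤ (suc K) fisher) (≤-reflexive flags))

  xe<lam : x * e < lam
  xe<lam = *-cancelʳ-< (suc δ) (x * e) lam (begin-strict
    x * e * suc δ       ≡⟨ *-assoc x e (suc δ) ⟩
    x * (e * suc δ)     ≤⟨ *-monoʳ-≤ x (<⇒≤ (<-trans K>ed (n<1+n K))) ⟩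
    x * suc K           ≤⟨ *-monoʳ-≤ x k≤r ⟩
    x * r               ≡⟨ trans (*-comm x r) rx≡ ⟩
    lam * δ             <⟨ *-monoʳ-< lam (n<1+n δ) ⟩
    lam * suc δ ∎)
    where open ≤-Reasoning

  k≡₁ : suc K ≡ e * suc δ + (x + 1)
  k≡₁ = trans (cong suc (sym K≡)) (rearrange (e * suc δ) x)
    where
    rearrange : ∀ y x → suc (y + x) ≡ y + (x + 1)
    rearrange = solve-∀

  k≡₂ : suc K ≡ e * δ + (x + suc e)
  k≡₂ = trans k≡₁ (rearrange e δ x)
    where
    rearrange : ∀ e δ x → e * suc δ + (x + 1) ≡ e * δ + (x + suc e)
    rearrange = solve-∀

  k≡₃ : suc K ≡ x * suc c + suc e
  k≡₃ = trans k≡₂ (trans (cong (_+ (x + suc e)) (sym xc≡eδ)) (rearrange x c e))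
    where
    rearrange : ∀ x c e → x * c + (x + suc e) ≡ x * suc c + suc e
    rearrange = solve-∀

  bound : ℕ
  bound = (x + 1) * (suc e * ((x + suc e) * lam))

  -- Multiplying b k = v r by x² e² and using r x = λ δ gives b k x² e² = (e d)(x s)(e δ λ). The
  -- factors e d, x s and e δ are then replaced in turn by their complements modulo k.
  k∣bound : suc K ∣ bound
  k∣bound = subst (suc K ∣_) (swap₃ (x + suc e) (x + 1) (suc e) lam) (∣-complement (e * δ) (x + suc e) ((x + 1) * (suc e * lam)) k≡₂ (subst (suc K ∣_) (swap₂ (suc e) (x + 1) (e * δ) lam)
    (∣-complement (x * suc c) (suc e) ((x + 1) * (e * δ * lam)) k≡₃ (subst (suc K ∣_) (swap₁ (x + 1) (x * suc c) (e * δ) lam) (∣-complement (e * suc δ) (x + 1) (x * suc c * (e * δ * lam)) k≡₁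
      (divides (b * (x * (x * (e * e)))) total))))))
    where
    swap₁ : ∀ u y z l → u * (y * (z * l)) ≡ y * (u * (z * l))
    swap₁ = solve-∀
    swap₂ : ∀ w u z l → w * (u * (z * l)) ≡ z * (u * (w * l))
    swap₂ = solve-∀
    swap₃ : ∀ t u w l → t * (u * (w * l)) ≡ u * (w * (t * l))
    swap₃ = solve-∀
    shuffle₁ : ∀ e d x s l δ → e * d * (x * s * (e * δ * l)) ≡ d * s * (l * δ) * (x * (e * e))
    shuffle₁ = solve-∀
    shuffle₂ : ∀ v r x y → v * (r * x) * y ≡ v * r * (x * y)
    shuffle₂ = solve-∀
    open ≡-Reasoning
    total : e * suc δ * (x * suc c * (e * δ * lam)) ≡ b * (x * (x * (e * e))) * suc K
    total = begin
      e * suc δ * (x * suc c * (e * δ * lam))             ≡⟨ shuffle₁ e (suc δ) x (suc c) lam δ ⟩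
      suc δ * suc c * (lam * δ) * (x * (e * e))           ≡⟨ cong (λ t → suc δ * suc c * t * (x * (e * e))) (sym rx≡) ⟩
      suc δ * suc c * (r * x) * (x * (e * e))             ≡⟨ shuffle₂ (suc δ * suc c) r x (x * (e * e)) ⟩
      suc δ * suc c * r * (x * (x * (e * e)))             ≡⟨ cong (_* (x * (x * (e * e)))) (sym flags) ⟩
      b * suc K * (x * (x * (e * e)))                     ≡⟨ trans (*-assoc b (suc K) _) (trans (cong (b *_) (*-comm (suc K) _)) (sym (*-assoc b _ (suc K)))) ⟩
      b * (x * (x * (e * e))) * suc K ∎

  d+2≤k : suc δ + 2 ≤ suc K
  d+2≤k = subst (suc δ + 2 ≤_) (sym k≡₁) (+-mono-≤ (≤-trans (≤-reflexive (sym (*-identityˡ (suc δ)))) (*-monoˡ-≤ (suc δ) 1≤e)) (+-monoˡ-≤ 1 1≤x))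

  s+2≤k : suc c + 2 ≤ suc K
  s+2≤k = subst (suc c + 2 ≤_) (sym k≡₃) (+-mono-≤ (≤-trans (≤-reflexive (sym (*-identityˡ (suc c)))) (*-monoˡ-≤ (suc c) 1≤x)) (s≤s 1≤e))

  v≤[k-2]² : suc δ * suc c ≤ (suc K ∸ 2) ^ 2
  v≤[k-2]² = ≤-trans (*-mono-≤ (le d+2≤k) (le s+2≤k)) (≤-reflexive (cong ((suc K ∸ 2) *_) (sym (*-identityʳ (suc K ∸ 2)))))
    where
    le : ∀ {y} → y + 2 ≤ suc K → y ≤ suc K ∸ 2
    le {y} h = subst (_≤ suc K ∸ 2) (m+n∸n≡m y 2) (∸-monoˡ-≤ 2 h)

  -- The subscripts give d = s in the three exceptional cases.
  data Outcome : Set where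
    small : suc K ≤ 2 * lam ^ 2 * (lam ∸ 1) → Outcome
    case₁₀ : lam ≡ 2 → e ≡ 1 → c ≡ 9 → δ ≡ 9 → K ≡ 11 → r ≡ 18 → Outcome
    case₂₂ : lam ≡ 2 → e ≡ 1 → c ≡ 21 → δ ≡ 21 → K ≡ 23 → r ≡ 42 → Outcome
    case₁₁₁ : lam ≡ 5 → e ≡ 2 → c ≡ 110 → δ ≡ 110 → K ≡ 224 → r ≡ 275 → b ≡ 15059 → Outcome

  from-≤ : ∀ {y} → y ≤ 2 * (lam * (lam * (lam ∸ 1))) → suc K ≤ y → Outcome
  from-≤ h h′ = small (≤-trans h′ (≤-trans h (≤-reflexive (shape lam (lam ∸ 1)))))
    where
    shape : ∀ l m → 2 * (l * (l * m)) ≡ 2 * (l * (l * 1)) * m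
    shape = solve-∀

  k≤bound : suc K ≤ bound
  k≤bound = ∣⇒≤ {{>-nonZero (*-mono-≤ (m≤n+m 1 x) (*-mono-≤ (s≤s {n = e} z≤n) (*-mono-≤ (≤-trans (s≤s z≤n) (m≤n+m (suc e) x)) 1≤lam)))}} k∣bound

  -- (x - 1)(e - 1) ≥ 0.
  x+e≤ : x + e ≤ x * e + 1
  x+e≤ = lemma x e 1≤x 1≤e
    where
    lemma : ∀ x e → 1 ≤ x → 1 ≤ e → x + e ≤ x * e + 1
    lemma (suc x) (suc e) _ _ = ≤-trans (m≤m+n (suc x + suc e) (x * e)) (≤-reflexive (ring x e))
      where
      ring : ∀ x e → suc x + suc e + x * e ≡ suc x * suc e + 1
      ring = solve-∀

  factor₁ : (x + 1) * suc e ≤ 2 * (x * e + 1)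
  factor₁ = ≤-trans (≤-reflexive (ring₁ x e)) (≤-trans (+-monoʳ-≤ (x * e + 1) x+e≤) (≤-reflexive (ring₂ (x * e + 1))))
    where
    ring₁ : ∀ x e → (x + 1) * suc e ≡ x * e + 1 + (x + e)
    ring₁ = solve-∀
    ring₂ : ∀ n → n + n ≡ 2 * n
    ring₂ = solve-∀

  factor₂ : x + suc e ≤ x * e + 2
  factor₂ = ≤-trans (≤-reflexive (+-suc x e)) (≤-trans (s≤s x+e≤) (≤-reflexive (sym (+-suc (x * e) 1))))

  bound-assoc : bound ≡ (x + 1) * suc e * (x + suc e) * lam
  bound-assoc = ring (x + 1) (suc e) (x + suc e) lam
    where
    ring : ∀ a b c d → a * (b * (c * d)) ≡ a * b * c * d
    ring = solve-∀

  -- Here (x + 1) ℓ ≤ 2 (x e + 1) ≤ 2 (λ - 1) and x + ℓ ≤ x e + 2 ≤ λ.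
  slack : x * e + 2 ≤ lam → Outcome
  slack h = from-≤ (≤-trans (≤-reflexive bound-assoc) (≤-trans (*-monoˡ-≤ lam (*-mono-≤
      (≤-trans factor₁ (*-monoʳ-≤ 2 (subst (_≤ lam ∸ 1) (m+n∸n≡m (x * e + 1) 1) (∸-monoˡ-≤ 1 (≤-trans (≤-reflexive (+-assoc (x * e) 1 1)) h)))))
      (≤-trans factor₂ h))) (≤-reflexive (ring lam (lam ∸ 1))))) k≤bound
    where
    ring : ∀ l m → 2 * m * l * l ≡ 2 * (l * (l * m))
    ring = solve-∀

  -- When k is a proper divisor of `bound`, 2 k ≤ 2 λ² (λ + 1), and λ + 1 ≤ 2 (λ - 1) because λ ≥ 3.
  half-bound : lam ≡ x * e + 1 → 3 ≤ lam → suc K + suc K ≤ bound → Outcome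
  half-bound refl 3≤lam h = from-≤ (≤-refl) (*-cancelˡ-≤ 2 (≤-trans (≤-reflexive (ring₁ (suc K))) (≤-trans h (≤-trans (≤-reflexive bound-assoc)
      (≤-trans (*-monoˡ-≤ lam (*-mono-≤ factor₁ factor₂)) (≤-trans (≤-reflexive (ring₂ (x * e))) (≤-trans (*-monoʳ-≤ 2 (*-monoʳ-≤ lam (*-monoʳ-≤ lam step))) (≤-reflexive (cong (2 *_) (ring₃ lam (lam ∸ 1)))))))))))
    where
    ring₁ : ∀ n → 2 * n ≡ n + n
    ring₁ = solve-∀
    ring₂ : ∀ n → 2 * (n + 1) * (n + 2) * (n + 1) ≡ 2 * ((n + 1) * ((n + 1) * (n + 2)))
    ring₂ = solve-∀
    ring₃ : ∀ l m → l * (l * (2 * m)) ≡ 2 * (l * (l * m))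
    ring₃ = solve-∀
    step : x * e + 2 ≤ 2 * (lam ∸ 1)
    step = subst (λ n → x * e + 2 ≤ 2 * n) (sym (m+n∸n≡m (x * e) 1)) (≤-trans (+-monoʳ-≤ (x * e) (s≤s⁻¹ (≤-trans 3≤lam (≤-reflexive (+-comm (x * e) 1))))) (≤-reflexive (sym (ring₁ (x * e)))))

  full : lam ≡ x * e + 1 → 3 ≤ lam → suc K ≡ bound → Outcome
  full lam≡ 3≤lam k≡ = cases x e refl refl
    where
    restate : ∀ x′ e′ → x ≡ x′ → e ≡ e′ → suc K ≡ (x′ + 1) * (suc e′ * ((x′ + suc e′) * (x′ * e′ + 1)))
    restate _ _ refl refl = trans k≡ (cong (λ l → (x + 1) * (suc e * ((x + suc e) * l))) lam≡)
    not-72 : suc δ * suc c * r ≡ 246330 → suc K ≡ 72 → ⊥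
    not-72 v k = from-no (72 ∣? 246330) (divides b (trans (sym v) (trans (sym flags) (cong (b *_) k))))
    product : ∀ {d s t} → suc δ ≡ d → suc c ≡ s → r ≡ t → suc δ * suc c * r ≡ d * s * t
    product refl refl refl = refl
    3-not-2 : ∀ {A : Set} → lam ≡ 2 → A
    3-not-2 q = contradiction 3≤lam (<⇒≱ (≤-reflexive (cong suc q)))
    -- For e = 1, k - 2 = x s while k = x (2x² + 8x + 10) + 4, so x divides 2. x = 1 gives λ = 2; x
    -- = 2 gives (k, d, s, r) = (72, 69, 35, 102), where 72 does not divide v r = 246330.
    thin : ∀ {x′} → x ≡ x′ → e ≡ 1 → Outcome
    thin {x′} px pe = [ (λ q → 3-not-2 (trans lam≡ (cong₂ (λ x e → x * e + 1) (trans px q) pe))) , (λ q → ⊥-elim (two (trans px q))) ]′ (prime⇒irreducible prime[2] x′∣2)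
      where
      δ≡ : δ ≡ x′ * c
      δ≡ = trans (sym (*-identityˡ δ)) (trans (cong (_* δ) (sym pe)) (trans (sym xc≡eδ) (cong (_* c) px)))
      k≡xc : suc K ≡ x′ * suc c + 2
      k≡xc = trans k≡₃ (cong₂ (λ x e → x * suc c + suc e) px pe)
      x′∣2 : x′ ∣ 2
      x′∣2 = ∣m+n∣m⇒∣n {x′} {x′ * (2 * (x′ * x′) + 8 * x′ + 10)} (divides (suc c) (+-cancelʳ-≡ 2 _ _ (begin
          x′ * (2 * (x′ * x′) + 8 * x′ + 10) + 2 + 2              ≡⟨ ring x′ ⟩
          (x′ + 1) * (2 * ((x′ + 2) * (x′ * 1 + 1)))              ≡⟨ sym (restate x′ 1 px pe) ⟩
          suc K                                                   ≡⟨ k≡xc ⟩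
          x′ * suc c + 2                                          ≡⟨ cong (_+ 2) (*-comm x′ (suc c)) ⟩
          suc c * x′ + 2 ∎))) (m∣m*n _)
        where
        open ≡-Reasoning
        ring : ∀ x → x * (2 * (x * x) + 8 * x + 10) + 2 + 2 ≡ (x + 1) * (2 * ((x + 2) * (x * 1 + 1)))
        ring = solve-∀
      two : x ≡ 2 → ⊥
      two px₂ = not-72 (product (cong suc δ≡68) (cong suc c≡34) r≡102) k≡72
        where
        k≡72 : suc K ≡ 72
        k≡72 = restate 2 1 px₂ pe
        c≡34 : c ≡ 34
        c≡34 = suc-injective (*-cancelˡ-≡ (suc c) 35 2 (+-cancelʳ-≡ 2 (2 * suc c) 70
          (trans (sym (trans k≡₃ (cong₂ (λ x e → x * suc c + suc e) px₂ pe))) k≡72)))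
        δ≡68 : δ ≡ 68
        δ≡68 = trans δ≡ (cong₂ _*_ (trans (sym px) px₂) c≡34)
        r≡102 : r ≡ 102
        r≡102 = *-cancelʳ-≡ r 102 2 (trans (cong (r *_) (sym px₂)) (trans rx≡ (cong₂ _*_ (trans lam≡ (cong₂ (λ x e → x * e + 1) px₂ pe)) δ≡68)))
    -- For x = 1 the roles of d and s are exchanged: k - 2 = e d, so e divides 2.
    flat : ∀ {e′} → x ≡ 1 → e ≡ e′ → Outcome
    flat {e′} px pe = [ (λ q → 3-not-2 (trans lam≡ (cong₂ (λ x e → x * e + 1) px (trans pe q)))) , (λ q → ⊥-elim (two (trans pe q))) ]′ (prime⇒irreducible prime[2] e′∣2)
      where
      e′∣2 : e′ ∣ 2
      e′∣2 = ∣m+n∣m⇒∣n {e′} {e′ * (2 * (e′ * e′) + 8 * e′ + 10)} (divides (suc δ) (+-cancelʳ-≡ 2 _ _ (begin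
          e′ * (2 * (e′ * e′) + 8 * e′ + 10) + 2 + 2              ≡⟨ ring e′ ⟩
          (1 + 1) * (suc e′ * ((1 + suc e′) * (1 * e′ + 1)))      ≡⟨ sym (restate 1 e′ px pe) ⟩
          suc K                                                   ≡⟨ trans k≡₁ (cong₂ (λ x e → e * suc δ + (x + 1)) px pe) ⟩
          e′ * suc δ + 2                                          ≡⟨ cong (_+ 2) (*-comm e′ (suc δ)) ⟩
          suc δ * e′ + 2 ∎))) (m∣m*n _)
        where
        open ≡-Reasoning
        ring : ∀ x → x * (2 * (x * x) + 8 * x + 10) + 2 + 2 ≡ (1 + 1) * (suc x * ((1 + suc x) * (1 * x + 1)))
        ring = solve-∀
      two : e ≡ 2 → ⊥
      two pe₂ = not-72 (product (cong suc δ≡34) (cong suc c≡68) r≡102) k≡72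
        where
        k≡72 : suc K ≡ 72
        k≡72 = restate 1 2 px pe₂
        δ≡34 : δ ≡ 34
        δ≡34 = suc-injective (*-cancelˡ-≡ (suc δ) 35 2 (+-cancelʳ-≡ 2 (2 * suc δ) 70
          (trans (sym (trans k≡₁ (cong₂ (λ x e → e * suc δ + (x + 1)) px pe₂))) k≡72)))
        c≡68 : c ≡ 68
        c≡68 = trans (sym (*-identityˡ c)) (trans (cong (_* c) (sym px)) (trans xc≡eδ (cong₂ _*_ pe₂ δ≡34)))
        r≡102 : r ≡ 102
        r≡102 = trans (sym (*-identityʳ r)) (trans (cong (r *_) (sym px)) (trans rx≡ (cong₂ _*_ (trans lam≡ (cong₂ (λ x e → x * e + 1) px pe₂)) δ≡34)))
    square : x ≡ 2 → e ≡ 2 → Outcome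
    square px pe = case₁₁₁ lam≡5 pe c≡110 δ≡110 (suc-injective k≡225) r≡275 b≡15059
      where
      lam≡5 : lam ≡ 5
      lam≡5 = trans lam≡ (cong₂ (λ x e → x * e + 1) px pe)
      k≡225 : suc K ≡ 225
      k≡225 = restate 2 2 px pe
      δ≡110 : δ ≡ 110
      δ≡110 = suc-injective (*-cancelˡ-≡ (suc δ) 111 2 (+-cancelʳ-≡ 3 (2 * suc δ) 222
          (trans (sym (trans k≡₁ (cong₂ (λ x e → e * suc δ + (x + 1)) px pe))) k≡225)))
      c≡110 : c ≡ 110
      c≡110 = *-cancelˡ-≡ c 110 2 (trans (cong (_* c) (sym px)) (trans xc≡eδ (cong₂ _*_ pe δ≡110)))
      r≡275 : r ≡ 275
      r≡275 = *-cancelʳ-≡ r 275 2 (trans (cong (r *_) (sym px)) (trans rx≡ (cong₂ _*_ lam≡5 δ≡110)))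
      b≡15059 : b ≡ 15059
      b≡15059 = *-cancelʳ-≡ b 15059 225 (trans (cong (b *_) (sym k≡225)) (trans flags (product (cong suc δ≡110) (cong suc c≡110) r≡275)))
    -- For x = 2 + i and e = 2 + j the difference of the two sides is
    -- 12(i+j) + 13ij + 5(i+j)² + 7ij(i+j) + 2i²j² − 5.
    wide : ∀ i j → x ≡ 2 + i → e ≡ 2 + j → 1 ≤ i + j → Outcome
    wide i j px pe 1≤ = from-≤ (≤-trans (≤-reflexive bound-assoc) (≤-trans (*-monoˡ-≤ lam comparison)
        (≤-reflexive (ring (x * e) lam (lam ∸ 1) (trans lam≡ (+-comm (x * e) 1)) (trans (cong (_∸ 1) lam≡) (m+n∸n≡m (x * e) 1)))))) k≤bound
      where
      ring : ∀ n l m → l ≡ 1 + n → m ≡ n → 2 * (n + 1) * n * l ≡ 2 * (l * (l * m))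
      ring n _ _ refl refl = poly n
        where
        poly : ∀ n → 2 * (n + 1) * n * (1 + n) ≡ 2 * ((1 + n) * ((1 + n) * n))
        poly = solve-∀
      polynomial : ∀ i j → (2 + i + 1) * suc (2 + j) * (2 + i + suc (2 + j)) + (12 * (i + j) + (13 * (i * j) + 5 * ((i + j) * (i + j)) + 7 * (i * j * (i + j)) + 2 * (i * i * (j * j))))
                   ≡ 2 * ((2 + i) * (2 + j) + 1) * ((2 + i) * (2 + j)) + 5
      polynomial = solve-∀
      comparison : (x + 1) * suc e * (x + suc e) ≤ 2 * (x * e + 1) * (x * e)
      comparison = subst₂ (λ x e → (x + 1) * suc e * (x + suc e) ≤ 2 * (x * e + 1) * (x * e)) (sym px) (sym pe)
        (+-cancelʳ-≤ 5 _ _ (≤-trans (+-monoʳ-≤ ((2 + i + 1) * suc (2 + j) * (2 + i + suc (2 + j)))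
            (≤-trans (≤-trans (from-yes (5 ≤? 12)) (≤-reflexive refl)) (≤-trans (*-monoʳ-≤ 12 1≤) (m≤m+n (12 * (i + j)) _)))) (≤-reflexive (polynomial i j))))
    cases : ∀ x′ e′ → x ≡ x′ → e ≡ e′ → Outcome
    cases 0 _ px _ = contradiction 1≤x (<⇒≱ (≤-reflexive (cong suc px)))
    cases (suc x′) 0 _ pe = contradiction 1≤e (<⇒≱ (≤-reflexive (cong suc pe)))
    cases (suc x′) 1 px pe = thin px pe
    cases 1 (suc (suc j)) px pe = flat px pe
    cases 2 2 px pe = square px pe
    cases (suc (suc (suc i))) (suc (suc j)) px pe = wide (suc i) j px pe (s≤s z≤n)
    cases 2 (suc (suc (suc j))) px pe = wide 0 (suc j) px pe (s≤s z≤n)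

  -- `bound` is 24, whereas the claimed bound is 8, so of the divisors of 24 only 12 and 24 remain.
  pair-case : lam ≡ 2 → x ≡ 1 → e ≡ 1 → Outcome
  pair-case pl px pe = [ (λ h → small (≤-trans h (≤-reflexive (cong (λ l → 2 * l ^ 2 * (l ∸ 1)) (sym pl))))) ,
      [ (λ q → case₁₀ pl pe (c≡ 9 q) (δ≡ 9 q) (suc-injective q) (r≡ 9 q)) , (λ q → case₂₂ pl pe (c≡ 21 q) (δ≡ 21 q) (suc-injective q) (r≡ 21 q)) ]′ ]′
      (divisors-of-24 (suc K) (subst (suc K ∣_) bound≡24 k∣bound))
    where
    bound≡24 : bound ≡ 24
    bound≡24 = trans (cong (λ l → (x + 1) * (suc e * ((x + suc e) * l))) pl) (cong₂ (λ x e → (x + 1) * (suc e * ((x + suc e) * 2))) px pe)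
    divisors-of-24 : ∀ k → k ∣ 24 → k ≤ 8 ⊎ k ≡ 12 ⊎ k ≡ 24
    divisors-of-24 k d = subst (λ k → k ∣ 24 → k ≤ 8 ⊎ k ≡ 12 ⊎ k ≡ 24) (toℕ-fromℕ< k<25)
        (toWitness {a? = all? (λ (i : Fin 25) → (toℕ i ∣? 24) →-dec ((toℕ i ≤? 8) ⊎-dec ((toℕ i ≟ 12) ⊎-dec (toℕ i ≟ 24))))} tt (fromℕ< k<25)) d
      where
      k<25 : k < 25
      k<25 = s≤s (∣⇒≤ d)
    δ≡ : ∀ t → suc K ≡ 3 + t → δ ≡ t
    δ≡ t q = suc-injective (+-cancelʳ-≡ 2 (suc δ) (suc t) (trans (cong (_+ 2) (sym (*-identityˡ (suc δ))))
      (trans (sym (trans k≡₁ (cong₂ (λ x e → e * suc δ + (x + 1)) px pe))) (trans q (+-comm 2 (suc t))))))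
    c≡ : ∀ t → suc K ≡ 3 + t → c ≡ t
    c≡ t q = trans (sym (*-identityˡ c)) (trans (cong (_* c) (sym px)) (trans xc≡eδ (trans (cong₂ _*_ pe (δ≡ t q)) (*-identityˡ t))))
    r≡ : ∀ t → suc K ≡ 3 + t → r ≡ 2 * t
    r≡ t q = trans (sym (*-identityʳ r)) (trans (cong (r *_) (sym px)) (trans rx≡ (cong₂ _*_ pl (δ≡ t q))))

  tight : lam ≡ x * e + 1 → Outcome
  tight lam≡ = from (3 ≤? lam) k∣bound
    where
    1≤xe : 1 ≤ x * e
    1≤xe = *-mono-≤ 1≤x 1≤e
    ones : ∀ x e → 1 ≤ x → 1 ≤ e → x * e ≡ 1 → x ≡ 1 × e ≡ 1
    ones x e _ _ q = m*n≡1⇒m≡1 x e q , m*n≡1⇒n≡1 x e q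
    from : Dec (3 ≤ lam) → suc K ∣ bound → Outcome
    from (yes 3≤) (divides 0 q) = contradiction (≤-trans k≤bound (≤-reflexive q)) λ ()
    from (yes 3≤) (divides 1 q) = full lam≡ 3≤ (sym (trans q (*-identityˡ (suc K))))
    from (yes 3≤) (divides (suc (suc t)) q) = half-bound lam≡ 3≤ (subst (suc K + suc K ≤_) (sym (trans q (sym (+-assoc (suc K) (suc K) (t * suc K))))) (m≤m+n (suc K + suc K) (t * suc K)))
    from (no ¬3≤) _ = pair-case (trans lam≡ (cong (_+ 1) xe≡1)) (proj₁ both) (proj₂ both)
      where
      xe≡1 : x * e ≡ 1
      xe≡1 = ≤-antisym (+-cancelʳ-≤ 1 (x * e) 1 (≤-trans (≤-reflexive (sym lam≡)) (s≤s⁻¹ (≰⇒> ¬3≤)))) 1≤xe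
      both = ones x e 1≤x 1≤e xe≡1

  outcome : Outcome
  outcome = from (x * e + 2 ≤? lam)
    where
    from : Dec (x * e + 2 ≤ lam) → Outcome
    from (yes h) = slack h
    from (no ¬h) = tight (≤-antisym (s≤s⁻¹ (≤-trans (≰⇒> ¬h) (≤-reflexive (+-suc (x * e) 1)))) (≤-trans (≤-reflexive (+-comm (x * e) 1)) xe<lam))

-- Parameters of a flag-transitive imprimitive design

∣∣≡count : ∀ {n} (S : Subset n) → ∣ S ∣ ≡ count (λ x → lookup S x Bool.≟ true)
∣∣≡count S = trans (go S) (sym (count≡sum (λ x → lookup S x Bool.≟ true)))
  where
  go : ∀ {n} (S : Subset n) → ∣ S ∣ ≡ sum (λ x → ind (lookup S x Bool.≟ true))
  go []          = refl
  go (true  ∷ S) = cong suc (go S)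
  go (false ∷ S) = go S

∧-true : ∀ {a b} → a ∧ b ≡ true → a ≡ true × b ≡ true
∧-true {true} {true} _ = refl , refl

true-∧ : ∀ {a b} → a ≡ true → b ≡ true → a ∧ b ≡ true
true-∧ refl refl = refl

module Incidence {v : ℕ} (D : Structure v) where

  I : Fin v → Fin (b D) → Set
  I x j = lookup (block D j) x ≡ true

  I? : ∀ x j → Dec (I x j)
  I? x j = lookup (block D j) x Bool.≟ true

  image-I : ∀ σ {j l x} → image σ (block D j) ≡ block D l → I x j → I (σ ⟨$⟩ʳ x) l
  image-I σ {j} {l} {x} e i = trans (cong (λ S → lookup S (σ ⟨$⟩ʳ x)) (sym e))
    (trans (lookup∘tabulate _ (σ ⟨$⟩ʳ x)) (trans (cong (lookup (block D j)) (inverseˡ σ)) i))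

  I-image : ∀ σ {j l y} → image σ (block D j) ≡ block D l → I y l → I (σ ⟨$⟩ˡ y) j
  I-image σ {j} {l} {y} e i = trans (sym (lookup∘tabulate _ y)) (trans (cong (λ S → lookup S y) e) i)

module Flags {v k lam : ℕ} (D : Structure v) (G : Permutation′ v → Set) (des : Is2Design D k lam)
  (2<k : 2 < k) (k<v : k < v) (grp : IsAutGroup D G) (ft : FlagTransitive D G) (c : Fin v → ℕ)
  (c-inv : ∀ σ → G σ → ∀ x y → c x ≡ c y → c (σ ⟨$⟩ʳ x) ≡ c (σ ⟨$⟩ʳ y))
  {x₁ y₁ : Fin v} (x₁≢y₁ : x₁ ≢ y₁) (cx₁ : c x₁ ≡ c y₁) {x₂ y₂ : Fin v} (cx₂ : c x₂ ≢ c y₂) where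

  open Is2Design des
  open Incidence D public

  block-count : ∀ j → count (λ x → I? x j) ≡ k
  block-count j = trans (sym (∣∣≡count (block D j))) (block-size j)

  pair-count : ∀ {x y} → x ≢ y → count (λ j → I? x j ×-dec I? y j) ≡ lam
  pair-count {x} {y} ne = trans (count-cong _ (λ j → lookup (blocksThrough D x y) j Bool.≟ true)
      (λ j (a , b) → trans (lookup∘tabulate _ j) (true-∧ a b)) (λ j e → ∧-true (trans (sym (lookup∘tabulate _ j)) e)))
    (trans (sym (∣∣≡count (blocksThrough D x y))) (balanced x y ne))

  flag-element : ∀ {x j y l} → I x j → I y l → ∃ λ σ → G σ × σ ⟨$⟩ʳ x ≡ y × image σ (block D j) ≡ block D l
  flag-element {x} {j} {y} {l} i i′ = ft x j y l (lookup⇒[]= x (block D j) i) (lookup⇒[]= y (block D l) i′)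

  K : ℕ
  K = pred k

  k≡ : k ≡ suc K
  k≡ = sym (suc-pred k {{>-nonZero (≤-trans (s≤s z≤n) 2<k)}})

  j₁ : Fin (b D)
  j₁ = fromℕ< blocks-nonempty

  block-point : ∀ j → ∃ λ x → I x j
  block-point j = count-witness (λ x → I? x j) (subst (1 ≤_) (sym (block-count j)) (≤-trans (s≤s z≤n) 2<k))

  p₁ : Fin v
  p₁ = proj₁ (block-point j₁)

  i₁ : I p₁ j₁
  i₁ = proj₂ (block-point j₁)

  1≤lam : 1 ≤ lam
  1≤lam = from (count-witness (λ x → I? x j₁ ×-dec ¬? (x ≟ᶠ p₁)) (s≤s⁻¹ (≤-trans (≤-trans (s≤s (s≤s z≤n)) 2<k)
      (≤-reflexive (trans (sym (block-count j₁)) (count-remove (λ x → I? x j₁) i₁))))))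
    where
    from : (∃ λ x → I x j₁ × x ≢ p₁) → 1 ≤ lam
    from (x , i , ne) = subst (1 ≤_) (pair-count ne) (count-pos _ j₁ (i , i₁))

  degree-eq : ∀ x → count (I? x) * K ≡ (v ∸ 1) * lam
  degree-eq x = trans (biregular (I? x) (λ y → ¬? (y ≟ᶠ x)) (λ j y → I? y j) K lam
      (λ j i → suc-injective (trans (cong suc (count-cong _ (λ y → I? y j ×-dec ¬? (y ≟ᶠ x)) (λ _ (n , i) → i , n) (λ _ (i , n) → n , i)))
        (trans (sym (count-remove (λ y → I? y j) i)) (trans (block-count j) k≡))))
      (λ y ne → pair-count (λ e → ne (sym e))))
    (cong (_* lam) (cong (_∸ 1) (count-≢ x)))

  private
    instance
      K≢0 : NonZero K
      K≢0 = >-nonZero (s≤s⁻¹ (≤-trans (s≤s (s≤s z≤n)) (subst (2 <_) k≡ 2<k)))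
      lam≢0 : NonZero lam
      lam≢0 = >-nonZero 1≤lam

  r : ℕ
  r = count (I? p₁)

  point-count : ∀ x → count (I? x) ≡ r
  point-count x = *-cancelʳ-≡ _ _ K (trans (degree-eq x) (sym (degree-eq p₁)))

  lam<r : lam < r
  lam<r = *-cancelʳ-< K lam r (begin-strict
    lam * K        <⟨ *-monoʳ-< lam (s≤s⁻¹ (≤-trans (subst (_< v) k≡ k<v) (≤-reflexive (sym (m+[n∸m]≡n (≤-trans (s≤s z≤n) k<v)))))) ⟩
    lam * (v ∸ 1)  ≡⟨ trans (*-comm lam (v ∸ 1)) (sym (degree-eq p₁)) ⟩
    r * K ∎)
    where
    open ≤-Reasoning

  v≤b : v ≤ b D
  v≤b = fisher I? r lam lam<r point-count pair-count

  flags-eq : b D * k ≡ v * r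
  flags-eq = trans (cong (_* k) (sym (count-all (λ j → j ≟ᶠ j) (λ _ → refl)))) (trans
    (biregular (λ j → j ≟ᶠ j) (λ x → x ≟ᶠ x) (λ j x → I? x j) k r
      (λ j _ → trans (count-cong _ (λ x → I? x j) (λ _ → proj₂) (λ _ i → refl , i)) (block-count j))
      (λ x _ → trans (count-cong _ (I? x) (λ _ → proj₂) (λ _ i → refl , i)) (point-count x)))
    (cong (_* r) (count-all (λ x → x ≟ᶠ x) (λ _ → refl))))

  c-inv⁻¹ : ∀ σ → G σ → ∀ {x y} → c (σ ⟨$⟩ʳ x) ≡ c (σ ⟨$⟩ʳ y) → c x ≡ c y
  c-inv⁻¹ σ g {x} {y} e = subst₂ (λ x y → c x ≡ c y) (inverseˡ σ) (inverseˡ σ) (c-inv (flip σ) (IsAutGroup.closed-⁻¹ grp σ g) _ _ e)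

  trace? : ∀ x j → Decidable (λ y → c y ≡ c x × I y j)
  trace? x j y = (c y ≟ c x) ×-dec I? y j

  ℓ : ℕ
  ℓ = count (trace? p₁ j₁)

  meet-count : ∀ {x j} → I x j → count (trace? x j) ≡ ℓ
  meet-count {x} {j} i = from (flag-element i i₁)
    where
    from : (∃ λ σ → G σ × σ ⟨$⟩ʳ x ≡ p₁ × image σ (block D j) ≡ block D j₁) → count (trace? x j) ≡ ℓ
    from (σ , g , e , im) = count-bij (trace? x j) (trace? p₁ j₁) (σ ⟨$⟩ʳ_)
      (λ y (cy , iy) → trans (c-inv σ g y x cy) (cong c e) , image-I σ im iy)
      (λ y z _ _ q → trans (sym (inverseˡ σ)) (trans (cong (σ ⟨$⟩ˡ_) q) (inverseˡ σ)))
      (λ y (cy , iy) → σ ⟨$⟩ˡ y , (c-inv⁻¹ σ g (trans (cong c (inverseʳ σ)) (trans cy (cong c (sym e)))) , I-image σ im iy) , inverseʳ σ)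

  1≤ℓ : 1 ≤ ℓ
  1≤ℓ = count-pos (trace? p₁ j₁) p₁ (refl , i₁)

  class? : ∀ x → Decidable (λ y → c y ≡ c x)
  class? x y = c y ≟ c x

  class-eq : ∀ x → (count (class? x) ∸ 1) * lam ≡ r * (ℓ ∸ 1)
  class-eq x = trans (cong (_* lam) (cong (_∸ 1) (count-remove (class? x) {x} refl)))
    (trans (biregular (λ y → class? x y ×-dec ¬? (y ≟ᶠ x)) (I? x) I? lam (ℓ ∸ 1)
        (λ y (_ , ne) → pair-count (λ e → ne (sym e)))
        (λ j i → cong (_∸ 1) (trans (cong suc (count-cong _ (λ y → trace? x j y ×-dec ¬? (y ≟ᶠ x))
              (λ _ ((a , n) , i) → (a , i) , n) (λ _ ((a , i) , n) → (a , n) , i)))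
            (trans (sym (count-remove (trace? x j) (refl , i))) (meet-count i)))))
      (cong (_* (ℓ ∸ 1)) (point-count x)))

  s : ℕ
  s = count (class? p₁)

  ∸1-injective : ∀ {m n} → 1 ≤ m → 1 ≤ n → m ∸ 1 ≡ n ∸ 1 → m ≡ n
  ∸1-injective (s≤s _) (s≤s _) e = cong suc e

  -- Read off from (s - 1) λ = r (ℓ - 1), which fixes the size of each class without an appeal to
  -- transitivity on points.
  class-count : ∀ x → count (class? x) ≡ s
  class-count x = ∸1-injective (count-pos (class? x) x refl) (count-pos (class? p₁) p₁ refl)
    (*-cancelʳ-≡ _ _ lam (trans (class-eq x) (sym (class-eq p₁))))

  s∣v : s ∣ v
  s∣v = subst (s ∣_) (count-all (λ x → x ≟ᶠ x) (λ _ → refl)) (class-size-∣-count (λ x → x ≟ᶠ x) class?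
    (record { rfl = λ _ _ → refl ; symm = λ _ _ _ e → sym e ; trns = λ _ _ _ _ e e′ → trans e′ e ; closed = λ _ _ _ _ → refl })
    s (λ x _ → class-count x))

  two : ∀ {n} {P : Fin n → Set} (P? : Decidable P) {x y} → x ≢ y → P x → P y → 2 ≤ count P?
  two P? {x} {y} ne px py = subst (2 ≤_) (sym (count-remove P? px)) (s≤s (count-pos _ y (py , λ e → ne (sym e))))

  2≤s : 2 ≤ s
  2≤s = subst (2 ≤_) (class-count x₁) (two (class? x₁) x₁≢y₁ refl (sym cx₁))

  -- Two points of one class lie on a common block, as λ ≥ 1.
  2≤ℓ : 2 ≤ ℓ
  2≤ℓ = from (count-witness _ (subst (1 ≤_) (sym (pair-count x₁≢y₁)) 1≤lam))
    where
    from : (∃ λ j → I x₁ j × I y₁ j) → 2 ≤ ℓ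
    from (j , i , i′) = subst (2 ≤_) (meet-count i) (two (trace? x₁ j) x₁≢y₁ (refl , i) (sym cx₁ , i′))

  s<v : s < v
  s<v = subst₂ _<_ (class-count x₂) (count-all (λ x → x ≟ᶠ x) (λ _ → refl))
    (count-< (class? x₂) (λ x → x ≟ᶠ x) (λ _ _ → refl) y₂ refl (λ e → cx₂ (sym e)))

  d : ℕ
  d = quotient s∣v

  v≡ : v ≡ d * s
  v≡ = _∣_.equality s∣v

  2≤d : 2 ≤ d
  2≤d = from d v≡
    where
    from : ∀ d → v ≡ d * s → 2 ≤ d
    from 0 e = contradiction (≤-trans k<v (≤-reflexive e)) λ ()
    from 1 e = contradiction s<v (≤⇒≯ (≤-reflexive (trans e (*-identityˡ s))))
    from (suc (suc d)) _ = s≤s (s≤s z≤n)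

  suc-pred′ : ∀ {n} → 2 ≤ n → n ≡ suc (n ∸ 1)
  suc-pred′ (s≤s _) = refl

  v-1≡ : v ∸ 1 ≡ suc (d ∸ 1) * (s ∸ 1) + (d ∸ 1)
  v-1≡ = trans (cong (_∸ 1) (trans v≡ (cong₂ _*_ (suc-pred′ 2≤d) (suc-pred′ 2≤s)))) (expand (d ∸ 1) (s ∸ 1))
    where
    expand : ∀ δ c → suc δ * suc c ∸ 1 ≡ suc δ * c + δ
    expand δ c = cong (_∸ 1) (poly δ c)
      where
      poly : ∀ δ c → suc δ * suc c ≡ suc (suc δ * c + δ)
      poly = solve-∀

  v≡′ : v ≡ suc (d ∸ 1) * suc (s ∸ 1)
  v≡′ = trans v≡ (cong₂ _*_ (suc-pred′ 2≤d) (suc-pred′ 2≤s))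

  open Parameters (ℓ ∸ 1) (s ∸ 1) (d ∸ 1) K (b D) r lam
    (∸-monoˡ-≤ 1 2≤ℓ) (∸-monoˡ-≤ 1 2≤s) (∸-monoˡ-≤ 1 2≤d) 1≤lam
    (trans (degree-eq p₁) (cong (_* lam) v-1≡)) (class-eq p₁)
    (trans (cong (b D *_) (sym k≡)) (trans flags-eq (cong (_* r) v≡′)))
    (subst (_≤ b D) v≡′ v≤b) public

-- The finite group of an exceptional design

-- Finitely many instances of excluded middle hold simultaneously under double negation.
¬¬-decidable : ∀ {n} (P : Fin n → Set) → ¬ ¬ Decidable P
¬¬-decidable {zero}  P k = k λ ()
¬¬-decidable {suc n} P k = ¬¬-excluded-middle (λ p₀ → ¬¬-decidable (λ i → P (suc i)) (λ ps → k (λ { zero → p₀ ; (suc i) → ps i })))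

record Enumeration {n : ℕ} (P : Fin n → Set) : Set where
  field
    size : ℕ
    element : Fin size → Fin n
    sound : ∀ i → P (element i)
    injective : ∀ i j → element i ≡ element j → i ≡ j
    complete : ∀ x → P x → ∃ λ i → element i ≡ x

enumerate : ∀ {n} {P : Fin n → Set} → Decidable P → Enumeration P
enumerate {zero}  P? = record { size = 0 ; element = λ () ; sound = λ () ; injective = λ () ; complete = λ () }
enumerate {suc n} P? with P? zero | enumerate (λ i → P? (suc i))
... | yes p | E = record
  { size = suc size ; element = λ { zero → zero ; (suc i) → suc (element i) }
  ; sound = λ { zero → p ; (suc i) → sound i }
  ; injective = λ { zero zero _ → refl ; (suc i) (suc j) e → cong suc (injective i j (sucᶠ-injective e)) }
  ; complete = λ { zero _ → zero , refl ; (suc x) q → suc (proj₁ (complete x q)) , cong suc (proj₂ (complete x q)) } }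
  where open Enumeration E
... | no ¬p | E = record
  { size = size ; element = λ i → suc (element i) ; sound = sound
  ; injective = λ i j e → injective i j (sucᶠ-injective e)
  ; complete = λ { zero q → contradiction q ¬p ; (suc x) q → proj₁ (complete x q) , cong suc (proj₂ (complete x q)) } }
  where open Enumeration E

-- Renumbers the arbitrary labels by an initial segment, so that classes can be counted and acted
-- on.
record Labelling {n : ℕ} (c : Fin n → ℕ) : Set where
  field
    size : ℕ
    label : Fin n → Fin size
    section : Fin size → Fin n
    label-section : ∀ i → label (section i) ≡ i
    label-cong : ∀ {x y} → c x ≡ c y → label x ≡ label y
    label-injective : ∀ {x y} → label x ≡ label y → c x ≡ c y

labelling : ∀ {n} (c : Fin n → ℕ) → Labelling c
labelling {zero} c = record { size = 0 ; label = λ () ; section = λ () ; label-section = λ ()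
                            ; label-cong = λ { {()} } ; label-injective = λ { {()} } }
labelling {suc n} c = extend (labelling (λ i → c (suc i))) (any? (λ i → c (suc i) ≟ c zero))
  where
  extend : Labelling (λ i → c (suc i)) → Dec (∃ λ i → c (suc i) ≡ c zero) → Labelling c
  extend L (yes (i , e)) = record
    { size = size ; label = λ { zero → label i ; (suc x) → label x } ; section = λ l → suc (section l)
    ; label-section = label-section
    ; label-cong = λ { {zero} {zero} _ → refl ; {zero} {suc y} q → label-cong (trans e q)
                     ; {suc x} {zero} q → label-cong (trans q (sym e)) ; {suc x} {suc y} q → label-cong q }
    ; label-injective = λ { {zero} {zero} _ → refl ; {zero} {suc y} q → trans (sym e) (label-injective q)
                          ; {suc x} {zero} q → trans (label-injective q) e ; {suc x} {suc y} q → label-injective q } }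
    where open Labelling L
  extend L (no new) = record
    { size = suc size ; label = λ { zero → zero ; (suc x) → suc (label x) } ; section = λ { zero → zero ; (suc l) → suc (section l) }
    ; label-section = λ { zero → refl ; (suc l) → cong suc (label-section l) }
    ; label-cong = λ { {zero} {zero} _ → refl ; {zero} {suc y} q → contradiction (y , sym q) new
                     ; {suc x} {zero} q → contradiction (x , q) new ; {suc x} {suc y} q → cong suc (label-cong q) }
    ; label-injective = λ { {zero} {zero} _ → refl ; {suc x} {suc y} q → label-injective (sucᶠ-injective q) } }
    where open Labelling L

-- G need not be decidable, but towards a contradiction its finitely many elements (up to
-- pointwise equality) may be listed.
record FiniteFamily {v : ℕ} (G : Permutation′ v → Set) : Set where
  field
    size : ℕ
    perm : Fin size → Permutation′ v
    member : ∀ i → G (perm i)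
    distinct : ∀ i j → (∀ x → perm i ⟨$⟩ʳ x ≡ perm j ⟨$⟩ʳ x) → i ≡ j
    complete : ∀ σ → G σ → ∃ λ i → ∀ x → perm i ⟨$⟩ʳ x ≡ σ ⟨$⟩ʳ x

-- Permutations are coded by their tables of values in `Fin (v ^ v)`; once it is decided which codes
-- occur in G, they can be enumerated.
¬¬-finiteFamily : ∀ {v} (G : Permutation′ v → Set) → ¬ ¬ FiniteFamily G
¬¬-finiteFamily {v} G = ¬¬-map family (¬¬-decidable Realised)
  where
  open Vectors v
  code : Permutation′ v → Fin (v ^ v)
  code σ = encode (tabulate (σ ⟨$⟩ʳ_))
  Realised : Fin (v ^ v) → Set
  Realised m = ∃ λ σ → G σ × code σ ≡ m
  code-ext : ∀ {σ τ} → (∀ x → σ ⟨$⟩ʳ x ≡ τ ⟨$⟩ʳ x) → code σ ≡ code τ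
  code-ext e = cong encode (tabulate-cong e)
  code-injective : ∀ {σ τ} → code σ ≡ code τ → ∀ x → σ ⟨$⟩ʳ x ≡ τ ⟨$⟩ʳ x
  code-injective {σ} {τ} e x = trans (sym (lookup∘tabulate (σ ⟨$⟩ʳ_) x)) (trans (cong (λ w → lookup w x) vectors) (lookup∘tabulate (τ ⟨$⟩ʳ_) x))
    where
    vectors : tabulate (σ ⟨$⟩ʳ_) ≡ tabulate (τ ⟨$⟩ʳ_)
    vectors = trans (sym (decode-encode (tabulate (σ ⟨$⟩ʳ_)))) (trans (cong (decode {v}) e) (decode-encode (tabulate (τ ⟨$⟩ʳ_))))
  family : Decidable Realised → FiniteFamily G
  family R? = record
    { size = size ; perm = λ i → proj₁ (sound i) ; member = λ i → proj₁ (proj₂ (sound i))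
    ; distinct = λ i j e → injective i j (trans (sym (proj₂ (proj₂ (sound i)))) (trans (code-ext {proj₁ (sound i)} {proj₁ (sound j)} e) (proj₂ (proj₂ (sound j)))))
    ; complete = λ σ g → proj₁ (complete (code σ) (σ , g , refl)) ,
        code-injective {proj₁ (sound (proj₁ (complete (code σ) (σ , g , refl))))} {σ} (trans (proj₂ (proj₂ (sound (proj₁ (complete (code σ) (σ , g , refl)))))) (proj₂ (complete (code σ) (σ , g , refl)))) }
    where open Enumeration (enumerate R?)

module FromFamily {v : ℕ} (D : Structure v) (G : Permutation′ v → Set) (grp : IsAutGroup D G) (F : FiniteFamily G)
  (c : Fin v → ℕ) (c-inv : ∀ σ → G σ → ∀ x y → c x ≡ c y → c (σ ⟨$⟩ʳ x) ≡ c (σ ⟨$⟩ʳ y)) where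

  open FiniteFamily F
  open IsAutGroup grp
  open Incidence D

  infixr 8 _⋆_
  _⋆_ : Fin size → Fin v → Fin v
  i ⋆ x = perm i ⟨$⟩ʳ x

  index : ∀ σ → G σ → Fin size
  index σ g = proj₁ (complete σ g)

  index-act : ∀ σ (g : G σ) x → index σ g ⋆ x ≡ σ ⟨$⟩ʳ x
  index-act σ g = proj₂ (complete σ g)

  -- `∘ₚ` applies its left argument first, hence the reversed order.
  mul : Fin size → Fin size → Fin size
  mul i j = index (perm j ∘ₚ perm i) (closed-∘ (perm j) (perm i) (member j) (member i))

  mul-act : ∀ i j x → mul i j ⋆ x ≡ i ⋆ j ⋆ x
  mul-act i j = index-act (perm j ∘ₚ perm i) (closed-∘ (perm j) (perm i) (member j) (member i))

  unit : Fin size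
  unit = index id has-id

  unit-act : ∀ x → unit ⋆ x ≡ x
  unit-act = index-act id has-id

  inv : Fin size → Fin size
  inv i = index (flip (perm i)) (closed-⁻¹ (perm i) (member i))

  inv-act : ∀ i x → inv i ⋆ x ≡ perm i ⟨$⟩ˡ x
  inv-act i = index-act (flip (perm i)) (closed-⁻¹ (perm i) (member i))

  Γ : FinGroup
  Γ = record
    { order = size ; _∙_ = mul ; ε = unit ; _⁻¹ = inv
    ; assoc = λ i j k → distinct _ _ (λ x → trans (mul-act (mul i j) k x) (trans (mul-act i j (k ⋆ x))
        (sym (trans (mul-act i (mul j k) x) (cong (i ⋆_) (mul-act j k x))))))
    ; idˡ = λ i → distinct _ _ (λ x → trans (mul-act unit i x) (unit-act (i ⋆ x)))
    ; idʳ = λ i → distinct _ _ (λ x → trans (mul-act i unit x) (cong (i ⋆_) (unit-act x)))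
    ; invˡ = λ i → distinct _ _ (λ x → trans (mul-act (inv i) i x) (trans (inv-act i (i ⋆ x)) (trans (inverseˡ (perm i)) (sym (unit-act x)))))
    ; invʳ = λ i → distinct _ _ (λ x → trans (mul-act i (inv i) x) (trans (cong (i ⋆_) (inv-act i x)) (trans (inverseʳ (perm i)) (sym (unit-act x))))) }

  points : Action Γ v
  points = record { act = _⋆_ ; act-ε = unit-act ; act-∙ = mul-act }

  block-ext : ∀ {j l} → (∀ x → I x j → I x l) → (∀ x → I x l → I x j) → j ≡ l
  block-ext {j} {l} f g = block-injective D (trans (sym (tabulate∘lookup (block D j)))
    (trans (tabulate-cong (λ x → bool-ext (f x) (g x))) (tabulate∘lookup (block D l))))
    where
    bool-ext : ∀ {a b : Bool} → (a ≡ true → b ≡ true) → (b ≡ true → a ≡ true) → a ≡ b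
    bool-ext {false} {false} _ _ = refl
    bool-ext {false} {true}  _ g = g refl
    bool-ext {true}  {b}     f _ = sym (f refl)

  _⋆ᴮ_ : Fin size → Fin (b D) → Fin (b D)
  i ⋆ᴮ j = proj₁ (aut (perm i) (member i) j)

  I-⋆ : ∀ i {x j} → I x j → I (i ⋆ x) (i ⋆ᴮ j)
  I-⋆ i {x} {j} = image-I (perm i) (proj₂ (aut (perm i) (member i) j))

  I-⋆⁻¹ : ∀ i {y j} → I y (i ⋆ᴮ j) → I (perm i ⟨$⟩ˡ y) j
  I-⋆⁻¹ i {y} {j} = I-image (perm i) (proj₂ (aut (perm i) (member i) j))

  block-unique : ∀ i {j l} → (∀ x → I x j → I (i ⋆ x) l) → (∀ y → I y l → I (perm i ⟨$⟩ˡ y) j) → i ⋆ᴮ j ≡ l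
  block-unique i {j} {l} f g = block-ext
    (λ y h → subst (λ z → I z l) (inverseʳ (perm i)) (f _ (I-⋆⁻¹ i h)))
    (λ y h → subst (λ z → I z (i ⋆ᴮ j)) (inverseʳ (perm i)) (I-⋆ i (g y h)))

  blocks : Action Γ (b D)
  blocks = record
    { act = _⋆ᴮ_
    ; act-ε = λ j → block-unique unit (λ x h → subst (λ z → I z j) (sym (unit-act x)) h)
        (λ y h → subst (λ z → I z j) (trans (sym (inverseʳ (perm unit))) (unit-act _)) h)
    ; act-∙ = λ g h j → block-unique (mul g h)
        (λ x i → subst (λ z → I z (g ⋆ᴮ (h ⋆ᴮ j))) (sym (mul-act g h x)) (I-⋆ g (I-⋆ h i)))
        (λ y i → subst (λ z → I z j) (undo g h y) (I-⋆⁻¹ h (I-⋆⁻¹ g i))) }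
    where
    undo : ∀ g h y → perm h ⟨$⟩ˡ (perm g ⟨$⟩ˡ y) ≡ perm (mul g h) ⟨$⟩ˡ y
    undo g h y = trans (sym (inverseˡ (perm (mul g h)))) (cong (perm (mul g h) ⟨$⟩ˡ_)
      (trans (mul-act g h _) (trans (cong (g ⋆_) (inverseʳ (perm h))) (inverseʳ (perm g)))))

  open Labelling (labelling c) public renaming (size to N)

  -- A class is moved through a chosen representative; invariance of the partition makes the choice
  -- irrelevant.
  classes : Action Γ N
  classes = record
    { act = λ g l → label (g ⋆ section l)
    ; act-ε = λ l → trans (cong label (unit-act (section l))) (label-section l)
    ; act-∙ = λ g h l → trans (cong label (mul-act g h (section l)))
        (label-cong (c-inv (perm g) (member g) _ _ (label-injective (sym (label-section (label (h ⋆ section l))))))) }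

  label-act : ∀ g x → label (g ⋆ x) ≡ label (g ⋆ section (label x))
  label-act g x = label-cong (c-inv (perm g) (member g) _ _ (label-injective (sym (label-section (label x)))))

  faithful : ∀ g → (∀ x → g ⋆ x ≡ x) → g ≡ unit
  faithful g e = distinct g unit (λ x → trans (e x) (sym (unit-act x)))

  flag-⋆ : FlagTransitive D G → ∀ {x j y l} → x Data.Fin.Subset.∈ block D j → y Data.Fin.Subset.∈ block D l → ∃ λ g → g ⋆ x ≡ y × g ⋆ᴮ j ≡ l
  flag-⋆ ft {x} {j} {y} {l} i i′ = from (ft x j y l i i′)
    where
    from : (∃ λ σ → G σ × (σ ⟨$⟩ʳ x ≡ y) × (image σ (block D j) ≡ block D l)) → ∃ λ g → g ⋆ x ≡ y × g ⋆ᴮ j ≡ l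
    from (σ , s , e , im) = g , trans (index-act σ s x) e , block-unique g
        (λ z h → subst (λ w → I w l) (sym (index-act σ s z)) (image-I σ im h))
        (λ z h → subst (λ w → I w j) (back z) (I-image σ im h))
      where
      g = index σ s
      back : ∀ z → σ ⟨$⟩ˡ z ≡ perm g ⟨$⟩ˡ z
      back z = trans (sym (inverseˡ (perm g))) (cong (perm g ⟨$⟩ˡ_) (trans (index-act σ s _) (inverseʳ σ)))

∸1≡⇒≡suc : ∀ {n t} → 2 ≤ n → n ∸ 1 ≡ t → n ≡ suc t
∸1≡⇒≡suc (s≤s _) e = cong suc e

theorem1p1 : (v k lam : ℕ) (D : Structure v) (G : Permutation′ v → Set) →
    Is2Design D k lam → 2 < k → k < v →
    IsAutGroup D G → FlagTransitive D G → PointImprimitive G →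
    (k ≤ 2 * lam ^ 2 * (lam ∸ 1)) × (v ≤ (2 * lam ^ 2 * (lam ∸ 1) ∸ 2) ^ 2)
theorem1p1 v k lam D G des 2<k k<v grp ft (c , c-inv , (x₁ , y₁ , x₁≢y₁ , cx₁) , (x₂ , y₂ , cx₂)) = from outcome
  where
  open Flags D G des 2<k k<v grp ft c c-inv x₁≢y₁ cx₁ cx₂

  module Exceptional (F : FiniteFamily G) (m c₁ c₂ h₂ : ℕ) (m-eq : m * ℓ ≡ k) (c₁-eq : c₁ * ℓ ≡ s * r)
    (h₂-eq : h₂ * ℓ ≡ s * lam) (c₂-eq : c₂ * ℓ ≡ s * h₂) where

    private
      module B = FromFamily D G grp F c c-inv
      instance
        ℓ≢0 = >-nonZero 1≤ℓ
        s≢0 = >-nonZero (≤-trans (s≤s z≤n) 2≤s)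
        r≢0 = >-nonZero (≤-trans (s≤s z≤n) lam<r)
        lam≢0 = >-nonZero 1≤lam
        m≢0 = >-nonZero (n≢0⇒n>0 (λ { refl → <⇒≢ (≤-trans (s≤s z≤n) 2<k) m-eq }))

    label-count : ∀ l → count (λ x → B.label x ≟ᶠ l) ≡ s
    label-count l = trans (count-cong _ (class? (B.section l))
      (λ x e → B.label-injective (trans e (sym (B.label-section l)))) (λ x e → trans (B.label-cong e) (B.label-section l)))
      (class-count (B.section l))

    N≡d : B.N ≡ d
    N≡d = *-cancelʳ-≡ B.N d s (trans (sym (trans (count-fibres (λ x → x ≟ᶠ x) (λ l → l ≟ᶠ l) B.label s (λ _ _ → refl)
        (λ l _ → trans (count-cong _ (λ x → B.label x ≟ᶠ l) (λ _ → proj₂) (λ _ e → refl , e)) (label-count l)))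
      (cong (_* s) (count-all (λ l → l ≟ᶠ l) (λ _ → refl))))) (trans (count-all (λ x → x ≟ᶠ x) (λ _ → refl)) v≡))

    design : ImprimitiveDesign
    design = record
      { Γ = B.Γ ; v = v ; nb = b D ; N = B.N ; points = B.points ; blocks = B.blocks ; classes = B.classes
      ; I = I ; I? = I? ; cl = B.label ; cl-act = B.label-act ; I-act = λ g → B.I-⋆ g ; faithful = B.faithful
      ; flag-transitive = λ {x} {j} {y} {l} i i′ → B.flag-⋆ ft (lookup⇒[]= x (block D j) i) (lookup⇒[]= y (block D l) i′)
      ; k = k ; r = r ; lam = lam ; ℓ = ℓ ; s = s ; m = m ; c₁ = c₁ ; c₂ = c₂ ; h₂ = h₂
      ; block-count = block-count ; point-count = point-count ; pair-count = pair-count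
      ; class-count = label-count
      ; meet-count = λ {x} {j} i → trans (count-cong _ (trace? x j) (λ y (e , i) → B.label-injective e , i)
          (λ y (e , i) → B.label-cong e , i)) (meet-count i)
      ; m-eq = m-eq ; c₁-eq = c₁-eq ; h₂-eq = h₂-eq ; c₂-eq = c₂-eq }

  pair-impossible : ∀ q → Prime (3 + q) → ¬ (3 + 2 * q ∣ (3 + q) * (3 + q) * (1 + q)) →
    lam ≡ 2 → ℓ ∸ 1 ≡ 1 → s ∸ 1 ≡ 5 + 2 * q → d ∸ 1 ≡ 5 + 2 * q → K ≡ 7 + 2 * q → r ≡ 2 * (5 + 2 * q) →
    FiniteFamily G → ⊥
  pair-impossible q pr-p indivisible pl pe ps pd pK pr F =
    PairCase.impossible design (record
      { q = q ; pr = pr-p ; ℓ≡2 = ℓ≡2 ; N≡ = trans N≡d d≡ ; s≡ = s≡ ; r≡ = pr ; m≡ = refl ; h₂≡ = refl ; c₁≡ = refl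
      ; c₂≡ = refl ; indivisible = indivisible })
    where
    ℓ≡2 : ℓ ≡ 2
    ℓ≡2 = ∸1≡⇒≡suc 2≤ℓ pe
    double : ∀ q → suc (5 + 2 * q) ≡ 2 * (3 + q)
    double = solve-∀
    s≡ : s ≡ 2 * (3 + q)
    s≡ = trans (∸1≡⇒≡suc 2≤s ps) (double q)
    d≡ : d ≡ 2 * (3 + q)
    d≡ = trans (∸1≡⇒≡suc 2≤d pd) (double q)
    eq₁ : ∀ q → (4 + q) * 2 ≡ suc (7 + 2 * q)
    eq₁ = solve-∀
    eq₂ : ∀ q → 2 * (3 + q) * (5 + 2 * q) * 2 ≡ 2 * (3 + q) * (2 * (5 + 2 * q))
    eq₂ = solve-∀
    eq₃ : ∀ q → 2 * ((3 + q) * (3 + q)) * 2 ≡ 2 * (3 + q) * (2 * (3 + q))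
    eq₃ = solve-∀
    open Exceptional F (4 + q) (2 * (3 + q) * (5 + 2 * q)) (2 * ((3 + q) * (3 + q))) (2 * (3 + q))
      (trans (cong ((4 + q) *_) ℓ≡2) (trans (eq₁ q) (sym (trans k≡ (cong suc pK)))))
      (trans (cong (2 * (3 + q) * (5 + 2 * q) *_) ℓ≡2) (trans (eq₂ q) (sym (cong₂ _*_ s≡ pr))))
      (trans (cong (2 * (3 + q) *_) ℓ≡2) (sym (cong₂ _*_ s≡ pl)))
      (trans (cong (2 * ((3 + q) * (3 + q)) *_) ℓ≡2) (trans (eq₃ q) (cong (_* (2 * (3 + q))) (sym s≡))))

  triple-impossible′ : lam ≡ 5 → ℓ ∸ 1 ≡ 2 → s ∸ 1 ≡ 110 → d ∸ 1 ≡ 110 → K ≡ 224 → r ≡ 275 → b D ≡ 15059 →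
    FiniteFamily G → ⊥
  triple-impossible′ pl pe ps pd pK pr pb F = triple-impossible design (record
    { p = 37 ; p≡ = refl ; pr = from-yes (prime? 37) ; ℓ≡3 = ℓ≡3 ; N≡ = trans N≡d (∸1≡⇒≡suc 2≤d pd) ; s≡ = s≡ ; r≡ = pr
    ; b≡ = pb ; m≡ = refl ; h₂≡ = refl ; c₁≡ = refl ; c₂≡ = refl })
    where
    ℓ≡3 : ℓ ≡ 3
    ℓ≡3 = ∸1≡⇒≡suc 2≤ℓ pe
    s≡ : s ≡ 111
    s≡ = ∸1≡⇒≡suc 2≤s ps
    open Exceptional F 75 10175 6845 185
      (trans (cong (75 *_) ℓ≡3) (sym (trans k≡ (cong suc pK))))
      (trans (cong (10175 *_) ℓ≡3) (sym (cong₂ _*_ s≡ pr)))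
      (trans (cong (185 *_) ℓ≡3) (sym (cong₂ _*_ s≡ pl)))
      (trans (cong (6845 *_) ℓ≡3) (sym (cong (_* 185) s≡)))

  from : Outcome → (k ≤ 2 * lam ^ 2 * (lam ∸ 1)) × (v ≤ (2 * lam ^ 2 * (lam ∸ 1) ∸ 2) ^ 2)
  from (small h) = subst (_≤ 2 * lam ^ 2 * (lam ∸ 1)) (sym k≡) h ,
    ≤-trans (≤-reflexive v≡′) (≤-trans v≤[k-2]² (^-monoˡ-≤ 2 (∸-monoˡ-≤ 2 h)))
  -- q = p - 3. For p = 5, 2p - 3 = 7 does not divide p²(p - 2) = 75; for p = 11 below, 19 does not
  -- divide 1089.
  from (case₁₀ pl pe ps pd pK pr) = ⊥-elim (¬¬-finiteFamily G
    (pair-impossible 2 (from-yes (prime? 5)) (from-no (7 ∣? 75)) pl pe ps pd pK pr))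
  from (case₂₂ pl pe ps pd pK pr) = ⊥-elim (¬¬-finiteFamily G
    (pair-impossible 8 (from-yes (prime? 11)) (from-no (19 ∣? 1089)) pl pe ps pd pK pr))
  from (case₁₁₁ pl pe ps pd pK pr pb) = ⊥-elim (¬¬-finiteFamily G (triple-impossible′ pl pe ps pd pK pr pb))
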